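{- Let $f(X)=a_nX^n+\cdots+a_1X+a_0$ be a polynomial with real coefficients, with $n\ge 1$ and $a_n>0$, and denote by $j_1<j_2<\cdots<j_\ell$ ($\ell\ge 1$) the indices $j$ for which $a_j<0$. Let $\lambda_1,\dots,\lambda_\ell$ be arbitrary positive real numbers with $\lambda_1+\cdots+\lambda_\ell=1$, and define $$v=\max_{1\le i\le \ell}\left(\frac{|a_{j_i}|}{\lambda_i a_n}\right)^{\frac{1}{n-j_i}}.$$ Then $f$ has no zero in the sector $S_{v,\frac{\pi}{n}}$.
   Context: For real numbers $v,\theta$ with $0<\theta\le\pi$, define the open sector $S_{v,\theta}=\{z=v+\rho e^{i\varphi}\in\mathbb{C}:\rho>0,\ |\varphi|<\theta\}$ (with $\varphi$ real). -}

module Defs where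

open import Algebra.Bundles.Raw using (RawRing)
import Algebra.Definitions.RawSemiring as RawSemiringDefs
open import Data.Fin.Base as Fin using (toℕ)
open import Data.Integer.Base using (+_)
open import Data.Nat.Base as ℕ using (ℕ; zero; suc; _!)
import Data.Nat.Properties as ℕ
open import Data.Nat.Properties using (_!≢0)
open import Data.Product.Base using (_×_; _,_; ∃)
open import Data.Rational.Base as ℚ using (ℚ; 0ℚ; 1ℚ; ½)
import Data.Rational.Properties as ℚ
open import Data.Rational.Solver using (module +-*-Solver)
open import Data.Sum.Base using (inj₁; inj₂)
open import Data.Vec.Functional using (Vector; tail)
open import Function.Base using (_∘_)
open import Level using (0ℓ)
open import Relation.Binary.Core using (Rel)
open import Relation.Binary.PropositionalEquality
open import Relation.Nullary using (¬_; yes; no; contradiction)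

module RationalLemmas where

  dist : ℚ → ℚ → ℚ
  dist p q = ℚ.∣ p ℚ.- q ∣

  ε/2+ε/2 : ∀ ε → ½ ℚ.* ε ℚ.+ ½ ℚ.* ε ≡ ε
  ε/2+ε/2 = solve 1 (λ ε → con ½ :* ε :+ con ½ :* ε := ε) refl
    where open +-*-Solver

  *-pos : ∀ {p q} → 0ℚ ℚ.< p → 0ℚ ℚ.< q → 0ℚ ℚ.< p ℚ.* q
  *-pos {p} {q} 0<p 0<q = ℚ.positive⁻¹ (p ℚ.* q)
    {{ℚ.pos*pos⇒pos p {{ℚ.positive 0<p}} q {{ℚ.positive 0<q}}}}

  ½-pos : ∀ {ε} → 0ℚ ℚ.< ε → 0ℚ ℚ.< ½ ℚ.* ε
  ½-pos = *-pos (ℚ.positive⁻¹ ½)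

  *-mono-≤-nonNeg : ∀ {p q r s} → 0ℚ ℚ.≤ r → 0ℚ ℚ.≤ q →
                    p ℚ.≤ q → r ℚ.≤ s → p ℚ.* r ℚ.≤ q ℚ.* s
  *-mono-≤-nonNeg {p} {q} {r} {s} 0≤r 0≤q p≤q r≤s = ℚ.≤-trans
    (ℚ.*-monoʳ-≤-nonNeg r {{ℚ.nonNegative 0≤r}} p≤q)
    (ℚ.*-monoˡ-≤-nonNeg q {{ℚ.nonNegative 0≤q}} r≤s)

  p≤∣p∣ : ∀ p → p ℚ.≤ ℚ.∣ p ∣
  p≤∣p∣ p with ℚ.≤-total 0ℚ p
  ... | inj₁ 0≤p = ℚ.≤-reflexive (sym (ℚ.0≤p⇒∣p∣≡p 0≤p))
  ... | inj₂ p≤0 = ℚ.≤-trans p≤0 (ℚ.0≤∣p∣ p)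

  dist-sym : ∀ p q → dist p q ≡ dist q p
  dist-sym p q = trans (sym (ℚ.∣-p∣≡∣p∣ (p ℚ.- q))) (cong ℚ.∣_∣ (lemma p q))
    where
    open +-*-Solver
    lemma : ∀ p q → ℚ.- (p ℚ.- q) ≡ q ℚ.- p
    lemma = solve 2 (λ p q → :- (p :- q) := q :- p) refl

  ≤-+dist : ∀ p q → p ℚ.≤ q ℚ.+ dist p q
  ≤-+dist p q = ℚ.≤-trans (ℚ.≤-reflexive (lemma p q)) (ℚ.+-monoʳ-≤ q (p≤∣p∣ (p ℚ.- q)))
    where
    open +-*-Solver
    lemma : ∀ p q → p ≡ q ℚ.+ (p ℚ.- q)
    lemma = solve 2 (λ p q → p := q :+ (p :- q)) refl

  dist-≤ : ∀ {p q d} → p ℚ.≤ q ℚ.+ d → q ℚ.≤ p ℚ.+ d → dist p q ℚ.≤ d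
  dist-≤ {p} {q} {d} p≤q+d q≤p+d with ℚ.∣p∣≡p∨∣p∣≡-p (p ℚ.- q)
  ... | inj₁ eq = subst (ℚ._≤ d) (sym eq)
    (subst (p ℚ.- q ℚ.≤_) (lemma q d) (ℚ.+-monoˡ-≤ (ℚ.- q) p≤q+d))
    where
    open +-*-Solver
    lemma : ∀ q d → (q ℚ.+ d) ℚ.- q ≡ d
    lemma = solve 2 (λ q d → (q :+ d) :- q := d) refl
  ... | inj₂ eq = subst (ℚ._≤ d) (sym eq)
    (subst₂ ℚ._≤_ (lemma₁ p q) (lemma₂ p d) (ℚ.+-monoˡ-≤ (ℚ.- p) q≤p+d))
    where
    open +-*-Solver
    lemma₁ : ∀ p q → q ℚ.- p ≡ ℚ.- (p ℚ.- q)
    lemma₁ = solve 2 (λ p q → q :- p := :- (p :- q)) refl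
    lemma₂ : ∀ p d → (p ℚ.+ d) ℚ.- p ≡ d
    lemma₂ = solve 2 (λ p d → (p :+ d) :- p := d) refl

open RationalLemmas

-- Real numbers: Cauchy sequences of rationals.  The equality is `_≈_`,
-- and the ring operations, absolute value and maximum are termwise.

record ℝ : Set where
  constructor mkℝ
  field
    seq    : ℕ → ℚ
    cauchy : ∀ ε → 0ℚ ℚ.< ε →
             ∃ λ N → ∀ m n → N ℕ.≤ m → N ℕ.≤ n →
             ℚ.∣ seq m ℚ.- seq n ∣ ℚ.< ε

open ℝ public

infix 4 _≈_ _<_ _≤_

_≈_ : Rel ℝ 0ℓ
x ≈ y = ∀ ε → 0ℚ ℚ.< ε →
        ∃ λ N → ∀ n → N ℕ.≤ n → ℚ.∣ seq x n ℚ.- seq y n ∣ ℚ.< ε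

_<_ : Rel ℝ 0ℓ
x < y = ∃ λ ε → 0ℚ ℚ.< ε ×
        ∃ λ N → ∀ n → N ℕ.≤ n → seq x n ℚ.+ ε ℚ.≤ seq y n

_≤_ : Rel ℝ 0ℓ
x ≤ y = ¬ (y < x)

module CauchyLemmas where

  unary : (f : ℚ → ℚ) → (∀ p q → dist (f p) (f q) ℚ.≤ dist p q) → ℝ → ℝ
  unary f f-nonexp x = mkℝ (f ∘ seq x) λ ε 0<ε →
    let (N , x-close) = cauchy x ε 0<ε in
    N , λ m n N≤m N≤n → ℚ.≤-<-trans (f-nonexp _ _) (x-close m n N≤m N≤n)

  binary : (f : ℚ → ℚ → ℚ) →
           (∀ p q r s → dist (f p q) (f r s) ℚ.≤ dist p r ℚ.+ dist q s) →
           ℝ → ℝ → ℝ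
  binary f f-nonexp x y = mkℝ (λ n → f (seq x n) (seq y n)) λ ε 0<ε →
    let (M , x-close) = cauchy x (½ ℚ.* ε) (½-pos 0<ε)
        (N , y-close) = cauchy y (½ ℚ.* ε) (½-pos 0<ε)
    in M ℕ.⊔ N , λ m n ≤m ≤n →
      ℚ.≤-<-trans (f-nonexp _ _ _ _)
        (subst (_ ℚ.<_) (ε/2+ε/2 ε) (ℚ.+-mono-<
          (x-close m n (ℕ.m⊔n≤o⇒m≤o M N ≤m) (ℕ.m⊔n≤o⇒m≤o M N ≤n))
          (y-close m n (ℕ.m⊔n≤o⇒n≤o M N ≤m) (ℕ.m⊔n≤o⇒n≤o M N ≤n))))

  +-nonexp : ∀ p q r s → dist (p ℚ.+ q) (r ℚ.+ s) ℚ.≤ dist p r ℚ.+ dist q s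
  +-nonexp p q r s = subst (λ t → ℚ.∣ t ∣ ℚ.≤ dist p r ℚ.+ dist q s) (lemma p q r s)
    (ℚ.∣p+q∣≤∣p∣+∣q∣ (p ℚ.- r) (q ℚ.- s))
    where
    open +-*-Solver
    lemma : ∀ p q r s → (p ℚ.- r) ℚ.+ (q ℚ.- s) ≡ (p ℚ.+ q) ℚ.- (r ℚ.+ s)
    lemma = solve 4 (λ p q r s → (p :- r) :+ (q :- s) := (p :+ q) :- (r :+ s)) refl

  neg-nonexp : ∀ p q → dist (ℚ.- p) (ℚ.- q) ℚ.≤ dist p q
  neg-nonexp p q = ℚ.≤-reflexive (trans (cong ℚ.∣_∣ (lemma p q)) (dist-sym q p))
    where
    open +-*-Solver
    lemma : ∀ p q → (ℚ.- p) ℚ.- (ℚ.- q) ≡ q ℚ.- p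
    lemma = solve 2 (λ p q → (:- p) :- (:- q) := q :- p) refl

  abs-≤ : ∀ p q → ℚ.∣ p ∣ ℚ.≤ ℚ.∣ q ∣ ℚ.+ dist p q
  abs-≤ p q = subst (λ t → ℚ.∣ t ∣ ℚ.≤ ℚ.∣ q ∣ ℚ.+ dist p q) (lemma p q)
    (ℚ.∣p+q∣≤∣p∣+∣q∣ q (p ℚ.- q))
    where
    open +-*-Solver
    lemma : ∀ p q → q ℚ.+ (p ℚ.- q) ≡ p
    lemma = solve 2 (λ p q → q :+ (p :- q) := p) refl

  abs-nonexp : ∀ p q → dist ℚ.∣ p ∣ ℚ.∣ q ∣ ℚ.≤ dist p q
  abs-nonexp p q = dist-≤ (abs-≤ p q)
    (subst (λ d → ℚ.∣ q ∣ ℚ.≤ ℚ.∣ p ∣ ℚ.+ d) (dist-sym q p) (abs-≤ q p))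

  p≤p+∣q∣ : ∀ p q → p ℚ.≤ p ℚ.+ ℚ.∣ q ∣
  p≤p+∣q∣ p q = subst (ℚ._≤ p ℚ.+ ℚ.∣ q ∣) (ℚ.+-identityʳ p) (ℚ.+-monoʳ-≤ p (ℚ.0≤∣p∣ q))

  ⊔-≤ : ∀ p q r s → p ℚ.⊔ q ℚ.≤ (r ℚ.⊔ s) ℚ.+ (dist p r ℚ.+ dist q s)
  ⊔-≤ p q r s = ℚ.⊔-lub
    (ℚ.≤-trans (≤-+dist p r) (ℚ.+-mono-≤ (ℚ.p≤p⊔q r s) (p≤p+∣q∣ (dist p r) (q ℚ.- s))))
    (ℚ.≤-trans (≤-+dist q s) (ℚ.+-mono-≤ (ℚ.p≤q⊔p r s)
      (subst (dist q s ℚ.≤_) (ℚ.+-comm (dist q s) (dist p r)) (p≤p+∣q∣ (dist q s) (p ℚ.- r)))))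

  ⊔-nonexp : ∀ p q r s → dist (p ℚ.⊔ q) (r ℚ.⊔ s) ℚ.≤ dist p r ℚ.+ dist q s
  ⊔-nonexp p q r s = dist-≤ (⊔-≤ p q r s)
    (subst (λ d → r ℚ.⊔ s ℚ.≤ (p ℚ.⊔ q) ℚ.+ d)
      (cong₂ ℚ._+_ (dist-sym r p) (dist-sym s q)) (⊔-≤ r s p q))

  bounded : ∀ x → ∃ λ B → 0ℚ ℚ.≤ B × ∃ λ N → ∀ n → N ℕ.≤ n → ℚ.∣ seq x n ∣ ℚ.≤ B
  bounded x =
    let (N , x-close) = cauchy x 1ℚ (ℚ.positive⁻¹ 1ℚ) in
    ℚ.∣ seq x N ∣ ℚ.+ 1ℚ ,
    ℚ.+-mono-≤ (ℚ.0≤∣p∣ (seq x N)) (ℚ.nonNegative⁻¹ 1ℚ) ,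
    N , λ n N≤n → ℚ.≤-trans (abs-≤ (seq x n) (seq x N))
      (ℚ.+-monoʳ-≤ ℚ.∣ seq x N ∣ (ℚ.<⇒≤ (x-close n N N≤n ℕ.≤-refl)))

  *-dist : ∀ {K} p q r s → ℚ.∣ q ∣ ℚ.≤ K → ℚ.∣ r ∣ ℚ.≤ K →
           dist (p ℚ.* q) (r ℚ.* s) ℚ.≤ K ℚ.* (dist p r ℚ.+ dist q s)
  *-dist {K} p q r s ∣q∣≤K ∣r∣≤K = begin
    dist (p ℚ.* q) (r ℚ.* s)
      ≡⟨ cong ℚ.∣_∣ (lemma p q r s) ⟩
    ℚ.∣ q ℚ.* (p ℚ.- r) ℚ.+ r ℚ.* (q ℚ.- s) ∣
      ≤⟨ ℚ.∣p+q∣≤∣p∣+∣q∣ (q ℚ.* (p ℚ.- r)) (r ℚ.* (q ℚ.- s)) ⟩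
    ℚ.∣ q ℚ.* (p ℚ.- r) ∣ ℚ.+ ℚ.∣ r ℚ.* (q ℚ.- s) ∣
      ≡⟨ cong₂ ℚ._+_ (ℚ.∣p*q∣≡∣p∣*∣q∣ q (p ℚ.- r)) (ℚ.∣p*q∣≡∣p∣*∣q∣ r (q ℚ.- s)) ⟩
    ℚ.∣ q ∣ ℚ.* dist p r ℚ.+ ℚ.∣ r ∣ ℚ.* dist q s
      ≤⟨ ℚ.+-mono-≤
           (ℚ.*-monoʳ-≤-nonNeg (dist p r) {{ℚ.∣-∣-nonNeg (p ℚ.- r)}} ∣q∣≤K)
           (ℚ.*-monoʳ-≤-nonNeg (dist q s) {{ℚ.∣-∣-nonNeg (q ℚ.- s)}} ∣r∣≤K) ⟩
    K ℚ.* dist p r ℚ.+ K ℚ.* dist q s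
      ≡⟨ ℚ.*-distribˡ-+ K (dist p r) (dist q s) ⟨
    K ℚ.* (dist p r ℚ.+ dist q s) ∎
    where
    open ℚ.≤-Reasoning
    open +-*-Solver
    lemma : ∀ p q r s → p ℚ.* q ℚ.- r ℚ.* s ≡ q ℚ.* (p ℚ.- r) ℚ.+ r ℚ.* (q ℚ.- s)
    lemma = solve 4 (λ p q r s → p :* q :- r :* s := q :* (p :- r) :+ r :* (q :- s)) refl

  upper : ∀ A B → 0ℚ ℚ.≤ A → 0ℚ ℚ.≤ B → ∃ λ K → 0ℚ ℚ.< K × A ℚ.≤ K × B ℚ.≤ K
  upper A B 0≤A 0≤B =
    (A ℚ.⊔ B) ℚ.+ 1ℚ ,
    ℚ.+-mono-≤-< {0ℚ} (ℚ.≤-trans 0≤A (ℚ.p≤p⊔q A B)) (ℚ.positive⁻¹ 1ℚ) ,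
    ℚ.≤-trans (ℚ.p≤p⊔q A B) (step (A ℚ.⊔ B)) ,
    ℚ.≤-trans (ℚ.p≤q⊔p A B) (step (A ℚ.⊔ B))
    where
    step : ∀ C → C ℚ.≤ C ℚ.+ 1ℚ
    step C = subst (ℚ._≤ C ℚ.+ 1ℚ) (ℚ.+-identityʳ C) (ℚ.+-monoʳ-≤ C (ℚ.nonNegative⁻¹ 1ℚ))

  shrink : ∀ K ε → 0ℚ ℚ.< K → 0ℚ ℚ.< ε →
           ∃ λ δ → 0ℚ ℚ.< δ × (∀ {d e} → d ℚ.< δ → e ℚ.< δ → K ℚ.* (d ℚ.+ e) ℚ.< ε)
  shrink K ε 0<K 0<ε =
    ½ ℚ.* ε/K , ½-pos 0<ε/K , λ {d} {e} d<δ e<δ →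
      subst (K ℚ.* (d ℚ.+ e) ℚ.<_) K*ε/K (ℚ.*-monoʳ-<-pos K
        (subst (d ℚ.+ e ℚ.<_) (ε/2+ε/2 ε/K) (ℚ.+-mono-< d<δ e<δ)))
    where
    instance
      K-pos : ℚ.Positive K
      K-pos = ℚ.positive 0<K
      K-nonZero : ℚ.NonZero K
      K-nonZero = ℚ.pos⇒nonZero K
    ε/K = ε ℚ.* ℚ.1/ K
    0<ε/K : 0ℚ ℚ.< ε/K
    0<ε/K = *-pos 0<ε (ℚ.positive⁻¹ (ℚ.1/ K) {{ℚ.1/pos⇒pos K}})
    K*ε/K : K ℚ.* ε/K ≡ ε
    K*ε/K = begin
      K ℚ.* (ε ℚ.* ℚ.1/ K)  ≡⟨ ℚ.*-comm K _ ⟩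
      (ε ℚ.* ℚ.1/ K) ℚ.* K  ≡⟨ ℚ.*-assoc ε _ K ⟩
      ε ℚ.* (ℚ.1/ K ℚ.* K)  ≡⟨ cong (ε ℚ.*_) (ℚ.*-inverseˡ K) ⟩
      ε ℚ.* 1ℚ              ≡⟨ ℚ.*-identityʳ ε ⟩
      ε                     ∎
      where open ≡-Reasoning

  EventuallyBounded : ℚ → ℝ → ℕ → Set
  EventuallyBounded K x N = ∀ n → N ℕ.≤ n → ℚ.∣ seq x n ∣ ℚ.≤ K

  EventuallyWithin : ℚ → (ℕ → ℚ) → ℕ → Set
  EventuallyWithin ε s N = ∀ m n → N ℕ.≤ m → N ℕ.≤ n → dist (s m) (s n) ℚ.< ε

  *-within : ∀ x y {K δ ε N₁ N₂ N₃ N₄} →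
    (∀ {d e} → d ℚ.< δ → e ℚ.< δ → K ℚ.* (d ℚ.+ e) ℚ.< ε) →
    EventuallyBounded K x N₁ → EventuallyBounded K y N₂ →
    EventuallyWithin δ (seq x) N₃ → EventuallyWithin δ (seq y) N₄ →
    EventuallyWithin ε (λ n → seq x n ℚ.* seq y n) ((N₁ ℕ.⊔ N₂) ℕ.⊔ (N₃ ℕ.⊔ N₄))
  *-within x y {N₁ = N₁} {N₂} {N₃} {N₄} δ-small x≤K y≤K x-close y-close m n ≤m ≤n =
    ℚ.≤-<-trans
      (*-dist (seq x m) (seq y m) (seq x n) (seq y n)
        (y≤K m (ℕ.m⊔n≤o⇒n≤o N₁ N₂ (left ≤m)))
        (x≤K n (ℕ.m⊔n≤o⇒m≤o N₁ N₂ (left ≤n))))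
      (δ-small
        (x-close m n (ℕ.m⊔n≤o⇒m≤o N₃ N₄ (right ≤m)) (ℕ.m⊔n≤o⇒m≤o N₃ N₄ (right ≤n)))
        (y-close m n (ℕ.m⊔n≤o⇒n≤o N₃ N₄ (right ≤m)) (ℕ.m⊔n≤o⇒n≤o N₃ N₄ (right ≤n))))
    where
    left : ∀ {o} → (N₁ ℕ.⊔ N₂) ℕ.⊔ (N₃ ℕ.⊔ N₄) ℕ.≤ o → N₁ ℕ.⊔ N₂ ℕ.≤ o
    left = ℕ.m⊔n≤o⇒m≤o (N₁ ℕ.⊔ N₂) (N₃ ℕ.⊔ N₄)
    right : ∀ {o} → (N₁ ℕ.⊔ N₂) ℕ.⊔ (N₃ ℕ.⊔ N₄) ℕ.≤ o → N₃ ℕ.⊔ N₄ ℕ.≤ o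
    right = ℕ.m⊔n≤o⇒n≤o (N₁ ℕ.⊔ N₂) (N₃ ℕ.⊔ N₄)

  *-cauchy : ∀ x y ε → 0ℚ ℚ.< ε →
             ∃ (EventuallyWithin ε (λ n → seq x n ℚ.* seq y n))
  *-cauchy x y ε 0<ε =
    let (A , 0≤A , N₁ , x≤A) = bounded x
        (B , 0≤B , N₂ , y≤B) = bounded y
        (K , 0<K , A≤K , B≤K) = upper A B 0≤A 0≤B
        (δ , 0<δ , δ-small) = shrink K ε 0<K 0<ε
        (N₃ , x-close) = cauchy x δ 0<δ
        (N₄ , y-close) = cauchy y δ 0<δ
    in (N₁ ℕ.⊔ N₂) ℕ.⊔ (N₃ ℕ.⊔ N₄) ,
       *-within x y {K} {δ} {ε} {N₁} {N₂} {N₃} {N₄} δ-small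
         (λ n ≤n → ℚ.≤-trans (x≤A n ≤n) A≤K) (λ n ≤n → ℚ.≤-trans (y≤B n ≤n) B≤K)
         x-close y-close

open CauchyLemmas

infix  8 -_
infixl 7 _*_
infixl 6 _+_ _-_ _⊔_

fromℚ : ℚ → ℝ
fromℚ p = mkℝ (λ _ → p) λ ε 0<ε →
  0 , λ _ _ _ _ → subst (ℚ._< ε) (cong ℚ.∣_∣ (sym (ℚ.+-inverseʳ p))) 0<ε

0ℝ 1ℝ : ℝ
0ℝ = fromℚ 0ℚ
1ℝ = fromℚ 1ℚ

_+_ : ℝ → ℝ → ℝ
_+_ = binary ℚ._+_ +-nonexp

-_ : ℝ → ℝ
-_ = unary (ℚ.-_) neg-nonexp

_-_ : ℝ → ℝ → ℝ
x - y = x + (- y)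

∣_∣ : ℝ → ℝ
∣_∣ = unary ℚ.∣_∣ abs-nonexp

_⊔_ : ℝ → ℝ → ℝ
_⊔_ = binary ℚ._⊔_ ⊔-nonexp

_*_ : ℝ → ℝ → ℝ
x * y = mkℝ (λ n → seq x n ℚ.* seq y n) (*-cauchy x y)

-- The value 0 at 0 is immaterial below: `inv` is only applied to reals
-- whose terms are eventually bounded away from 0.
recip : ℚ → ℚ
recip p with p ℚ.≟ 0ℚ
... | yes _  = 0ℚ
... | no p≢0 = ℚ.1/_ p {{ℚ.≢-nonZero p≢0}}

module RecipLemmas where

  recip-inverse : ∀ p → 0ℚ ℚ.< p → recip p ℚ.* p ≡ 1ℚ
  recip-inverse p 0<p with p ℚ.≟ 0ℚ
  ... | yes p≡0 = contradiction (sym p≡0) (ℚ.<⇒≢ 0<p)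
  ... | no  p≢0 = ℚ.*-inverseˡ p {{ℚ.≢-nonZero p≢0}}

  recip-dist : ∀ {η} p q → 0ℚ ℚ.< η → η ℚ.≤ p → η ℚ.≤ q →
               dist (recip p) (recip q) ℚ.* (η ℚ.* η) ℚ.≤ dist p q
  recip-dist {η} p q 0<η η≤p η≤q = begin
    dist (recip p) (recip q) ℚ.* (η ℚ.* η)
      ≤⟨ ℚ.*-monoˡ-≤-nonNeg (dist (recip p) (recip q))
           {{ℚ.∣-∣-nonNeg (recip p ℚ.- recip q)}}
           (*-mono-≤-nonNeg 0≤η (ℚ.≤-trans 0≤η η≤p) η≤p η≤q) ⟩
    dist (recip p) (recip q) ℚ.* (p ℚ.* q)
      ≡⟨ cong (dist (recip p) (recip q) ℚ.*_) (ℚ.0≤p⇒∣p∣≡p 0≤pq) ⟨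
    dist (recip p) (recip q) ℚ.* ℚ.∣ p ℚ.* q ∣
      ≡⟨ ℚ.∣p*q∣≡∣p∣*∣q∣ (recip p ℚ.- recip q) (p ℚ.* q) ⟨
    ℚ.∣ (recip p ℚ.- recip q) ℚ.* (p ℚ.* q) ∣
      ≡⟨ cong ℚ.∣_∣ lemma ⟩
    dist q p
      ≡⟨ dist-sym q p ⟩
    dist p q ∎
    where
    open ℚ.≤-Reasoning
    0≤η = ℚ.<⇒≤ 0<η
    0<p = ℚ.<-≤-trans 0<η η≤p
    0<q = ℚ.<-≤-trans 0<η η≤q
    0≤pq = ℚ.<⇒≤ (*-pos 0<p 0<q)
    expand : ∀ r s p q → (r ℚ.- s) ℚ.* (p ℚ.* q) ≡ (r ℚ.* p) ℚ.* q ℚ.- (s ℚ.* q) ℚ.* p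
    expand = solve 4 (λ r s p q →
      (r :- s) :* (p :* q) := (r :* p) :* q :- (s :* q) :* p) refl
      where open +-*-Solver
    lemma : (recip p ℚ.- recip q) ℚ.* (p ℚ.* q) ≡ q ℚ.- p
    lemma = trans (expand (recip p) (recip q) p q) (cong₂ ℚ._-_
      (trans (cong (ℚ._* q) (recip-inverse p 0<p)) (ℚ.*-identityˡ q))
      (trans (cong (ℚ._* p) (recip-inverse q 0<q)) (ℚ.*-identityˡ p)))

open RecipLemmas

inv : (x : ℝ) → 0ℝ < x → ℝ
inv x (η , 0<η , N₁ , x≥η) = mkℝ (recip ∘ seq x) λ ε 0<ε →
  let (N₂ , x-close) = cauchy x (ε ℚ.* (η ℚ.* η)) (*-pos 0<ε 0<η²) in
  N₁ ℕ.⊔ N₂ , λ m n ≤m ≤n →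
    ℚ.*-cancelʳ-<-nonNeg (η ℚ.* η) {{ℚ.nonNegative (ℚ.<⇒≤ 0<η²)}}
      (ℚ.≤-<-trans
        (recip-dist (seq x m) (seq x n) 0<η
          (η≤x m (ℕ.m⊔n≤o⇒m≤o N₁ N₂ ≤m)) (η≤x n (ℕ.m⊔n≤o⇒m≤o N₁ N₂ ≤n)))
        (x-close m n (ℕ.m⊔n≤o⇒n≤o N₁ N₂ ≤m) (ℕ.m⊔n≤o⇒n≤o N₁ N₂ ≤n)))
  where
  0<η² : 0ℚ ℚ.< η ℚ.* η
  0<η² = *-pos 0<η 0<η
  η≤x : ∀ n → N₁ ℕ.≤ n → η ℚ.≤ seq x n
  η≤x n N₁≤n = subst (ℚ._≤ seq x n) (ℚ.+-identityˡ η) (x≥η n N₁≤n)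

infixl 7 _/_[_] _/ₙ_

_/_[_] : (x y : ℝ) → 0ℝ < y → ℝ
x / y [ 0<y ] = x * inv y 0<y

_/ₙ_ : ℝ → (n : ℕ) .{{_ : ℕ.NonZero n}} → ℝ
x /ₙ n = x * fromℚ (+ 1 ℚ./ n)

0<-* : ∀ x y → 0ℝ < x → 0ℝ < y → 0ℝ < x * y
0<-* x y (ε , 0<ε , M , x≥ε) (δ , 0<δ , N , y≥δ) =
  ε ℚ.* δ , *-pos 0<ε 0<δ , M ℕ.⊔ N , λ n ≤n →
    let ε≤x = subst (ℚ._≤ seq x n) (ℚ.+-identityˡ ε) (x≥ε n (ℕ.m⊔n≤o⇒m≤o M N ≤n))
        δ≤y = subst (ℚ._≤ seq y n) (ℚ.+-identityˡ δ) (y≥δ n (ℕ.m⊔n≤o⇒n≤o M N ≤n))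
    in subst (ℚ._≤ seq x n ℚ.* seq y n) (sym (ℚ.+-identityˡ (ε ℚ.* δ)))
         (*-mono-≤-nonNeg (ℚ.<⇒≤ 0<δ) (ℚ.≤-trans (ℚ.<⇒≤ 0<ε) ε≤x) ε≤x δ≤y)

max : ∀ {ℓ} .{{_ : ℕ.NonZero ℓ}} → Vector ℝ ℓ → ℝ
max {suc zero}    x = x Fin.zero
max {suc (suc ℓ)} x = x Fin.zero ⊔ max (tail x)

ℝ-rawRing : RawRing 0ℓ 0ℓ
ℝ-rawRing = record
  { Carrier = ℝ ; _≈_ = _≈_ ; _+_ = _+_ ; _*_ = _*_ ; -_ = -_ ; 0# = 0ℝ ; 1# = 1ℝ }

open RawSemiringDefs (RawRing.rawSemiring ℝ-rawRing) public
  using (sum; _^_)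

-- r = x^(1/d), for x ≥ 0 and d ≥ 1: the non-negative d-th root is unique.
IsRoot : ℕ → ℝ → ℝ → Set
IsRoot d x r = 0ℝ ≤ r × r ^ d ≈ x

record ℂ : Set where
  constructor _+i_
  field
    re im : ℝ

open ℂ public

infix  4 _≈ᶜ_ _⟶_
infix  8 -ᶜ_
infixl 7 _*ᶜ_
infixl 6 _+ᶜ_

_≈ᶜ_ : Rel ℂ 0ℓ
z ≈ᶜ w = re z ≈ re w × im z ≈ im w

_+ᶜ_ : ℂ → ℂ → ℂ
z +ᶜ w = (re z + re w) +i (im z + im w)

-ᶜ_ : ℂ → ℂ
-ᶜ z = (- re z) +i (- im z)

_*ᶜ_ : ℂ → ℂ → ℂ
z *ᶜ w = (re z * re w - im z * im w) +i (re z * im w + im z * re w)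

fromℝ : ℝ → ℂ
fromℝ x = x +i 0ℝ

0ℂ 1ℂ : ℂ
0ℂ = fromℝ 0ℝ
1ℂ = fromℝ 1ℝ

ℂ-rawRing : RawRing 0ℓ 0ℓ
ℂ-rawRing = record
  { Carrier = ℂ ; _≈_ = _≈ᶜ_ ; _+_ = _+ᶜ_ ; _*_ = _*ᶜ_ ; -_ = -ᶜ_ ; 0# = 0ℂ ; 1# = 1ℂ }

open RawSemiringDefs (RawRing.rawSemiring ℂ-rawRing) public
  using () renaming (sum to sumᶜ; _^_ to _^ᶜ_)

-- The coefficient of X^k is `a k`.
eval : ∀ {m} → Vector ℝ m → ℂ → ℂ
eval a z = sumᶜ λ k → fromℝ (a k) *ᶜ z ^ᶜ toℕ k

_⟶_ : (ℕ → ℂ) → ℂ → Set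
s ⟶ w = ∀ ε → 0ℚ ℚ.< ε → ∃ λ N → ∀ n → N ℕ.≤ n →
        ∣ re (s n) - re w ∣ < fromℚ ε × ∣ im (s n) - im w ∣ < fromℚ ε

expTerm : ℂ → ℕ → ℂ
expTerm z k = fromℝ (fromℚ (+ 1 ℚ./ (k !))) *ᶜ z ^ᶜ k
  where instance _ = k !≢0

expPartial : ℂ → ℕ → ℂ
expPartial z N = sumᶜ {N} (expTerm z ∘ toℕ)

-- w = e^z, i.e. w is the sum of the series ∑ z^k / k!.
IsExp : ℂ → ℂ → Set
IsExp z w = expPartial z ⟶ w

-- Cosine, cos h = Re e^{ih}, has exactly one zero in [0,2]; π is twice it.
IsPi : ℝ → Set
IsPi π = ∃ λ h → ∃ λ w →
  π ≈ h + h × 0ℝ ≤ h × h ≤ fromℚ (+ 2 ℚ./ 1) × IsExp (0ℝ +i h) w × re w ≈ 0ℝ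

Sector : ℝ → ℝ → ℂ → Set
Sector v θ z = ∃ λ ρ → ∃ λ φ → ∃ λ e^iφ →
  0ℝ < ρ × ∣ φ ∣ < θ × IsExp (0ℝ +i φ) e^iφ × z ≈ᶜ fromℝ v +ᶜ fromℝ ρ *ᶜ e^iφ

{-# OPTIONS --safe #-}

-- Write z = v + y with y = ρ e^{iφ}.  Splitting aₙ z^n as Σ λᵢ aₙ z^n and pairing each part with the
-- negative term a_j z^j, j = jᵢ, gives λᵢ aₙ z^j (z^{n−j} − rᵢ^{n−j}) with rᵢ ≤ v, which is a
-- polynomial in y with nonnegative coefficients and leading coefficient λᵢ aₙ.  Hence
-- f(z) = aₙ y^n + (a polynomial in y of degree at most n with nonnegative coefficients).  Since
-- |φ| < π/n, one of the functionals Im, −Im, Re (for φ > 0, φ < 0, φ = 0) is nonnegative on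
-- 1, y, …, y^n and positive on y^n, so it does not vanish at f(z).  The case split is legitimate
-- constructively because the conclusion is a negation.
--
-- Positivity of sine on (0 , π) comes from the power series on (0 , 2] together with the addition
-- theorem for the exponential, which is the Cauchy product of two geometrically dominated series.

module Submission where

open import Algebra.Bundles using (CommutativeRing; CommutativeSemiring)
import Algebra.Properties.CommutativeSemiring.Exp as Exp
import Algebra.Properties.Ring as RingProperties
import Algebra.Properties.Semiring.Sum as Sum
import Algebra.Solver.Ring as RingSolver
open import Algebra.Solver.Ring.AlmostCommutativeRing using (_-Raw-AlmostCommutative⟶_; fromCommutativeRing)
import Algebra.Solver.Ring.NaturalCoefficients.Default as NaturalSolver
open import Algebra.Structures using (IsCommutativeRing)
open import Data.Fin.Base as Fin using (Fin; fromℕ; toℕ; punchIn; punchOut)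
import Data.Fin.Properties as Fin
open import Data.Integer.Base as ℤ using (+_)
import Data.Integer.Properties as ℤ
open import Data.Integer.Solver using () renaming (module +-*-Solver to ℤ-Solver)
open import Data.Maybe.Base using (just; nothing)
open import Data.Nat.Base as ℕ using (ℕ; zero; suc; _∸_; _!; NonZero)
import Data.Nat.Properties as ℕ
open import Data.Nat.Properties using (_!≢0)
open import Data.Product.Base using (_×_; _,_; ∃; proj₁; proj₂)
open import Data.Rational.Base as ℚ using (ℚ; 0ℚ; 1ℚ; ½)
import Data.Rational.Properties as ℚ
open import Data.Rational.Solver using (module +-*-Solver)
open import Data.Rational.Unnormalised.Base as ℚᵘ using (mkℚᵘ; *≤*; *≡*)
import Data.Rational.Unnormalised.Properties as ℚᵘ
open import Data.Sum.Base using (_⊎_; inj₁; inj₂)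
open import Data.Vec.Functional using (Vector; removeAt; tail)
open import Defs using (module RationalLemmas)
open RationalLemmas using (½-pos) renaming (*-pos to *ℚ-pos)
open import Function.Base using (_∘_)
open import Function.Bundles using (_⇔_; Equivalence)
open import Level using (0ℓ)
open import Relation.Binary.Bundles using (Poset)
open import Relation.Binary.Core using (Rel)
open import Relation.Binary.Definitions using (WeaklyDecidable; tri<; tri≈; tri>)
open import Relation.Binary.PropositionalEquality as ≡ using (_≡_; _≢_)
import Relation.Binary.Reasoning.PartialOrder as PosetReasoning
import Relation.Binary.Reasoning.Setoid as SetoidReasoning
open import Relation.Nullary using (¬_; yes; no; contradiction)

-- Three functionals are needed because no single one covers the sector. For l ≤ n the angle l|φ|
-- can come close to π, and Re turns negative past π/2; Im is nonnegative on the whole half turn but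
-- vanishes identically on the real axis, where Re takes over. The obstacle is the order of the
-- reals: `x ≤ y` means `¬ (y < x)`, and neither the sign of φ nor the position of lφ relative to a
-- quarter turn can be decided. Positivity is therefore often carried as `¬ (x ≤ 0#)`, and cases are
-- refuted one after another until the goal `⊥` is reached. What is given about π is that h = π/2 is
-- a zero of cosine in [0,2]. Hence sine is bounded below from its series up to 2, and a reflection
-- at h supplies the rest of the half turn. The analysis is done over an abstract ordered ring, in
-- which a real is an atom for the ring solver and not a Cauchy sequence with its proofs.

Eventually : (ℕ → Set) → Set
Eventually P = ∃ λ N → ∀ n → N ℕ.≤ n → P n

zipᵉ : ∀ {P Q R : ℕ → Set} → (∀ n → P n → Q n → R n) →
       Eventually P → Eventually Q → Eventually R
zipᵉ f (M , p) (N , q) = M ℕ.⊔ N , λ n ≤n →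
  f n (p n (ℕ.m⊔n≤o⇒m≤o M N ≤n)) (q n (ℕ.m⊔n≤o⇒n≤o M N ≤n))

mapᵉ : ∀ {P Q : ℕ → Set} → (∀ n → P n → Q n) → Eventually P → Eventually Q
mapᵉ f (M , p) = M , λ n ≤n → f n (p n ≤n)

alwaysᵉ : ∀ {P : ℕ → Set} → (∀ n → P n) → Eventually P
alwaysᵉ p = 0 , λ n _ → p n

witnessᵉ : ∀ {P : Set} → Eventually (λ _ → P) → P
witnessᵉ (N , p) = p N ℕ.≤-refl

natℚ : ℕ → ℚ
natℚ k = + k ℚ./ 1

-- Axioms for the ordered ring of reals

-- Limits enter through hypotheses such as `IsExpSum`, so the order laws with `archimedean` and
-- `≤-closed` suffice for the analysis. `_≤_` is defined as a negation, as in the concrete reals, so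
-- that an inequality can be applied to a proof of the reverse strict one.
record ArchimedeanRing : Set₁ where
  infix 4 _<_ _≤_
  field
    commutativeRing : CommutativeRing 0ℓ 0ℓ
  open CommutativeRing commutativeRing public hiding (zero)
  field
    fromℚ        : ℚ → Carrier
    fromℚ-+      : ∀ p q → fromℚ (p ℚ.+ q) ≈ fromℚ p + fromℚ q
    fromℚ-*      : ∀ p q → fromℚ (p ℚ.* q) ≈ fromℚ p * fromℚ q
    fromℚ-neg    : ∀ p → fromℚ (ℚ.- p) ≈ - fromℚ p
    fromℚ-0      : fromℚ 0ℚ ≈ 0#
    fromℚ-1      : fromℚ 1ℚ ≈ 1#
    _<_          : Rel Carrier 0ℓ
  _≤_ : Rel Carrier 0ℓ
  x ≤ y = ¬ (y < x)
  field
    ≤-reflexive  : ∀ {x y} → x ≈ y → x ≤ y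
    <⇒≤          : ∀ {x y} → x < y → x ≤ y
    ≤-trans      : ∀ {x y z} → x ≤ y → y ≤ z → x ≤ z
    ≤-<-trans    : ∀ {x y z} → x ≤ y → y < z → x < z
    <-≤-trans    : ∀ {x y z} → x < y → y ≤ z → x < z
    ≤-antisym    : ∀ {x y} → x ≤ y → y ≤ x → x ≈ y
    +-mono-≤     : ∀ {x y u v} → x ≤ y → u ≤ v → x + u ≤ y + v
    *-pos        : ∀ {x y} → 0# < x → 0# < y → 0# < x * y
    fromℚ-mono-< : ∀ {p q} → p ℚ.< q → fromℚ p < fromℚ q
    ∣_∣          : Carrier → Carrier
    ∣-∣-cong     : ∀ {x y} → x ≈ y → ∣ x ∣ ≈ ∣ y ∣
    x≤∣x∣        : ∀ x → x ≤ ∣ x ∣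
    -x≤∣x∣       : ∀ x → - x ≤ ∣ x ∣
    ∣x∣≤         : ∀ {x y} → x ≤ y → - x ≤ y → ∣ x ∣ ≤ y
    ∣x*y∣≤       : ∀ x y → ∣ x * y ∣ ≤ ∣ x ∣ * ∣ y ∣
    archimedean  : ∀ x → ∃ λ K → x ≤ fromℚ (natℚ K)
    ≤-closed     : ∀ {x} → (∀ ε → 0ℚ ℚ.< ε → x ≤ fromℚ ε) → x ≤ 0#

-- Rational arithmetic

module Rationals where
  open ≡ using (refl; sym; cong)

  -- `ℚ._/_` cancels common factors and does not compute on variables; passing to unnormalised
  -- fractions reduces identities to cross multiplication.
  toℚᵘ-/ : ∀ i n .{{_ : ℕ.NonZero n}} → ℚ.toℚᵘ (i ℚ./ n) ℚᵘ.≃ i ℚᵘ./ n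
  toℚᵘ-/ i (suc n) = ℚ.toℚᵘ-fromℚᵘ (mkℚᵘ i n)

  natℚ-suc : ∀ n → natℚ (suc n) ≡ 1ℚ ℚ.+ natℚ n
  natℚ-suc n = ℚ.toℚᵘ-injective (ℚᵘ.≃-trans (toℚᵘ-/ (+ suc n) 1)
    (ℚᵘ.≃-trans (*≡* (cong (λ t → (+ 1 ℤ.+ t) ℤ.* + 1) (sym (ℤ.*-identityʳ (+ n)))))
    (ℚᵘ.≃-sym (ℚᵘ.≃-trans (ℚ.toℚᵘ-homo-+ 1ℚ (natℚ n)) (ℚᵘ.+-congʳ (ℚ.toℚᵘ 1ℚ) (toℚᵘ-/ (+ n) 1))))))

  natℚ-mono : ∀ {m n} → m ℕ.≤ n → natℚ m ℚ.≤ natℚ n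
  natℚ-mono {m} {n} m≤n = ℚ.toℚᵘ-cancel-≤
    (ℚᵘ.≤-respˡ-≃ (ℚᵘ.≃-sym (toℚᵘ-/ (+ m) 1)) (ℚᵘ.≤-respʳ-≃ (ℚᵘ.≃-sym (toℚᵘ-/ (+ n) 1))
      (*≤* (ℤ.*-monoʳ-≤-nonNeg (+ 1) (ℤ.+≤+ m≤n)))))

  1/-* : ∀ m n .{{_ : ℕ.NonZero m}} .{{_ : ℕ.NonZero n}} .{{_ : ℕ.NonZero (m ℕ.* n)}} →
         + 1 ℚ./ (m ℕ.* n) ≡ (+ 1 ℚ./ m) ℚ.* (+ 1 ℚ./ n)
  1/-* (suc m) (suc n) = ℚ.toℚᵘ-injective (ℚᵘ.≃-trans (toℚᵘ-/ (+ 1) (suc m ℕ.* suc n))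
    (ℚᵘ.≃-sym (ℚᵘ.≃-trans (ℚ.toℚᵘ-homo-* (+ 1 ℚ./ suc m) (+ 1 ℚ./ suc n))
      (ℚᵘ.*-cong (toℚᵘ-/ (+ 1) (suc m)) (toℚᵘ-/ (+ 1) (suc n))))))

  natℚ*1/ : ∀ n .{{_ : ℕ.NonZero n}} → natℚ n ℚ.* (+ 1 ℚ./ n) ≡ 1ℚ
  natℚ*1/ (suc n) = ℚ.toℚᵘ-injective (ℚᵘ.≃-trans
    (ℚᵘ.≃-trans (ℚ.toℚᵘ-homo-* (natℚ (suc n)) (+ 1 ℚ./ suc n))
      (ℚᵘ.*-cong (toℚᵘ-/ (+ suc n) 1) (toℚᵘ-/ (+ 1) (suc n))))
    (*≡* (lemma (+ suc n))))
    where
    lemma : ∀ i → (i ℤ.* + 1) ℤ.* + 1 ≡ + 1 ℤ.* (+ 1 ℤ.* i)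
    lemma = solve 1 (λ i → (i :* con (+ 1)) :* con (+ 1) := con (+ 1) :* (con (+ 1) :* i)) refl
      where open ℤ-Solver

  1/-pos : ∀ n .{{_ : ℕ.NonZero n}} → 0ℚ ℚ.< + 1 ℚ./ n
  1/-pos n = ℚ.positive⁻¹ (+ 1 ℚ./ n) {{ℚ.normalize-pos 1 n}}

  1/! : ℕ → ℚ
  1/! k = + 1 ℚ./ (k !)
    where instance _ = k !≢0

  1/!-suc : ∀ k → 1/! (suc k) ≡ (+ 1 ℚ./ suc k) ℚ.* 1/! k
  1/!-suc k = 1/-* (suc k) (k !)
    where instance _ = k !≢0 ; _ = suc k !≢0

  1/!-pos : ∀ k → 0ℚ ℚ.< 1/! k
  1/!-pos k = 1/-pos (k !) {{k !≢0}}

open Rationals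

module ℚ-Solver (S : CommutativeRing 0ℓ 0ℓ)
  (h : ℚ.+-*-rawRing -Raw-AlmostCommutative⟶ fromCommutativeRing S) where
  open CommutativeRing S
  open _-Raw-AlmostCommutative⟶_ h
  coeff≟ : WeaklyDecidable (λ p q → ⟦ p ⟧ ≈ ⟦ q ⟧)
  coeff≟ p q with p ℚ.≟ q
  ... | yes ≡.refl = just refl
  ... | no _       = nothing
  open RingSolver ℚ.+-*-rawRing (fromCommutativeRing S) h coeff≟ public

-- Consequences of the order axioms

module OrderProperties (A : ArchimedeanRing) where
  open ArchimedeanRing A public
  open Exp commutativeSemiring public using (_^_)
  open RingProperties ring public using (-‿involutive; -0#≈0#)

  fromℚ-homo : ℚ.+-*-rawRing -Raw-AlmostCommutative⟶ fromCommutativeRing commutativeRing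
  fromℚ-homo = record
    { ⟦_⟧ = fromℚ ; +-homo = fromℚ-+ ; *-homo = fromℚ-* ; -‿homo = fromℚ-neg
    ; 0-homo = fromℚ-0 ; 1-homo = fromℚ-1 }

  module R-Solver = ℚ-Solver commutativeRing fromℚ-homo

  ≤-poset : Poset 0ℓ 0ℓ 0ℓ
  ≤-poset = record
    { _≤_ = _≤_
    ; isPartialOrder = record
      { isPreorder = record
        { isEquivalence = isEquivalence ; reflexive = ≤-reflexive ; trans = ≤-trans }
      ; antisym = ≤-antisym } }

  ≤-refl : ∀ {x} → x ≤ x
  ≤-refl = ≤-reflexive refl

  ≤-respˡ : ∀ {x y z} → x ≈ y → x ≤ z → y ≤ z
  ≤-respˡ x≈y = ≤-trans (≤-reflexive (sym x≈y))

  ≤-respʳ : ∀ {x y z} → x ≈ y → z ≤ x → z ≤ y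
  ≤-respʳ x≈y z≤x = ≤-trans z≤x (≤-reflexive x≈y)

  +-nonNeg : ∀ {x y} → 0# ≤ x → 0# ≤ y → 0# ≤ x + y
  +-nonNeg 0≤x 0≤y = ≤-respˡ (+-identityˡ 0#) (+-mono-≤ 0≤x 0≤y)

  ≤-by-difference : ∀ {x y d} → y ≈ x + d → 0# ≤ d → x ≤ y
  ≤-by-difference y≈x+d 0≤d =
    ≤-respˡ (+-identityʳ _) (≤-respʳ (sym y≈x+d) (+-mono-≤ ≤-refl 0≤d))

  x≤y⇒0≤y-x : ∀ {x y} → x ≤ y → 0# ≤ y - x
  x≤y⇒0≤y-x {x} x≤y = ≤-respˡ (-‿inverseʳ x) (+-mono-≤ x≤y ≤-refl)

  neg-antimono : ∀ {x y} → x ≤ y → - y ≤ - x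
  neg-antimono {x} {y} x≤y = ≤-by-difference
    (solve 2 (λ x y → :- x := :- y :+ (y :- x)) refl x y) (x≤y⇒0≤y-x x≤y)
    where open R-Solver

  -- Neither factor can be split into zero or positive. A nonnegative factor that is not positive is
  -- zero by antisymmetry, and then the product is not negative; so both are positive up to double
  -- negation, which suffices for the goal `⊥`.
  *-nonNeg : ∀ {x y} → 0# ≤ x → 0# ≤ y → 0# ≤ x * y
  *-nonNeg {x} {y} 0≤x 0≤y xy<0 = ¬0<x λ 0<x → ¬0<y λ 0<y → <⇒≤ (*-pos 0<x 0<y) xy<0
    where
    ¬0<x : ¬ ¬ (0# < x)
    ¬0<x h = ≤-reflexive (sym (trans (*-congʳ (≤-antisym h 0≤x)) (zeroˡ y))) xy<0
    ¬0<y : ¬ ¬ (0# < y)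
    ¬0<y h = ≤-reflexive (sym (trans (*-congˡ (≤-antisym h 0≤y)) (zeroʳ x))) xy<0

  *-monoˡ-≤ : ∀ {c x y} → 0# ≤ c → x ≤ y → c * x ≤ c * y
  *-monoˡ-≤ {c} {x} {y} 0≤c x≤y = ≤-by-difference
    (solve 3 (λ c x y → c :* y := c :* x :+ c :* (y :- x)) refl c x y)
    (*-nonNeg 0≤c (x≤y⇒0≤y-x x≤y))
    where open R-Solver

  *-monoʳ-≤ : ∀ {c x y} → 0# ≤ c → x ≤ y → x * c ≤ y * c
  *-monoʳ-≤ 0≤c x≤y = ≤-respˡ (*-comm _ _) (≤-respʳ (*-comm _ _) (*-monoˡ-≤ 0≤c x≤y))

  *-mono-≤ : ∀ {x y u v} → 0# ≤ x → 0# ≤ v → x ≤ y → u ≤ v → x * u ≤ y * v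
  *-mono-≤ 0≤x 0≤v x≤y u≤v = ≤-trans (*-monoˡ-≤ 0≤x u≤v) (*-monoʳ-≤ 0≤v x≤y)

  fromℚ-pos : ∀ {p} → 0ℚ ℚ.< p → 0# < fromℚ p
  fromℚ-pos 0<p = ≤-<-trans (≤-reflexive (sym fromℚ-0)) (fromℚ-mono-< 0<p)

  fromℚ-mono-≤ : ∀ {p q} → p ℚ.≤ q → fromℚ p ≤ fromℚ q
  fromℚ-mono-≤ {p} {q} p≤q with ℚ.<-cmp p q
  ... | tri< p<q _ _    = <⇒≤ (fromℚ-mono-< p<q)
  ... | tri≈ _ ≡.refl _ = ≤-refl
  ... | tri> _ _ q<p    = contradiction (ℚ.≤-<-trans p≤q q<p) (ℚ.<-irrefl ≡.refl)

  fromℚ-nonNeg : ∀ {p} → 0ℚ ℚ.≤ p → 0# ≤ fromℚ p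
  fromℚ-nonNeg 0≤p = ≤-respˡ fromℚ-0 (fromℚ-mono-≤ 0≤p)

  0<1 : 0# < 1#
  0<1 = <-≤-trans (fromℚ-pos (ℚ.positive⁻¹ 1ℚ)) (≤-reflexive fromℚ-1)

  ^-nonNeg : ∀ {x} → 0# ≤ x → ∀ n → 0# ≤ x ^ n
  ^-nonNeg 0≤x zero    = <⇒≤ 0<1
  ^-nonNeg 0≤x (suc n) = *-nonNeg 0≤x (^-nonNeg 0≤x n)

  ^-pos : ∀ {x} → 0# < x → ∀ n → 0# < x ^ n
  ^-pos 0<x zero    = 0<1
  ^-pos 0<x (suc n) = *-pos 0<x (^-pos 0<x n)

-- Complex multiplication in coordinates

module ComplexMultiplication (A : ArchimedeanRing) where
  private module A = OrderProperties A
  open A using (_≈_; _+_; _*_; -_; _-_; 0#; 1#; refl; trans)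
  open A.R-Solver

  re-assoc : ∀ a b c d e f →
    (a * c - b * d) * e - (a * d + b * c) * f ≈ a * (c * e - d * f) - b * (c * f + d * e)
  re-assoc = solve 6 (λ a b c d e f →
    (a :* c :- b :* d) :* e :- (a :* d :+ b :* c) :* f :=
    a :* (c :* e :- d :* f) :- b :* (c :* f :+ d :* e)) refl

  im-assoc : ∀ a b c d e f →
    (a * c - b * d) * f + (a * d + b * c) * e ≈ a * (c * f + d * e) + b * (c * e - d * f)
  im-assoc = solve 6 (λ a b c d e f →
    (a :* c :- b :* d) :* f :+ (a :* d :+ b :* c) :* e :=
    a :* (c :* f :+ d :* e) :+ b :* (c :* e :- d :* f)) refl

  re-comm : ∀ a b c d → a * c - b * d ≈ c * a - d * b
  re-comm = solve 4 (λ a b c d → a :* c :- b :* d := c :* a :- d :* b) refl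

  im-comm : ∀ a b c d → a * d + b * c ≈ c * b + d * a
  im-comm = solve 4 (λ a b c d → a :* d :+ b :* c := c :* b :+ d :* a) refl

  re-distribˡ : ∀ a b c d e f → a * (c + e) - b * (d + f) ≈ (a * c - b * d) + (a * e - b * f)
  re-distribˡ = solve 6 (λ a b c d e f →
    a :* (c :+ e) :- b :* (d :+ f) := (a :* c :- b :* d) :+ (a :* e :- b :* f)) refl

  im-distribˡ : ∀ a b c d e f → a * (d + f) + b * (c + e) ≈ (a * d + b * c) + (a * f + b * e)
  im-distribˡ = solve 6 (λ a b c d e f →
    a :* (d :+ f) :+ b :* (c :+ e) := (a :* d :+ b :* c) :+ (a :* f :+ b :* e)) refl

  re-distribʳ : ∀ a b c d e f → (c + e) * a - (d + f) * b ≈ (c * a - d * b) + (e * a - f * b)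
  re-distribʳ = solve 6 (λ a b c d e f →
    (c :+ e) :* a :- (d :+ f) :* b := (c :* a :- d :* b) :+ (e :* a :- f :* b)) refl

  im-distribʳ : ∀ a b c d e f → (c + e) * b + (d + f) * a ≈ (c * b + d * a) + (e * b + f * a)
  im-distribʳ = solve 6 (λ a b c d e f →
    (c :+ e) :* b :+ (d :+ f) :* a := (c :* b :+ d :* a) :+ (e :* b :+ f :* a)) refl

  re-identityˡ : ∀ a b → 1# * a - 0# * b ≈ a
  re-identityˡ a b = trans (A.+-cong (A.*-identityˡ a) (trans (A.-‿cong (A.zeroˡ b)) A.-0#≈0#)) (A.+-identityʳ a)

  im-identityˡ : ∀ a b → 1# * b + 0# * a ≈ b
  im-identityˡ a b = trans (A.+-cong (A.*-identityˡ b) (A.zeroˡ a)) (A.+-identityʳ b)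

  re-identityʳ : ∀ a b → a * 1# - b * 0# ≈ a
  re-identityʳ a b = trans (re-comm a b 1# 0#) (re-identityˡ a b)

  im-identityʳ : ∀ a b → a * 0# + b * 1# ≈ b
  im-identityʳ a b = trans (im-comm a b 1# 0#) (im-identityˡ a b)

-- Formal power series and the Cauchy product

module CauchyProduct (S : CommutativeSemiring 0ℓ 0ℓ) where
  open CommutativeSemiring S
  open Sum semiring using (sum; ∑-distrib-+; *-distribˡ-sum)
  open NaturalSolver S
  open SetoidReasoning setoid

  Σ< : (ℕ → Carrier) → ℕ → Carrier
  Σ< a N = sum {N} (a ∘ toℕ)

  Σ<-cong : ∀ {a b} → (∀ k → a k ≈ b k) → ∀ N → Σ< a N ≈ Σ< b N
  Σ<-cong h zero    = refl
  Σ<-cong h (suc N) = +-cong (h 0) (Σ<-cong (h ∘ suc) N)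

  ν : ℕ → Carrier
  ν zero    = 0#
  ν (suc n) = 1# + ν n

  -- The coefficients of a product of formal power series. The recursion splits off the constant
  -- coefficient of the first factor, so that every law becomes an induction with `a ∘ suc`.
  conv : (ℕ → Carrier) → (ℕ → Carrier) → ℕ → Carrier
  conv a b zero    = a 0 * b 0
  conv a b (suc k) = a 0 * b (suc k) + conv (a ∘ suc) b k

  conv-congˡ : ∀ {a a′} → (∀ k → a k ≈ a′ k) → ∀ b k → conv a b k ≈ conv a′ b k
  conv-congˡ h b zero    = *-congʳ (h 0)
  conv-congˡ h b (suc k) = +-cong (*-congʳ (h 0)) (conv-congˡ (h ∘ suc) b k)

  conv-congʳ : ∀ a {b b′} → (∀ k → b k ≈ b′ k) → ∀ k → conv a b k ≈ conv a b′ k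
  conv-congʳ a h zero    = *-congˡ (h 0)
  conv-congʳ a h (suc k) = +-cong (*-congˡ (h (suc k))) (conv-congʳ (a ∘ suc) h k)

  conv-+ˡ : ∀ a a′ b k → conv (λ i → a i + a′ i) b k ≈ conv a b k + conv a′ b k
  conv-+ˡ a a′ b zero    = distribʳ _ _ _
  conv-+ˡ a a′ b (suc k) = trans (+-congˡ (conv-+ˡ (a ∘ suc) (a′ ∘ suc) b k))
    (solve 5 (λ x y b u v → (x :+ y) :* b :+ (u :+ v) := (x :* b :+ u) :+ (y :* b :+ v))
      refl _ _ _ _ _)

  conv-*ˡ : ∀ c a b k → conv (λ i → c * a i) b k ≈ c * conv a b k
  conv-*ˡ c a b zero    = *-assoc _ _ _
  conv-*ˡ c a b (suc k) = trans (+-congˡ (conv-*ˡ c (a ∘ suc) b k))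
    (solve 4 (λ c x b u → (c :* x) :* b :+ c :* u := c :* (x :* b :+ u)) refl _ _ _ _)

  conv-*ʳ : ∀ c a b k → conv a (λ i → c * b i) k ≈ c * conv a b k
  conv-*ʳ c a b zero    = solve 3 (λ c x b → x :* (c :* b) := c :* (x :* b)) refl _ _ _
  conv-*ʳ c a b (suc k) = trans (+-congˡ (conv-*ʳ c (a ∘ suc) b k))
    (solve 4 (λ c x b u → x :* (c :* b) :+ c :* u := c :* (x :* b :+ u)) refl _ _ _ _)

  derivative : (ℕ → Carrier) → ℕ → Carrier
  derivative a k = ν (suc k) * a (suc k)

  -- The Leibniz rule. On the part of the convolution that comes from the tail `a ∘ suc`, write the
  -- factor k + 2 as 1 + n: the induction hypothesis treats n, and the remaining single copy is the
  -- extra summand in (X T)′ = T + X T′ for the tail series T.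
  derivative-conv : ∀ a b k →
    derivative (conv a b) k ≈ conv (derivative a) b k + conv a (derivative b) k
  derivative-conv a b zero =
    solve 4 (λ a₀ a₁ b₀ b₁ → one :* (a₀ :* b₁ :+ a₁ :* b₀) :=
      (one :* a₁) :* b₀ :+ a₀ :* (one :* b₁)) refl (a 0) (a 1) (b 0) (b 1)
    where
    one : ∀ {n} → Polynomial n
    one = con 1 :+ con 0
  derivative-conv a b (suc k) = begin
    (1# + n) * (a 0 * b (2 ℕ.+ k) + conv a′ b (suc k))
      ≈⟨ solve 4 (λ n x b u → (con 1 :+ n) :* (x :* b :+ u) :=
           ((con 1 :+ n) :* (x :* b) :+ u) :+ n :* u) refl _ _ _ _ ⟩
    ((1# + n) * (a 0 * b (2 ℕ.+ k)) + conv a′ b (suc k)) + n * conv a′ b (suc k)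
      ≈⟨ +-congˡ (derivative-conv a′ b k) ⟩
    ((1# + n) * (a 0 * b (2 ℕ.+ k)) + (a 1 * b (suc k) + conv (a′ ∘ suc) b k)) +
      (conv (derivative a′) b k + conv a′ (derivative b) k)
      ≈⟨ solve 8 (λ n a₀ a₁ b₁ b₂ u v w →
           ((con 1 :+ n) :* (a₀ :* b₂) :+ (a₁ :* b₁ :+ u)) :+ (v :+ w) :=
           ((con 1 :+ con 0) :* a₁ :* b₁ :+ (u :+ v)) :+ (a₀ :* ((con 1 :+ n) :* b₂) :+ w))
           refl _ _ _ _ _ _ _ _ ⟩
    (derivative a 0 * b (suc k) + (conv (a′ ∘ suc) b k + conv (derivative a′) b k)) +
      conv a (derivative b) (suc k)
      ≈⟨ +-congʳ (+-congˡ (sym (conv-+ˡ (a′ ∘ suc) (derivative a′) b k))) ⟩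
    (derivative a 0 * b (suc k) + conv (λ i → a′ (suc i) + derivative a′ i) b k) +
      conv a (derivative b) (suc k)
      ≈⟨ +-congʳ (+-congˡ (conv-congˡ shift b k)) ⟩
    conv (derivative a) b (suc k) + conv a (derivative b) (suc k) ∎
    where
    a′ = a ∘ suc
    n = ν (suc k)
    shift : ∀ i → a′ (suc i) + derivative a′ i ≈ derivative a (suc i)
    shift i = solve 2 (λ n x → x :+ n :* x := (con 1 :+ n) :* x) refl (ν (suc i)) (a (2 ℕ.+ i))

  -- The products `a i * b k` with i + k < N, collected by i. `Σ<-conv` collects the same triangle
  -- along its antidiagonals, where it is a partial sum of the Cauchy product.
  partialConv : (ℕ → Carrier) → (ℕ → Carrier) → ℕ → Carrier
  partialConv a b zero    = 0#
  partialConv a b (suc N) = a 0 * Σ< b (suc N) + partialConv (a ∘ suc) b N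

  Σ<-conv : ∀ a b N → Σ< (conv a b) N ≈ partialConv a b N
  Σ<-conv a b zero    = refl
  Σ<-conv a b (suc N) = begin
    a 0 * b 0 + Σ< (λ k → a 0 * b (suc k) + conv (a ∘ suc) b k) N
      ≈⟨ +-congˡ (∑-distrib-+ {N} _ _) ⟩
    a 0 * b 0 + (Σ< (λ k → a 0 * b (suc k)) N + Σ< (conv (a ∘ suc) b) N)
      ≈⟨ +-congˡ (+-cong (sym (*-distribˡ-sum {N} _ _)) (Σ<-conv (a ∘ suc) b N)) ⟩
    a 0 * b 0 + (a 0 * Σ< (b ∘ suc) N + partialConv (a ∘ suc) b N)
      ≈⟨ solve 4 (λ x b s p → x :* b :+ (x :* s :+ p) := x :* (b :+ s) :+ p) refl _ _ _ _ ⟩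
    a 0 * (b 0 + Σ< (b ∘ suc) N) + partialConv (a ∘ suc) b N ∎

-- Complex numbers over the ordered ring, and their norm

record Complexification (A : ArchimedeanRing) : Set₁ where
  infix 5 _+i_
  private module A = ArchimedeanRing A
  open A using (_≈_; _+_; _*_; -_; _-_; 0#; 1#)
  field
    ℂ-commutativeRing : CommutativeRing 0ℓ 0ℓ
  open CommutativeRing ℂ-commutativeRing public using () renaming
    ( Carrier to ℂ; _≈_ to _≈ᶜ_; _+_ to _+ᶜ_; _*_ to _*ᶜ_; -_ to -ᶜ_; _-_ to _-ᶜ_; 0# to 0ᶜ; 1# to 1ᶜ
    ; refl to ≈ᶜ-refl; sym to ≈ᶜ-sym; trans to ≈ᶜ-trans; setoid to ℂ-setoid
    ; +-cong to +ᶜ-cong; *-cong to *ᶜ-cong; +-congˡ to +ᶜ-congˡ; +-congʳ to +ᶜ-congʳ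
    ; *-congˡ to *ᶜ-congˡ; *-congʳ to *ᶜ-congʳ; -‿cong to -ᶜ‿cong
    ; +-identityˡ to +ᶜ-identityˡ; +-identityʳ to +ᶜ-identityʳ
    ; *-identityˡ to *ᶜ-identityˡ; *-identityʳ to *ᶜ-identityʳ
    ; -‿inverseʳ to -ᶜ-inverseʳ; zeroˡ to zeroᶜˡ; zeroʳ to zeroᶜʳ; *-assoc to *ᶜ-assoc
    ; commutativeSemiring to ℂ-commutativeSemiring; semiring to ℂ-semiring)
  field
    re im  : ℂ → A.Carrier
    _+i_   : A.Carrier → A.Carrier → ℂ
    re-+i  : ∀ x y → re (x +i y) ≈ x
    im-+i  : ∀ x y → im (x +i y) ≈ y
    ≈ᶜ-intro : ∀ {z w} → re z ≈ re w → im z ≈ im w → z ≈ᶜ w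
    re-cong  : ∀ {z w} → z ≈ᶜ w → re z ≈ re w
    im-cong  : ∀ {z w} → z ≈ᶜ w → im z ≈ im w
    re-+   : ∀ z w → re (z +ᶜ w) ≈ re z + re w
    im-+   : ∀ z w → im (z +ᶜ w) ≈ im z + im w
    re-*   : ∀ z w → re (z *ᶜ w) ≈ re z * re w - im z * im w
    im-*   : ∀ z w → im (z *ᶜ w) ≈ re z * im w + im z * re w
    re-neg : ∀ z → re (-ᶜ z) ≈ - re z
    im-neg : ∀ z → im (-ᶜ z) ≈ - im z
    re-0   : re 0ᶜ ≈ 0#
    im-0   : im 0ᶜ ≈ 0#
    re-1   : re 1ᶜ ≈ 1#
    im-1   : im 1ᶜ ≈ 0#

  ι : A.Carrier → ℂ
  ι x = x +i 0#

module ComplexProperties {A : ArchimedeanRing} (C : Complexification A) where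
  open OrderProperties A public
  open Complexification C public
  open Exp ℂ-commutativeSemiring public using () renaming
    (_^_ to _^ᶜ_; ^-congˡ to ^ᶜ-congˡ; ^-homo-* to ^ᶜ-homo-*; ^-distrib-* to ^ᶜ-distrib-*)
  open RingProperties (CommutativeRing.ring ℂ-commutativeRing) public using () renaming (-0#≈0# to -ᶜ0≈0)
  open Sum ℂ-semiring public using () renaming (sum to sumᶜ; sum-cong-≋ to sumᶜ-cong-≋)
  open CauchyProduct ℂ-commutativeSemiring public using
    (Σ<; Σ<-cong; ν; conv; conv-congˡ; conv-congʳ; conv-*ˡ; conv-*ʳ; derivative; derivative-conv; partialConv; Σ<-conv)

  ι-re : ∀ x → re (ι x) ≈ x
  ι-re x = re-+i x 0#

  ι-im : ∀ x → im (ι x) ≈ 0#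
  ι-im x = im-+i x 0#

  ι-cong : ∀ {x y} → x ≈ y → ι x ≈ᶜ ι y
  ι-cong x≈y = ≈ᶜ-intro (trans (ι-re _) (trans x≈y (sym (ι-re _)))) (trans (ι-im _) (sym (ι-im _)))

  re-ι* : ∀ x z → re (ι x *ᶜ z) ≈ x * re z
  re-ι* x z = trans (re-* (ι x) z) (trans
    (+-cong (*-congʳ (ι-re x)) (-‿cong (*-congʳ (ι-im x))))
    (trans (+-congˡ (trans (-‿cong (zeroˡ (im z))) -0#≈0#)) (+-identityʳ _)))

  im-ι* : ∀ x z → im (ι x *ᶜ z) ≈ x * im z
  im-ι* x z = trans (im-* (ι x) z) (trans
    (+-cong (*-congʳ (ι-re x)) (*-congʳ (ι-im x)))
    (trans (+-congˡ (zeroˡ (re z))) (+-identityʳ _)))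

  ι-+ : ∀ x y → ι (x + y) ≈ᶜ ι x +ᶜ ι y
  ι-+ x y = ≈ᶜ-intro
    (trans (ι-re _) (sym (trans (re-+ _ _) (+-cong (ι-re x) (ι-re y)))))
    (trans (ι-im _) (sym (trans (im-+ _ _) (trans (+-cong (ι-im x) (ι-im y)) (+-identityˡ 0#)))))

  ι-* : ∀ x y → ι (x * y) ≈ᶜ ι x *ᶜ ι y
  ι-* x y = ≈ᶜ-intro
    (trans (ι-re _) (sym (trans (re-ι* x (ι y)) (*-congˡ (ι-re y)))))
    (trans (ι-im _) (sym (trans (im-ι* x (ι y)) (trans (*-congˡ (ι-im y)) (zeroʳ x)))))

  ι-neg : ∀ x → ι (- x) ≈ᶜ -ᶜ ι x
  ι-neg x = ≈ᶜ-intro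
    (trans (ι-re _) (sym (trans (re-neg _) (-‿cong (ι-re x)))))
    (trans (ι-im _) (sym (trans (im-neg _) (trans (-‿cong (ι-im x)) -0#≈0#))))

  ι-0 : ι 0# ≈ᶜ 0ᶜ
  ι-0 = ≈ᶜ-intro (trans (ι-re 0#) (sym re-0)) (trans (ι-im 0#) (sym im-0))

  ι-1 : ι 1# ≈ᶜ 1ᶜ
  ι-1 = ≈ᶜ-intro (trans (ι-re 1#) (sym re-1)) (trans (ι-im 1#) (sym im-1))

  ι-^ : ∀ x n → ι (x ^ n) ≈ᶜ ι x ^ᶜ n
  ι-^ x zero    = ι-1
  ι-^ x (suc n) = ≈ᶜ-trans (ι-* x (x ^ n)) (*ᶜ-congˡ (ι-^ x n))

  ι-fromℚ-homo : ℚ.+-*-rawRing -Raw-AlmostCommutative⟶ fromCommutativeRing ℂ-commutativeRing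
  ι-fromℚ-homo = record
    { ⟦_⟧ = ι ∘ fromℚ
    ; +-homo = λ p q → ≈ᶜ-trans (ι-cong (fromℚ-+ p q)) (ι-+ _ _)
    ; *-homo = λ p q → ≈ᶜ-trans (ι-cong (fromℚ-* p q)) (ι-* _ _)
    ; -‿homo = λ p → ≈ᶜ-trans (ι-cong (fromℚ-neg p)) (ι-neg _)
    ; 0-homo = ≈ᶜ-trans (ι-cong fromℚ-0) ι-0
    ; 1-homo = ≈ᶜ-trans (ι-cong fromℚ-1) ι-1 }

  module C-Solver = ℚ-Solver ℂ-commutativeRing ι-fromℚ-homo

  module ≤-Reasoning = PosetReasoning ≤-poset

  -- The sign of x is undecided, but adding x ≤ ∣x∣ and -x ≤ ∣x∣ gives 0 ≤ 2∣x∣; if ∣x∣ were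
  -- negative, this double would be at most ∣x∣ itself.
  ∣∣-nonNeg : ∀ x → 0# ≤ ∣ x ∣
  ∣∣-nonNeg x ∣x∣<0 = ≤-trans 0≤2∣x∣ (≤-respʳ (+-identityʳ _) (+-mono-≤ ≤-refl (<⇒≤ ∣x∣<0))) ∣x∣<0
    where
    0≤2∣x∣ : 0# ≤ ∣ x ∣ + ∣ x ∣
    0≤2∣x∣ = ≤-respˡ (-‿inverseʳ x) (+-mono-≤ (x≤∣x∣ x) (-x≤∣x∣ x))

  ∣x+y∣≤ : ∀ x y → ∣ x + y ∣ ≤ ∣ x ∣ + ∣ y ∣
  ∣x+y∣≤ x y = ∣x∣≤ (+-mono-≤ (x≤∣x∣ x) (x≤∣x∣ y))
    (≤-respˡ (solve 2 (λ x y → :- x :+ :- y := :- (x :+ y)) refl x y)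
      (+-mono-≤ (-x≤∣x∣ x) (-x≤∣x∣ y)))
    where open R-Solver

  ∣-x∣≤ : ∀ x → ∣ - x ∣ ≤ ∣ x ∣
  ∣-x∣≤ x = ∣x∣≤ (-x≤∣x∣ x) (≤-respˡ (sym (-‿involutive x)) (x≤∣x∣ x))

  nonNeg⇒∣x∣≤x : ∀ {x} → 0# ≤ x → ∣ x ∣ ≤ x
  nonNeg⇒∣x∣≤x 0≤x = ∣x∣≤ ≤-refl (≤-trans (≤-respʳ -0#≈0# (neg-antimono 0≤x)) 0≤x)

  -- The ℓ¹ norm of ℝ²: it is submultiplicative and needs no square root.
  ‖_‖ : ℂ → Carrier
  ‖ z ‖ = ∣ re z ∣ + ∣ im z ∣

  ‖‖-nonNeg : ∀ z → 0# ≤ ‖ z ‖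
  ‖‖-nonNeg z = +-nonNeg (∣∣-nonNeg _) (∣∣-nonNeg _)

  ‖‖-cong : ∀ {z w} → z ≈ᶜ w → ‖ z ‖ ≈ ‖ w ‖
  ‖‖-cong z≈w = +-cong (∣-∣-cong (re-cong z≈w)) (∣-∣-cong (im-cong z≈w))

  ‖z+w‖≤ : ∀ z w → ‖ z +ᶜ w ‖ ≤ ‖ z ‖ + ‖ w ‖
  ‖z+w‖≤ z w = begin
    ∣ re (z +ᶜ w) ∣ + ∣ im (z +ᶜ w) ∣
      ≈⟨ +-cong (∣-∣-cong (re-+ z w)) (∣-∣-cong (im-+ z w)) ⟩
    ∣ re z + re w ∣ + ∣ im z + im w ∣
      ≤⟨ +-mono-≤ (∣x+y∣≤ _ _) (∣x+y∣≤ _ _) ⟩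
    (∣ re z ∣ + ∣ re w ∣) + (∣ im z ∣ + ∣ im w ∣)
      ≈⟨ solve 4 (λ a b c d → (a :+ b) :+ (c :+ d) := (a :+ c) :+ (b :+ d)) refl _ _ _ _ ⟩
    ‖ z ‖ + ‖ w ‖ ∎
    where
    open ≤-Reasoning
    open R-Solver using (solve; _:+_; _:=_)

  ‖-z‖≤ : ∀ z → ‖ -ᶜ z ‖ ≤ ‖ z ‖
  ‖-z‖≤ z = ≤-respˡ (sym (+-cong (∣-∣-cong (re-neg z)) (∣-∣-cong (im-neg z))))
    (+-mono-≤ (∣-x∣≤ _) (∣-x∣≤ _))

  ‖z*w‖≤ : ∀ z w → ‖ z *ᶜ w ‖ ≤ ‖ z ‖ * ‖ w ‖
  ‖z*w‖≤ z w = begin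
    ∣ re (z *ᶜ w) ∣ + ∣ im (z *ᶜ w) ∣
      ≈⟨ +-cong (∣-∣-cong (re-* z w)) (∣-∣-cong (im-* z w)) ⟩
    ∣ re z * re w - im z * im w ∣ + ∣ re z * im w + im z * re w ∣
      ≤⟨ +-mono-≤
           (≤-trans (∣x+y∣≤ _ _) (+-mono-≤ (∣x*y∣≤ _ _) (≤-trans (∣-x∣≤ _) (∣x*y∣≤ _ _))))
           (≤-trans (∣x+y∣≤ _ _) (+-mono-≤ (∣x*y∣≤ _ _) (∣x*y∣≤ _ _))) ⟩
    (∣ re z ∣ * ∣ re w ∣ + ∣ im z ∣ * ∣ im w ∣) + (∣ re z ∣ * ∣ im w ∣ + ∣ im z ∣ * ∣ re w ∣)
      ≈⟨ solve 4 (λ a b c d → (a :* c :+ b :* d) :+ (a :* d :+ b :* c) := (a :+ b) :* (c :+ d))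
           refl _ _ _ _ ⟩
    ‖ z ‖ * ‖ w ‖ ∎
    where
    open ≤-Reasoning
    open R-Solver using (solve; _:+_; _:*_; _:=_)

  ‖ι‖≤ : ∀ {x} → 0# ≤ x → ‖ ι x ‖ ≤ x
  ‖ι‖≤ {x} 0≤x = begin
    ∣ re (ι x) ∣ + ∣ im (ι x) ∣  ≈⟨ +-cong (∣-∣-cong (ι-re x)) (∣-∣-cong (ι-im x)) ⟩
    ∣ x ∣ + ∣ 0# ∣               ≤⟨ +-mono-≤ (nonNeg⇒∣x∣≤x 0≤x) (nonNeg⇒∣x∣≤x ≤-refl) ⟩
    x + 0#                       ≈⟨ +-identityʳ x ⟩
    x                            ∎
    where open ≤-Reasoning

  ‖0‖≤0 : ‖ 0ᶜ ‖ ≤ 0#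
  ‖0‖≤0 = ≤-respˡ (‖‖-cong ι-0) (‖ι‖≤ ≤-refl)

-- Geometrically dominated series

module Series {A : ArchimedeanRing} (C : Complexification A) where
  open ComplexProperties C
  open R-Solver using (solve; con; _:+_; _:*_; _:=_)

  ¼ℚ 2ℚ 3ℚ 4ℚ : ℚ
  ¼ℚ = + 1 ℚ./ 4
  2ℚ = + 2 ℚ./ 1
  3ℚ = + 3 ℚ./ 1
  4ℚ = + 4 ℚ./ 1

  -- `q` = 1/4 is the ratio of all dominating series. `p` = 2`q` closes the induction in
  -- `‖product-partialConv‖≤` exactly: up to a common constant both error terms of a step are
  -- `q * p ^ N`, and together they give `p * p ^ N`.
  q p : Carrier
  q = fromℚ ¼ℚ
  p = fromℚ ½

  0≤q : 0# ≤ q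
  0≤q = fromℚ-nonNeg (ℚ.nonNegative⁻¹ ¼ℚ)

  0≤p : 0# ≤ p
  0≤p = fromℚ-nonNeg (ℚ.nonNegative⁻¹ ½)

  0≤fromℚ2 : 0# ≤ fromℚ 2ℚ
  0≤fromℚ2 = fromℚ-nonNeg (ℚ.nonNegative⁻¹ 2ℚ)

  q≤p : q ≤ p
  q≤p = ≤-by-difference (solve 0 (con ½ := con ¼ℚ :+ con ¼ℚ) refl) 0≤q

  q^n≤p^n : ∀ n → q ^ n ≤ p ^ n
  q^n≤p^n zero    = ≤-refl
  q^n≤p^n (suc n) = *-mono-≤ 0≤q (^-nonNeg 0≤p n) q≤p (q^n≤p^n n)

  Geometric : Carrier → (ℕ → ℂ) → Set
  Geometric K a = ∀ k → ‖ a k ‖ ≤ K * q ^ k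

  geometric-head : ∀ {K a} → Geometric K a → ‖ a 0 ‖ ≤ K
  geometric-head h = ≤-respʳ (*-identityʳ _) (h 0)

  geometric-tail : ∀ {K a} → Geometric K a → Geometric (K * q) (a ∘ suc)
  geometric-tail h k = ≤-respʳ (sym (*-assoc _ _ _)) (h (suc k))

  -- The induction needs a factor c with 1 + c/4 ≤ c; c = 2 leaves K/2 to spare.
  ‖Σ‖≤ : ∀ {K b} → 0# ≤ K → Geometric K b → ∀ M → ‖ Σ< b M ‖ ≤ K * fromℚ 2ℚ
  ‖Σ‖≤ 0≤K h zero = ≤-trans ‖0‖≤0 (*-nonNeg 0≤K 0≤fromℚ2)
  ‖Σ‖≤ {K} {b} 0≤K h (suc M) = begin
    ‖ b 0 +ᶜ Σ< (b ∘ suc) M ‖      ≤⟨ ‖z+w‖≤ _ _ ⟩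
    ‖ b 0 ‖ + ‖ Σ< (b ∘ suc) M ‖   ≤⟨ +-mono-≤ (geometric-head h)
                                        (‖Σ‖≤ (*-nonNeg 0≤K 0≤q) (geometric-tail h) M) ⟩
    K + K * q * fromℚ 2ℚ           ≤⟨ ≤-by-difference
      (solve 1 (λ K → K :* con 2ℚ := (K :+ K :* con ¼ℚ :* con 2ℚ) :+ K :* con ½) refl K)
      (*-nonNeg 0≤K 0≤p) ⟩
    K * fromℚ 2ℚ                   ∎
    where open ≤-Reasoning

  ‖tail‖≤ : ∀ {K b} → 0# ≤ K → Geometric K b → ∀ {L M} → L ℕ.≤ M →
            ‖ Σ< b M -ᶜ Σ< b L ‖ ≤ (K * fromℚ 2ℚ) * q ^ L
  ‖tail‖≤ {K} {b} 0≤K h {M = M} ℕ.z≤n = ≤-respˡ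
    (‖‖-cong (≈ᶜ-sym (≈ᶜ-trans (+ᶜ-congˡ -ᶜ0≈0) (+ᶜ-identityʳ _))))
    (≤-respʳ (sym (*-identityʳ _)) (‖Σ‖≤ 0≤K h M))
  ‖tail‖≤ {K} {b} 0≤K h {suc L} {suc M} (ℕ.s≤s L≤M) = begin
    ‖ (b 0 +ᶜ Σ< (b ∘ suc) M) -ᶜ (b 0 +ᶜ Σ< (b ∘ suc) L) ‖
      ≈⟨ ‖‖-cong (C.solve 3 (λ x s t → (x C.:+ s) C.:- (x C.:+ t) C.:= s C.:- t) ≈ᶜ-refl _ _ _) ⟩
    ‖ Σ< (b ∘ suc) M -ᶜ Σ< (b ∘ suc) L ‖
      ≤⟨ ‖tail‖≤ (*-nonNeg 0≤K 0≤q) (geometric-tail h) L≤M ⟩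
    (K * q * fromℚ 2ℚ) * q ^ L
      ≈⟨ solve 4 (λ K q t u → (K :* q :* t) :* u := (K :* t) :* (q :* u)) refl _ _ _ _ ⟩
    (K * fromℚ 2ℚ) * (q * q ^ L) ∎
    where
    module C = C-Solver
    open ≤-Reasoning

  -- The N error terms are each of size q^N, and p^N absorbs their number.
  ‖product-partialConv‖≤ : ∀ {J K a b} → 0# ≤ J → 0# ≤ K → Geometric J a → Geometric K b →
    ∀ {N M} → N ℕ.≤ M →
    ‖ Σ< a N *ᶜ Σ< b M -ᶜ partialConv a b N ‖ ≤ (J * (K * fromℚ 2ℚ)) * p ^ N
  ‖product-partialConv‖≤ {J} {K} {a} {b} 0≤J 0≤K ha hb {zero} {M} _ = ≤-trans
    (≤-respˡ (‖‖-cong zero-term) ‖0‖≤0)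
    (*-nonNeg (*-nonNeg 0≤J (*-nonNeg 0≤K 0≤fromℚ2)) (^-nonNeg 0≤p 0))
    where
    zero-term : 0ᶜ ≈ᶜ 0ᶜ *ᶜ Σ< b M -ᶜ 0ᶜ
    zero-term = ≈ᶜ-sym (≈ᶜ-trans (+ᶜ-congʳ (zeroᶜˡ _)) (-ᶜ-inverseʳ 0ᶜ))
  ‖product-partialConv‖≤ {J} {K} {a} {b} 0≤J 0≤K ha hb {suc N} {M} N<M = begin
    ‖ (a 0 +ᶜ Σ< a′ N) *ᶜ Σ< b M -ᶜ (a 0 *ᶜ Σ< b (suc N) +ᶜ partialConv a′ b N) ‖
      ≈⟨ ‖‖-cong (C.solve 5 (λ x s t u g →
           (x C.:+ s) C.:* t C.:- (x C.:* u C.:+ g) C.:= x C.:* (t C.:- u) C.:+ (s C.:* t C.:- g))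
           ≈ᶜ-refl _ _ _ _ _) ⟩
    ‖ a 0 *ᶜ (Σ< b M -ᶜ Σ< b (suc N)) +ᶜ (Σ< a′ N *ᶜ Σ< b M -ᶜ partialConv a′ b N) ‖
      ≤⟨ ≤-trans (‖z+w‖≤ _ _) (+-mono-≤
           (≤-trans (‖z*w‖≤ _ _) (*-mono-≤ (‖‖-nonNeg _)
             (*-nonNeg (*-nonNeg 0≤K 0≤fromℚ2) (^-nonNeg 0≤q (suc N)))
             (geometric-head ha) (‖tail‖≤ 0≤K hb N<M)))
           (‖product-partialConv‖≤ (*-nonNeg 0≤J 0≤q) 0≤K (geometric-tail ha) hb (ℕ.<⇒≤ N<M))) ⟩
    J * ((K * fromℚ 2ℚ) * (q * q ^ N)) + (J * q * (K * fromℚ 2ℚ)) * p ^ N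
      ≤⟨ +-mono-≤ (*-monoˡ-≤ 0≤J (*-monoˡ-≤ (*-nonNeg 0≤K 0≤fromℚ2) (*-monoˡ-≤ 0≤q (q^n≤p^n N))))
           ≤-refl ⟩
    J * ((K * fromℚ 2ℚ) * (q * p ^ N)) + (J * q * (K * fromℚ 2ℚ)) * p ^ N
      ≈⟨ solve 3 (λ J K u →
           J :* ((K :* con 2ℚ) :* (con ¼ℚ :* u)) :+ (J :* con ¼ℚ :* (K :* con 2ℚ)) :* u :=
           (J :* (K :* con 2ℚ)) :* (con ½ :* u)) refl J K (p ^ N) ⟩
    (J * (K * fromℚ 2ℚ)) * (p * p ^ N) ∎
    where
    a′ = a ∘ suc
    module C = C-Solver
    open ≤-Reasoning

  -- The ratio test past an arbitrary initial segment. Prepending a term shifts the index by one,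
  -- which costs the factor 4 = 1/`q`; adding `‖ a 0 ‖` covers the new term.
  ratio⇒geometric : ∀ k₀ a → (∀ k → k₀ ℕ.≤ k → ‖ a (suc k) ‖ ≤ q * ‖ a k ‖) →
                    ∃ λ K → 0# ≤ K × Geometric K a
  ratio⇒geometric zero a h = ‖ a 0 ‖ , ‖‖-nonNeg _ , go
    where
    go : Geometric ‖ a 0 ‖ a
    go zero    = ≤-reflexive (sym (*-identityʳ _))
    go (suc k) = ≤-trans (h k ℕ.z≤n) (≤-respʳ
      (solve 3 (λ q K u → q :* (K :* u) := K :* (q :* u)) refl _ _ _) (*-monoˡ-≤ 0≤q (go k)))
  ratio⇒geometric (suc k₀) a h with ratio⇒geometric k₀ (a ∘ suc) (λ k k₀≤k → h (suc k) (ℕ.s≤s k₀≤k))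
  ... | K , 0≤K , geo = ‖ a 0 ‖ + fromℚ 4ℚ * K , +-nonNeg (‖‖-nonNeg _) 0≤4K , go
    where
    0≤4K : 0# ≤ fromℚ 4ℚ * K
    0≤4K = *-nonNeg (fromℚ-nonNeg (ℚ.nonNegative⁻¹ 4ℚ)) 0≤K
    go : Geometric (‖ a 0 ‖ + fromℚ 4ℚ * K) a
    go zero    = ≤-by-difference (*-identityʳ _) 0≤4K
    go (suc k) = ≤-trans (geo k) (≤-by-difference
      (solve 3 (λ a K u → (a :+ con 4ℚ :* K) :* (con ¼ℚ :* u) := K :* u :+ a :* (con ¼ℚ :* u))
        refl _ _ _)
      (*-nonNeg (‖‖-nonNeg _) (^-nonNeg 0≤q (suc k))))

  -- Kept opaque because ℚ._/_ normalises by a gcd computation that gets stuck on variables.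
  opaque
    natᴿ 1/suc 1/!ᴿ : ℕ → Carrier
    natᴿ n  = fromℚ (natℚ n)
    1/suc n = fromℚ (+ 1 ℚ./ suc n)
    1/!ᴿ n  = fromℚ (1/! n)

    1/!ᴿ≡ : ∀ n → 1/!ᴿ n ≡ fromℚ (1/! n)
    1/!ᴿ≡ n = ≡.refl

    1/suc≡ : ∀ n → 1/suc n ≡ fromℚ (+ 1 ℚ./ suc n)
    1/suc≡ n = ≡.refl

    natᴿ-2 : natᴿ 2 ≈ fromℚ 2ℚ
    natᴿ-2 = refl

    natᴿ-3 : natᴿ 3 ≈ fromℚ 3ℚ
    natᴿ-3 = refl

    natᴿ-zero : natᴿ 0 ≈ 0#
    natᴿ-zero = fromℚ-0

    natᴿ-suc : ∀ n → natᴿ (suc n) ≈ 1# + natᴿ n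
    natᴿ-suc n = trans (reflexive (≡.cong fromℚ (natℚ-suc n)))
      (trans (fromℚ-+ 1ℚ (natℚ n)) (+-congʳ fromℚ-1))

    natᴿ-mono : ∀ {m n} → m ℕ.≤ n → natᴿ m ≤ natᴿ n
    natᴿ-mono m≤n = fromℚ-mono-≤ (natℚ-mono m≤n)

    natᴿ*1/suc : ∀ n → natᴿ (suc n) * 1/suc n ≈ 1#
    natᴿ*1/suc n = trans (sym (fromℚ-* _ _)) (trans (reflexive (≡.cong fromℚ (natℚ*1/ (suc n)))) fromℚ-1)

    1/suc-nonNeg : ∀ n → 0# ≤ 1/suc n
    1/suc-nonNeg n = fromℚ-nonNeg (ℚ.<⇒≤ (1/-pos (suc n)))

    1/!ᴿ-zero : 1/!ᴿ 0 ≈ 1#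
    1/!ᴿ-zero = fromℚ-1

    1/!ᴿ-suc : ∀ n → 1/!ᴿ (suc n) ≈ 1/suc n * 1/!ᴿ n
    1/!ᴿ-suc n = trans (reflexive (≡.cong fromℚ (1/!-suc n))) (fromℚ-* _ _)

    1/!ᴿ-pos : ∀ n → 0# < 1/!ᴿ n
    1/!ᴿ-pos n = fromℚ-pos (1/!-pos n)

    natᴿ-bound : ∀ x → ∃ λ n → x ≤ natᴿ n
    natᴿ-bound = archimedean

    fromℚ-divide : ∀ n ε → 0ℚ ℚ.< ε → ∃ λ δ → 0ℚ ℚ.< δ × fromℚ δ * natᴿ (suc n) ≤ fromℚ ε
    fromℚ-divide n ε 0<ε = ε ℚ.* (+ 1 ℚ./ suc n) , *ℚ-pos 0<ε (1/-pos (suc n)) ,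
      ≤-reflexive (trans (sym (fromℚ-* _ _)) (reflexive (≡.cong fromℚ (≡.trans (ℚ.*-assoc ε _ _)
        (≡.trans (≡.cong (ε ℚ.*_) (≡.trans (ℚ.*-comm _ (natℚ (suc n))) (natℚ*1/ (suc n))))
          (ℚ.*-identityʳ ε))))))

  natᴿ-nonNeg : ∀ n → 0# ≤ natᴿ n
  natᴿ-nonNeg n = ≤-respˡ natᴿ-zero (natᴿ-mono {0} {n} ℕ.z≤n)

  -- This is 1 + n ≤ 2^n; the induction step is (2 + n)/2 ≤ 1 + n.
  [1+n]p^n≤1 : ∀ n → (1# + natᴿ n) * p ^ n ≤ 1#
  [1+n]p^n≤1 zero = ≤-reflexive (trans (*-identityʳ _)
    (trans (+-congˡ natᴿ-zero) (+-identityʳ 1#)))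
  [1+n]p^n≤1 (suc n) = ≤-trans (≤-respˡ (*-congʳ (+-congˡ (sym (natᴿ-suc n)))) (≤-by-difference
    (solve 3 (λ e n u → (e :+ n) :* u :=
      (e :+ (e :+ n)) :* (con ½ :* u) :+ n :* (con ½ :* u)) refl 1# _ _)
    (*-nonNeg (natᴿ-nonNeg n) (^-nonNeg 0≤p (suc n))))) ([1+n]p^n≤1 n)

  -- A natural number M with K ≤ Mε already serves as the threshold, since n p^n ≤ 1 for every n.
  Kp^n→0 : ∀ K ε → 0ℚ ℚ.< ε → Eventually λ n → K * p ^ n ≤ fromℚ ε
  Kp^n→0 K ε 0<ε = proj₁ M , bound
    where
    instance
      _ = ℚ.positive 0<ε
      _ = ℚ.pos⇒nonZero ε
    0≤ε : 0# ≤ fromℚ ε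
    0≤ε = fromℚ-nonNeg (ℚ.<⇒≤ 0<ε)
    M = natᴿ-bound (K * fromℚ (ℚ.1/ ε))
    K≤Mε : K ≤ natᴿ (proj₁ M) * fromℚ ε
    K≤Mε = ≤-respˡ
      (trans (*-assoc _ _ _) (trans (*-congˡ (trans (sym (fromℚ-* _ _))
        (trans (reflexive (≡.cong fromℚ (ℚ.*-inverseˡ ε))) fromℚ-1))) (*-identityʳ K)))
      (*-monoʳ-≤ 0≤ε (proj₂ M))
    bound : ∀ n → proj₁ M ℕ.≤ n → K * p ^ n ≤ fromℚ ε
    bound n M≤n = begin
      K * p ^ n
        ≤⟨ *-monoʳ-≤ (^-nonNeg 0≤p n) K≤Mε ⟩
      natᴿ (proj₁ M) * fromℚ ε * p ^ n
        ≈⟨ solve 3 (λ x y z → x :* y :* z := y :* (x :* z)) refl _ _ _ ⟩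
      fromℚ ε * (natᴿ (proj₁ M) * p ^ n)
        ≤⟨ *-monoˡ-≤ 0≤ε (*-monoʳ-≤ (^-nonNeg 0≤p n) (natᴿ-mono M≤n)) ⟩
      fromℚ ε * (natᴿ n * p ^ n)
        ≤⟨ *-monoˡ-≤ 0≤ε (*-monoʳ-≤ (^-nonNeg 0≤p n) (≤-by-difference (+-comm _ _)
             (<⇒≤ 0<1))) ⟩
      fromℚ ε * ((1# + natᴿ n) * p ^ n)
        ≤⟨ *-monoˡ-≤ 0≤ε ([1+n]p^n≤1 n) ⟩
      fromℚ ε * 1#
        ≈⟨ *-identityʳ _ ⟩
      fromℚ ε ∎
      where open ≤-Reasoning

-- The exponential series and its addition theorem

module Exponential {A : ArchimedeanRing} (C : Complexification A) where
  open ComplexProperties C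
  open Series C
  open R-Solver using (solve; con; _:+_; _:*_; _:-_; :-_; _:=_)
  private module C = C-Solver

  infix 4 _⇒_
  -- Non-strict bounds on a norm chain well; `⟶⇒⇒` obtains them from the coordinatewise strict
  -- bounds, taken at ε/2 each.
  _⇒_ : (ℕ → ℂ) → ℂ → Set
  s ⇒ w = ∀ ε → 0ℚ ℚ.< ε → Eventually λ n → ‖ s n -ᶜ w ‖ ≤ fromℚ ε

  half+half : ∀ ε → fromℚ (½ ℚ.* ε) + fromℚ (½ ℚ.* ε) ≈ fromℚ ε
  half+half ε = trans (+-cong (fromℚ-* ½ ε) (fromℚ-* ½ ε))
    (trans (solve 1 (λ x → con ½ :* x :+ con ½ :* x := con 1ℚ :* x) refl _)
      (trans (*-congʳ fromℚ-1) (*-identityˡ _)))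

  ⇒-perturb : ∀ {s t w} → s ⇒ w →
    (∀ ε → 0ℚ ℚ.< ε → Eventually λ n → ‖ t n -ᶜ s n ‖ ≤ fromℚ ε) → t ⇒ w
  ⇒-perturb {s} {t} {w} s⇒w t-s ε 0<ε = zipᵉ (λ n a b → begin
    ‖ t n -ᶜ w ‖
      ≈⟨ ‖‖-cong (C.solve 3 (λ t s w → t C.:- w C.:= (t C.:- s) C.:+ (s C.:- w)) ≈ᶜ-refl _ (s n) _) ⟩
    ‖ (t n -ᶜ s n) +ᶜ (s n -ᶜ w) ‖
      ≤⟨ ≤-trans (‖z+w‖≤ _ _) (+-mono-≤ a b) ⟩
    fromℚ (½ ℚ.* ε) + fromℚ (½ ℚ.* ε)
      ≈⟨ half+half ε ⟩
    fromℚ ε ∎) (t-s (½ ℚ.* ε) (½-pos 0<ε)) (s⇒w (½ ℚ.* ε) (½-pos 0<ε))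
    where open ≤-Reasoning

  ⇒-congˡ : ∀ {s t w} → (∀ n → s n ≈ᶜ t n) → s ⇒ w → t ⇒ w
  ⇒-congˡ s≈t s⇒w ε 0<ε = mapᵉ (λ n → ≤-respˡ (‖‖-cong (+ᶜ-congʳ (s≈t n)))) (s⇒w ε 0<ε)

  ⇒-congʳ : ∀ {s w w′} → w ≈ᶜ w′ → s ⇒ w → s ⇒ w′
  ⇒-congʳ w≈w′ s⇒w ε 0<ε = mapᵉ (λ n → ≤-respˡ (‖‖-cong (+ᶜ-congˡ (-ᶜ‿cong w≈w′)))) (s⇒w ε 0<ε)

  -- With δ ≤ 1, the expansion
  -- s t − w w′ = (s − w)(t − w′) + (s − w) w′ + w (t − w′)
  -- is at most δ (1 + ‖w‖ + ‖w′‖).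
  ⇒-* : ∀ {s t w w′} → s ⇒ w → t ⇒ w′ → (λ n → s n *ᶜ t n) ⇒ w *ᶜ w′
  ⇒-* {s} {t} {w} {w′} s⇒w t⇒w′ ε 0<ε = zipᵉ bound (s⇒w δ 0<δ) (t⇒w′ δ 0<δ)
    where
    K = natᴿ-bound (1# + ‖ w ‖ + ‖ w′ ‖)
    η-small = fromℚ-divide (proj₁ K) ε 0<ε
    η δ : ℚ
    η = proj₁ η-small
    δ = η ℚ.⊓ 1ℚ
    0<δ : 0ℚ ℚ.< δ
    0<δ with ℚ.⊓-sel η 1ℚ
    ... | inj₁ e = ≡.subst (0ℚ ℚ.<_) (≡.sym e) (proj₁ (proj₂ η-small))
    ... | inj₂ e = ≡.subst (0ℚ ℚ.<_) (≡.sym e) (ℚ.positive⁻¹ 1ℚ)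
    d = fromℚ δ
    0≤d : 0# ≤ d
    0≤d = fromℚ-nonNeg (ℚ.<⇒≤ 0<δ)
    d≤1 : d ≤ 1#
    d≤1 = ≤-respʳ fromℚ-1 (fromℚ-mono-≤ (ℚ.p⊓q≤q η 1ℚ))
    bound : ∀ n → ‖ s n -ᶜ w ‖ ≤ d → ‖ t n -ᶜ w′ ‖ ≤ d → ‖ s n *ᶜ t n -ᶜ w *ᶜ w′ ‖ ≤ fromℚ ε
    bound n a b = begin
      ‖ s n *ᶜ t n -ᶜ w *ᶜ w′ ‖
        ≈⟨ ‖‖-cong (C.solve 4 (λ s t w w′ → s C.:* t C.:- w C.:* w′ C.:=
             (s C.:- w) C.:* (t C.:- w′) C.:+ w C.:* (t C.:- w′) C.:+ (s C.:- w) C.:* w′)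
             ≈ᶜ-refl _ _ _ _) ⟩
      ‖ (s n -ᶜ w) *ᶜ (t n -ᶜ w′) +ᶜ w *ᶜ (t n -ᶜ w′) +ᶜ (s n -ᶜ w) *ᶜ w′ ‖
        ≤⟨ ≤-trans (‖z+w‖≤ _ _) (+-mono-≤
             (≤-trans (‖z+w‖≤ _ _) (+-mono-≤ (‖z*w‖≤ _ _) (‖z*w‖≤ _ _))) (‖z*w‖≤ _ _)) ⟩
      ‖ s n -ᶜ w ‖ * ‖ t n -ᶜ w′ ‖ + ‖ w ‖ * ‖ t n -ᶜ w′ ‖ + ‖ s n -ᶜ w ‖ * ‖ w′ ‖
        ≤⟨ +-mono-≤ (+-mono-≤
             (*-mono-≤ (‖‖-nonNeg _) (<⇒≤ 0<1) a (≤-trans b d≤1))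
             (*-monoˡ-≤ (‖‖-nonNeg w) b))
             (*-monoʳ-≤ (‖‖-nonNeg w′) a) ⟩
      d * 1# + ‖ w ‖ * d + d * ‖ w′ ‖
        ≈⟨ solve 4 (λ d e x y → d :* e :+ x :* d :+ d :* y := d :* (e :+ x :+ y)) refl _ _ _ _ ⟩
      d * (1# + ‖ w ‖ + ‖ w′ ‖)
        ≤⟨ *-monoˡ-≤ 0≤d (≤-trans (proj₂ K) (natᴿ-mono (ℕ.n≤1+n (proj₁ K)))) ⟩
      d * natᴿ (suc (proj₁ K))
        ≤⟨ *-monoʳ-≤ (natᴿ-nonNeg (suc (proj₁ K))) (fromℚ-mono-≤ (ℚ.p⊓q≤p η 1ℚ)) ⟩
      fromℚ η * natᴿ (suc (proj₁ K))
        ≤⟨ proj₂ (proj₂ η-small) ⟩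
      fromℚ ε ∎
      where open ≤-Reasoning

  ν≈natᴿ : ∀ n → ν n ≈ᶜ ι (natᴿ n)
  ν≈natᴿ zero    = ≈ᶜ-sym (≈ᶜ-trans (ι-cong natᴿ-zero) ι-0)
  ν≈natᴿ (suc n) = ≈ᶜ-trans (+ᶜ-cong (≈ᶜ-sym ι-1) (ν≈natᴿ n))
    (≈ᶜ-sym (≈ᶜ-trans (ι-cong (natᴿ-suc n)) (ι-+ _ _)))

  ν*1/suc : ∀ k → ν (suc k) *ᶜ ι (1/suc k) ≈ᶜ 1ᶜ
  ν*1/suc k = ≈ᶜ-trans (*ᶜ-congʳ (ν≈natᴿ (suc k))) (≈ᶜ-trans (≈ᶜ-sym (ι-* _ _))
    (≈ᶜ-trans (ι-cong (natᴿ*1/suc k)) ι-1))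

  expTerm : ℂ → ℕ → ℂ
  expTerm z k = ι (1/!ᴿ k) *ᶜ z ^ᶜ k

  expTerm-zero : ∀ z → expTerm z 0 ≈ᶜ 1ᶜ
  expTerm-zero z = ≈ᶜ-trans (*ᶜ-identityʳ _) (≈ᶜ-trans (ι-cong 1/!ᴿ-zero) ι-1)

  expTerm-suc : ∀ z k → expTerm z (suc k) ≈ᶜ ι (1/suc k) *ᶜ (z *ᶜ expTerm z k)
  expTerm-suc z k = begin
    ι (1/!ᴿ (suc k)) *ᶜ (z *ᶜ z ^ᶜ k)
      ≈⟨ *ᶜ-congʳ (≈ᶜ-trans (ι-cong (1/!ᴿ-suc k)) (ι-* _ _)) ⟩
    (ι (1/suc k) *ᶜ ι (1/!ᴿ k)) *ᶜ (z *ᶜ z ^ᶜ k)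
      ≈⟨ C.solve 4 (λ r c z w → (r C.:* c) C.:* (z C.:* w) C.:= r C.:* (z C.:* (c C.:* w)))
           ≈ᶜ-refl _ _ _ _ ⟩
    ι (1/suc k) *ᶜ (z *ᶜ expTerm z k) ∎
    where open SetoidReasoning ℂ-setoid

  -- Read as coefficients in X, the terms form the series E = e^{zX}, and this is its differential
  -- equation E′ = zE.
  expTerm-derivative : ∀ z k → derivative (expTerm z) k ≈ᶜ z *ᶜ expTerm z k
  expTerm-derivative z k = ≈ᶜ-trans (*ᶜ-congˡ (expTerm-suc z k)) (≈ᶜ-trans (≈ᶜ-sym (*ᶜ-assoc _ _ _))
    (≈ᶜ-trans (*ᶜ-congʳ (ν*1/suc k)) (*ᶜ-identityˡ _)))

  -- The equation E′ = zE is the recurrence (k + 1) e_{k+1} = z e_k, which determines the next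
  -- coefficient because k + 1 is invertible.
  expTerm-unique : ∀ z e → e 0 ≈ᶜ 1ᶜ → (∀ k → derivative e k ≈ᶜ z *ᶜ e k) → ∀ k → e k ≈ᶜ expTerm z k
  expTerm-unique z e e₀ e′ zero    = ≈ᶜ-trans e₀ (≈ᶜ-sym (expTerm-zero z))
  expTerm-unique z e e₀ e′ (suc k) = begin
    e (suc k)                                   ≈⟨ *ᶜ-identityˡ _ ⟨
    1ᶜ *ᶜ e (suc k)                             ≈⟨ *ᶜ-congʳ (ν*1/suc k) ⟨
    (ν (suc k) *ᶜ ι (1/suc k)) *ᶜ e (suc k)     ≈⟨ C.solve 3 (λ n r e →
      (n C.:* r) C.:* e C.:= r C.:* (n C.:* e)) ≈ᶜ-refl _ _ _ ⟩
    ι (1/suc k) *ᶜ (ν (suc k) *ᶜ e (suc k))     ≈⟨ *ᶜ-congˡ (e′ k) ⟩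
    ι (1/suc k) *ᶜ (z *ᶜ e k)                   ≈⟨ *ᶜ-congˡ (*ᶜ-congˡ (expTerm-unique z e e₀ e′ k)) ⟩
    ι (1/suc k) *ᶜ (z *ᶜ expTerm z k)           ≈⟨ expTerm-suc z k ⟨
    expTerm z (suc k)                           ∎
    where open SetoidReasoning ℂ-setoid

  -- By the Leibniz rule the Cauchy product satisfies E′ = (x + y)E with constant term 1, so
  -- uniqueness takes the place of the binomial theorem.
  expTerm-+ : ∀ x y k → conv (expTerm x) (expTerm y) k ≈ᶜ expTerm (x +ᶜ y) k
  expTerm-+ x y = expTerm-unique (x +ᶜ y) (conv (expTerm x) (expTerm y))
    (≈ᶜ-trans (*ᶜ-cong (expTerm-zero x) (expTerm-zero y)) (*ᶜ-identityˡ 1ᶜ))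
    λ k → begin
      derivative (conv (expTerm x) (expTerm y)) k
        ≈⟨ derivative-conv (expTerm x) (expTerm y) k ⟩
      conv (derivative (expTerm x)) (expTerm y) k +ᶜ conv (expTerm x) (derivative (expTerm y)) k
        ≈⟨ +ᶜ-cong (conv-congˡ (expTerm-derivative x) _ k) (conv-congʳ _ (expTerm-derivative y) k) ⟩
      conv (λ i → x *ᶜ expTerm x i) (expTerm y) k +ᶜ conv (expTerm x) (λ i → y *ᶜ expTerm y i) k
        ≈⟨ +ᶜ-cong (conv-*ˡ x _ _ k) (conv-*ʳ y _ _ k) ⟩
      x *ᶜ conv (expTerm x) (expTerm y) k +ᶜ y *ᶜ conv (expTerm x) (expTerm y) k
        ≈⟨ C.solve 3 (λ x y c → x C.:* c C.:+ y C.:* c C.:= (x C.:+ y) C.:* c) ≈ᶜ-refl _ _ _ ⟩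
      (x +ᶜ y) *ᶜ conv (expTerm x) (expTerm y) k ∎
    where open SetoidReasoning ℂ-setoid

  expTerm-geometric : ∀ z → ∃ λ K → 0# ≤ K × Geometric K (expTerm z)
  expTerm-geometric z = ratio⇒geometric (proj₁ K) (expTerm z) ratio
    where
    -- Once k + 1 ≥ 4‖z‖, the ratio ‖z‖/(k + 1) of successive terms is at most `q`.
    K = natᴿ-bound (fromℚ 4ℚ * ‖ z ‖)
    ratio : ∀ k → proj₁ K ℕ.≤ k → ‖ expTerm z (suc k) ‖ ≤ q * ‖ expTerm z k ‖
    ratio k K≤k = begin
      ‖ expTerm z (suc k) ‖
        ≈⟨ ‖‖-cong (expTerm-suc z k) ⟩
      ‖ ι (1/suc k) *ᶜ (z *ᶜ expTerm z k) ‖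
        ≤⟨ ≤-trans (‖z*w‖≤ _ _) (*-mono-≤ (‖‖-nonNeg _)
             (*-nonNeg (‖‖-nonNeg z) (‖‖-nonNeg _)) (‖ι‖≤ (1/suc-nonNeg k)) (‖z*w‖≤ _ _)) ⟩
      1/suc k * (‖ z ‖ * ‖ expTerm z k ‖)
        ≈⟨ solve 3 (λ r z t → r :* (z :* t) := (con ¼ℚ :* (r :* (con 4ℚ :* z))) :* t) refl _ _ _ ⟩
      (q * (1/suc k * (fromℚ 4ℚ * ‖ z ‖))) * ‖ expTerm z k ‖
        ≤⟨ *-monoʳ-≤ (‖‖-nonNeg _) (*-monoˡ-≤ 0≤q (*-monoˡ-≤ (1/suc-nonNeg k)
             (≤-trans (proj₂ K) (natᴿ-mono (ℕ.m≤n⇒m≤1+n K≤k))))) ⟩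
      (q * (1/suc k * natᴿ (suc k))) * ‖ expTerm z k ‖
        ≈⟨ *-congʳ (trans (*-congˡ (trans (*-comm _ _) (natᴿ*1/suc k))) (*-identityʳ q)) ⟩
      q * ‖ expTerm z k ‖ ∎
      where open ≤-Reasoning

  IsExpSum : ℂ → ℂ → Set
  IsExpSum z w = Σ< (expTerm z) ⇒ w

  -- A partial sum for x + y runs over a triangle of products, the product of the two partial sums
  -- over the whole square; the difference is below a multiple of p^n.
  exp-+ : ∀ {x y w w′} → IsExpSum x w → IsExpSum y w′ → IsExpSum (x +ᶜ y) (w *ᶜ w′)
  exp-+ {x} {y} {w} {w′} x⇒w y⇒w′ = combine (expTerm-geometric x) (expTerm-geometric y)
    where
    G P : ℕ → ℂ
    G = partialConv (expTerm x) (expTerm y)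
    P n = Σ< (expTerm x) n *ᶜ Σ< (expTerm y) n
    close : ∀ {J K} → 0# ≤ J → 0# ≤ K → Geometric J (expTerm x) → Geometric K (expTerm y) →
            ∀ n → ‖ Σ< (expTerm (x +ᶜ y)) n -ᶜ P n ‖ ≤ (J * (K * fromℚ 2ℚ)) * p ^ n
    close {J} {K} 0≤J 0≤K geo-x geo-y n = begin
      ‖ Σ< (expTerm (x +ᶜ y)) n -ᶜ P n ‖
        ≈⟨ ‖‖-cong (+ᶜ-congʳ (≈ᶜ-trans (Σ<-cong (λ k → ≈ᶜ-sym (expTerm-+ x y k)) n)
             (Σ<-conv (expTerm x) (expTerm y) n))) ⟩
      ‖ G n -ᶜ P n ‖
        ≈⟨ ‖‖-cong (C.solve 2 (λ g p → g C.:- p C.:= C.:- (p C.:- g)) ≈ᶜ-refl (G n) (P n)) ⟩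
      ‖ -ᶜ (P n -ᶜ G n) ‖
        ≤⟨ ‖-z‖≤ _ ⟩
      ‖ P n -ᶜ G n ‖
        ≤⟨ ‖product-partialConv‖≤ 0≤J 0≤K geo-x geo-y {N = n} ℕ.≤-refl ⟩
      (J * (K * fromℚ 2ℚ)) * p ^ n ∎
      where open ≤-Reasoning
    combine : (∃ λ J → 0# ≤ J × Geometric J (expTerm x)) →
              (∃ λ K → 0# ≤ K × Geometric K (expTerm y)) → IsExpSum (x +ᶜ y) (w *ᶜ w′)
    combine (J , 0≤J , geo-x) (K , 0≤K , geo-y) = ⇒-perturb (⇒-* x⇒w y⇒w′)
      λ ε 0<ε → mapᵉ (λ n → ≤-trans (close 0≤J 0≤K geo-x geo-y n)) (Kp^n→0 (J * (K * fromℚ 2ℚ)) ε 0<ε)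

  exp-congˡ : ∀ {x y w} → x ≈ᶜ y → IsExpSum x w → IsExpSum y w
  exp-congˡ {x} {y} x≈y = ⇒-congˡ (Σ<-cong {expTerm x} {expTerm y} λ k → *ᶜ-congˡ (^ᶜ-congˡ k x≈y))

  ‖z‖≤0⇒z≈0 : ∀ {z} → ‖ z ‖ ≤ 0# → z ≈ᶜ 0ᶜ
  ‖z‖≤0⇒z≈0 {z} h = ≈ᶜ-intro
    (trans (∣x∣≤0⇒x≈0 (≤-trans (≤-by-difference refl (∣∣-nonNeg _)) h)) (sym re-0))
    (trans (∣x∣≤0⇒x≈0 (≤-trans (≤-by-difference (+-comm _ _) (∣∣-nonNeg _)) h)) (sym im-0))
    where
    ∣x∣≤0⇒x≈0 : ∀ {x} → ∣ x ∣ ≤ 0# → x ≈ 0#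
    ∣x∣≤0⇒x≈0 {x} h = ≤-antisym (≤-trans (x≤∣x∣ x) h)
      (≤-respˡ -0#≈0# (≤-respʳ (-‿involutive x) (neg-antimono (≤-trans (-x≤∣x∣ x) h))))

  ⇒-constant : ∀ {s w c} → s ⇒ w → Eventually (λ n → s n ≈ᶜ c) → c ≈ᶜ w
  ⇒-constant {s} {w} {c} s⇒w s≈c = begin
    c               ≈⟨ C.solve 2 (λ c w → c C.:= (c C.:- w) C.:+ w) ≈ᶜ-refl c w ⟩
    (c -ᶜ w) +ᶜ w   ≈⟨ +ᶜ-congʳ (‖z‖≤0⇒z≈0 (≤-closed λ ε 0<ε → witnessᵉ
      (zipᵉ (λ n e d → ≤-respˡ (‖‖-cong (+ᶜ-congʳ e)) d) s≈c (s⇒w ε 0<ε)))) ⟩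
    0ᶜ +ᶜ w         ≈⟨ +ᶜ-identityˡ w ⟩
    w               ∎
    where open SetoidReasoning ℂ-setoid

  exp-0 : ∀ {z w} → z ≈ᶜ 0ᶜ → IsExpSum z w → 1ᶜ ≈ᶜ w
  -- The threshold 1 excludes the empty partial sum, which is 0; all later ones are 1.
  exp-0 {z} z≈0 z⇒w = ⇒-constant z⇒w (1 , λ { (suc n) _ → begin
    expTerm z 0 +ᶜ Σ< (expTerm z ∘ suc) n   ≈⟨ +ᶜ-cong (expTerm-zero z) (vanish (expTerm z ∘ suc)
      (λ k → ≈ᶜ-trans (*ᶜ-congˡ (≈ᶜ-trans (*ᶜ-congʳ z≈0) (zeroᶜˡ _))) (zeroᶜʳ _)) n) ⟩
    1ᶜ +ᶜ 0ᶜ                                ≈⟨ +ᶜ-identityʳ 1ᶜ ⟩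
    1ᶜ                                      ∎ })
    where
    open SetoidReasoning ℂ-setoid
    vanish : ∀ a → (∀ k → a k ≈ᶜ 0ᶜ) → ∀ n → Σ< a n ≈ᶜ 0ᶜ
    vanish a h zero    = ≈ᶜ-refl
    vanish a h (suc n) = ≈ᶜ-trans (+ᶜ-cong (h 0) (vanish (a ∘ suc) (h ∘ suc) n)) (+ᶜ-identityˡ 0ᶜ)

  conj : ℂ → ℂ
  conj z = re z +i (- im z)

  re-conj : ∀ z → re (conj z) ≈ re z
  re-conj z = re-+i _ _

  im-conj : ∀ z → im (conj z) ≈ - im z
  im-conj z = im-+i _ _

  conj-cong : ∀ {z w} → z ≈ᶜ w → conj z ≈ᶜ conj w
  conj-cong z≈w = ≈ᶜ-intro (trans (re-conj _) (trans (re-cong z≈w) (sym (re-conj _))))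
    (trans (im-conj _) (trans (-‿cong (im-cong z≈w)) (sym (im-conj _))))

  conj-+ : ∀ z w → conj (z +ᶜ w) ≈ᶜ conj z +ᶜ conj w
  conj-+ z w = ≈ᶜ-intro
    (trans (re-conj _) (trans (re-+ z w) (sym (trans (re-+ _ _) (+-cong (re-conj z) (re-conj w))))))
    (trans (im-conj _) (trans (-‿cong (im-+ z w))
      (trans (solve 2 (λ x y → :- (x :+ y) := :- x :+ :- y) refl _ _)
        (sym (trans (im-+ _ _) (+-cong (im-conj z) (im-conj w)))))))

  conj-* : ∀ z w → conj (z *ᶜ w) ≈ᶜ conj z *ᶜ conj w
  conj-* z w = ≈ᶜ-intro
    (trans (re-conj _) (trans (re-* z w)
      (trans (solve 4 (λ a b c d → a :* c :- b :* d := a :* c :- (:- b) :* (:- d)) refl _ _ _ _)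
        (sym (trans (re-* _ _) (+-cong (*-cong (re-conj z) (re-conj w))
          (-‿cong (*-cong (im-conj z) (im-conj w)))))))))
    (trans (im-conj _) (trans (-‿cong (im-* z w))
      (trans (solve 4 (λ a b c d → :- (a :* d :+ b :* c) := a :* (:- d) :+ (:- b) :* c) refl _ _ _ _)
        (sym (trans (im-* _ _) (+-cong (*-cong (re-conj z) (im-conj w))
          (*-cong (im-conj z) (re-conj w))))))))

  conj-ι : ∀ x → conj (ι x) ≈ᶜ ι x
  conj-ι x = ≈ᶜ-intro (re-conj _) (trans (im-conj _)
    (trans (-‿cong (ι-im x)) (trans -0#≈0# (sym (ι-im x)))))

  conj-1 : conj 1ᶜ ≈ᶜ 1ᶜ
  conj-1 = ≈ᶜ-trans (conj-cong (≈ᶜ-sym ι-1)) (≈ᶜ-trans (conj-ι 1#) ι-1)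

  conj-0 : conj 0ᶜ ≈ᶜ 0ᶜ
  conj-0 = ≈ᶜ-trans (conj-cong (≈ᶜ-sym ι-0)) (≈ᶜ-trans (conj-ι 0#) ι-0)

  conj-neg : ∀ z → conj (-ᶜ z) ≈ᶜ -ᶜ conj z
  conj-neg z = ≈ᶜ-intro
    (trans (re-conj _) (trans (re-neg z) (sym (trans (re-neg _) (-‿cong (re-conj z))))))
    (trans (im-conj _) (trans (-‿cong (im-neg z)) (sym (trans (im-neg _) (-‿cong (im-conj z))))))

  conj-^ : ∀ z n → conj (z ^ᶜ n) ≈ᶜ conj z ^ᶜ n
  conj-^ z zero    = conj-1
  conj-^ z (suc n) = ≈ᶜ-trans (conj-* z _) (*ᶜ-congˡ (conj-^ z n))

  conj-Σ< : ∀ a n → conj (Σ< a n) ≈ᶜ Σ< (conj ∘ a) n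
  conj-Σ< a zero    = conj-0
  conj-Σ< a (suc n) = ≈ᶜ-trans (conj-+ _ _) (+ᶜ-congˡ (conj-Σ< (a ∘ suc) n))

  ‖conj‖≤ : ∀ z → ‖ conj z ‖ ≤ ‖ z ‖
  ‖conj‖≤ z = +-mono-≤ (≤-reflexive (∣-∣-cong (re-conj z)))
    (≤-respˡ (sym (∣-∣-cong (im-conj z))) (∣-x∣≤ _))

  exp-conj : ∀ {z w} → IsExpSum z w → IsExpSum (conj z) (conj w)
  exp-conj {z} {w} z⇒w ε 0<ε = mapᵉ (λ n h → ≤-trans (≤-respˡ (‖‖-cong (begin
    conj (Σ< (expTerm z) n -ᶜ w)
      ≈⟨ ≈ᶜ-trans (conj-+ _ _) (+ᶜ-cong (conj-Σ< (expTerm z) n) (conj-neg w)) ⟩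
    Σ< (conj ∘ expTerm z) n -ᶜ conj w
      ≈⟨ +ᶜ-congʳ (Σ<-cong conj-expTerm n) ⟩
    Σ< (expTerm (conj z)) n -ᶜ conj w ∎)) (‖conj‖≤ _)) h) (z⇒w ε 0<ε)
    where
    open SetoidReasoning ℂ-setoid
    conj-expTerm : ∀ k → conj (expTerm z k) ≈ᶜ expTerm (conj z) k
    conj-expTerm k = ≈ᶜ-trans (conj-* (ι (1/!ᴿ k)) (z ^ᶜ k)) (*ᶜ-cong (conj-ι (1/!ᴿ k)) (conj-^ z k))

-- Positivity of sine on the half turn

module SinePositivity {A : ArchimedeanRing} (C : Complexification A) where
  open ComplexProperties C
  open Series C
  open Exponential C
  open R-Solver using (solve; con; _:+_; _:*_; _:-_; :-_; _:=_)

  ⅈ : Carrier → ℂ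
  ⅈ x = 0# +i x

  re-ⅈ* : ∀ x z → re (ⅈ x *ᶜ z) ≈ - (x * im z)
  re-ⅈ* x z = trans (re-* (ⅈ x) z) (trans
    (+-cong (trans (*-congʳ (re-+i 0# x)) (zeroˡ _)) (-‿cong (*-congʳ (im-+i 0# x)))) (+-identityˡ _))

  im-ⅈ* : ∀ x z → im (ⅈ x *ᶜ z) ≈ x * re z
  im-ⅈ* x z = trans (im-* (ⅈ x) z) (trans
    (+-cong (trans (*-congʳ (re-+i 0# x)) (zeroˡ _)) (*-congʳ (im-+i 0# x))) (+-identityˡ _))

  -- Four is the period of the powers of i: in such a block of the series of e^{ix}, x real, only
  -- the offsets 1 and 3 contribute, with opposite signs.
  blockIm : (ℕ → ℂ) → ℕ → Carrier
  blockIm a m = im (a (m ℕ.* 4)) + (im (a (1 ℕ.+ m ℕ.* 4)) +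
    (im (a (2 ℕ.+ m ℕ.* 4)) + im (a (3 ℕ.+ m ℕ.* 4))))

  im-Σ<-block : ∀ a M → im (Σ< a (suc M ℕ.* 4)) ≈ blockIm a 0 + im (Σ< (λ k → a (4 ℕ.+ k)) (M ℕ.* 4))
  im-Σ<-block a M = trans (im-+ _ _) (trans (+-congˡ (trans (im-+ _ _) (+-congˡ
    (trans (im-+ _ _) (+-congˡ (im-+ _ _))))))
    (solve 5 (λ a b c d s → a :+ (b :+ (c :+ (d :+ s))) := (a :+ (b :+ (c :+ d))) :+ s) refl _ _ _ _ _))

  blocks-nonNeg⇒Σ-nonNeg : ∀ a → (∀ m → 0# ≤ blockIm a m) → ∀ M → 0# ≤ im (Σ< a (M ℕ.* 4))
  blocks-nonNeg⇒Σ-nonNeg a h zero    = ≤-reflexive (sym im-0)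
  blocks-nonNeg⇒Σ-nonNeg a h (suc M) = ≤-respʳ (sym (im-Σ<-block a M))
    (+-nonNeg (h 0) (blocks-nonNeg⇒Σ-nonNeg (λ k → a (4 ℕ.+ k)) (h ∘ suc) M))

  first-block≤Σ : ∀ a → (∀ m → 0# ≤ blockIm a m) → ∀ M → blockIm a 0 ≤ im (Σ< a (suc M ℕ.* 4))
  first-block≤Σ a h M = ≤-by-difference (im-Σ<-block a M)
    (blocks-nonNeg⇒Σ-nonNeg (λ k → a (4 ℕ.+ k)) (h ∘ suc) M)

  -- Bounds at arbitrarily late indices suffice for the limit; grouping into blocks provides them
  -- only at multiples of four.
  ⇒-im-lowerBound : ∀ {s w c} → s ⇒ w → (∀ N → ∃ λ n → N ℕ.≤ n × c ≤ im (s n)) → c ≤ im w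
  ⇒-im-lowerBound {s} {w} {c} s⇒w h = ≤-by-difference
    (solve 2 (λ c y → y := c :+ :- (c :- y)) refl c (im w))
    (≤-respˡ -0#≈0# (neg-antimono (≤-closed close)))
    where
    close : ∀ ε → 0ℚ ℚ.< ε → c - im w ≤ fromℚ ε
    close ε 0<ε = begin
      c - im w              ≤⟨ +-mono-≤ (proj₂ (proj₂ large)) ≤-refl ⟩
      im (s n) - im w       ≈⟨ trans (im-+ _ _) (+-congˡ (im-neg w)) ⟨
      im (s n -ᶜ w)         ≤⟨ x≤∣x∣ _ ⟩
      ∣ im (s n -ᶜ w) ∣     ≤⟨ ≤-by-difference (+-comm _ _) (∣∣-nonNeg _) ⟩
      ‖ s n -ᶜ w ‖          ≤⟨ proj₂ (s⇒w ε 0<ε) n (proj₁ (proj₂ large)) ⟩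
      fromℚ ε               ∎
      where
      open ≤-Reasoning
      large = h (proj₁ (s⇒w ε 0<ε))
      n = proj₁ large

  1/!ᴿ-nat : ∀ k → 1/!ᴿ k ≈ natᴿ (suc k) * 1/!ᴿ (suc k)
  1/!ᴿ-nat k = sym (trans (*-congˡ (1/!ᴿ-suc k)) (trans (sym (*-assoc _ _ _))
    (trans (*-congʳ (natᴿ*1/suc k)) (*-identityˡ _))))

  6ℚ : ℚ
  6ℚ = + 6 ℚ./ 1

  -- The quotient of the two factorials is (k + 2)(k + 3) ≥ 2 · 3. For 0 ≤ x ≤ 2 this exceeds x² ≤
  -- 4, and the surplus 6 - 4 is the factor 2 in `blockIm-lowerBound`.
  1/!ᴿ-drop : ∀ k → fromℚ 6ℚ * 1/!ᴿ (3 ℕ.+ k) ≤ 1/!ᴿ (1 ℕ.+ k)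
  1/!ᴿ-drop k = begin
    fromℚ 6ℚ * 1/!ᴿ (3 ℕ.+ k)
      ≈⟨ solve 1 (λ c → con 6ℚ :* c := (con 2ℚ :* con 3ℚ) :* c) refl _ ⟩
    (fromℚ 2ℚ * fromℚ 3ℚ) * 1/!ᴿ (3 ℕ.+ k)
      ≤⟨ *-monoʳ-≤ (<⇒≤ (1/!ᴿ-pos (3 ℕ.+ k))) (*-mono-≤ 0≤fromℚ2 (natᴿ-nonNeg (3 ℕ.+ k))
           (≤-respˡ natᴿ-2 (natᴿ-mono (ℕ.m≤m+n 2 k))) (≤-respˡ natᴿ-3 (natᴿ-mono (ℕ.m≤m+n 3 k)))) ⟩
    (natᴿ (2 ℕ.+ k) * natᴿ (3 ℕ.+ k)) * 1/!ᴿ (3 ℕ.+ k)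
      ≈⟨ trans (*-assoc _ _ _) (trans (*-congˡ (sym (1/!ᴿ-nat (2 ℕ.+ k)))) (sym (1/!ᴿ-nat (1 ℕ.+ k)))) ⟩
    1/!ᴿ (1 ℕ.+ k) ∎
    where open ≤-Reasoning

  module _ {x} (0≤x : 0# ≤ x) (x≤2 : x ≤ fromℚ 2ℚ) where
    z : ℂ
    z = ⅈ x

    im-zz* : ∀ w → im (z *ᶜ (z *ᶜ w)) ≈ - (x * (x * im w))
    im-zz* w = trans (im-ⅈ* x _) (trans (*-congˡ (re-ⅈ* x w))
      (solve 2 (λ x y → x :* (:- (x :* y)) := :- (x :* (x :* y))) refl _ _))

    re-zz* : ∀ w → re (z *ᶜ (z *ᶜ w)) ≈ - (x * (x * re w))
    re-zz* w = trans (re-ⅈ* x _) (-‿cong (*-congˡ (im-ⅈ* x w)))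

    re-z^4m-nonNeg : ∀ m → 0# ≤ re (z ^ᶜ (m ℕ.* 4))
    re-z^4m-nonNeg zero    = ≤-respʳ (sym re-1) (<⇒≤ 0<1)
    re-z^4m-nonNeg (suc m) = ≤-respʳ (sym (trans (re-zz* _) (trans (-‿cong (*-congˡ (*-congˡ (re-zz* _))))
      (solve 2 (λ x y → :- (x :* (x :* (:- (x :* (x :* y))))) := (x :* x) :* ((x :* x) :* y)) refl _ _))))
      (*-nonNeg (*-nonNeg 0≤x 0≤x) (*-nonNeg (*-nonNeg 0≤x 0≤x) (re-z^4m-nonNeg m)))

    im-z^4m : ∀ m → im (z ^ᶜ (m ℕ.* 4)) ≈ 0#
    im-z^4m zero    = im-1
    im-z^4m (suc m) = trans (im-zz* _) (trans (-‿cong (*-congˡ (*-congˡ (im-zz* _))))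
      (trans (solve 2 (λ x y → :- (x :* (x :* (:- (x :* (x :* y))))) := (x :* x) :* ((x :* x) :* y)) refl _ _)
        (trans (*-congˡ (trans (*-congˡ (im-z^4m m)) (zeroʳ _))) (zeroʳ _))))

    -- The block equals P x (c₁ - x² c₃) with P = x^{4m}, where c₁ ≥ 6c₃ and x² ≤ 4.
    blockIm-lowerBound : ∀ m → fromℚ 2ℚ * (re (z ^ᶜ (m ℕ.* 4)) * x * 1/!ᴿ (3 ℕ.+ m ℕ.* 4)) ≤
                               blockIm (expTerm z) m
    blockIm-lowerBound m = ≤-by-difference block≈ (*-nonNeg (*-nonNeg (re-z^4m-nonNeg m) 0≤x)
      (+-nonNeg (x≤y⇒0≤y-x (1/!ᴿ-drop N))
        (*-nonNeg (<⇒≤ (1/!ᴿ-pos (3 ℕ.+ N))) (x≤y⇒0≤y-x (*-mono-≤ 0≤x 0≤fromℚ2 x≤2 x≤2)))))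
      where
      N = m ℕ.* 4
      P = re (z ^ᶜ N)
      Q = im (z ^ᶜ N)
      c₁ = 1/!ᴿ (1 ℕ.+ N)
      c₂ = 1/!ᴿ (2 ℕ.+ N)
      c₃ = 1/!ᴿ (3 ℕ.+ N)
      im-odd : im (z ^ᶜ (3 ℕ.+ N)) ≈ - (x * (x * (x * P)))
      im-odd = trans (im-zz* _) (-‿cong (*-congˡ (*-congˡ (im-ⅈ* x _))))
      even-vanish : ∀ c {y} → y ≈ 0# → c * y ≈ 0#
      even-vanish c e = trans (*-congˡ e) (zeroʳ c)
      im-even : im (z ^ᶜ (2 ℕ.+ N)) ≈ 0#
      im-even = trans (im-zz* _) (trans (-‿cong (even-vanish x (even-vanish x (im-z^4m m)))) -0#≈0#)
      block≈ : blockIm (expTerm z) m ≈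
        fromℚ 2ℚ * (P * x * c₃) +
        P * x * ((c₁ - fromℚ 6ℚ * c₃) + c₃ * (fromℚ 2ℚ * fromℚ 2ℚ - x * x))
      block≈ = trans
        (+-cong (trans (im-ι* _ _) (even-vanish _ (im-z^4m m)))
          (+-cong (trans (im-ι* c₁ _) (*-congˡ (im-ⅈ* x _)))
            (+-cong (trans (im-ι* c₂ _) (even-vanish c₂ im-even))
              (trans (im-ι* c₃ _) (*-congˡ im-odd)))))
        (trans (trans (+-identityˡ _) (+-congˡ (+-identityˡ _)))
          (solve 4 (λ P x c₁ c₃ → c₁ :* (x :* P) :+ c₃ :* (:- (x :* (x :* (x :* P)))) :=
            con 2ℚ :* (P :* x :* c₃) :+
            P :* x :* ((c₁ :- con 6ℚ :* c₃) :+ c₃ :* (con 2ℚ :* con 2ℚ :- x :* x)))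
            refl P x c₁ c₃))

    blockIm-nonNeg : ∀ m → 0# ≤ blockIm (expTerm z) m
    blockIm-nonNeg m = ≤-trans (*-nonNeg 0≤fromℚ2 (*-nonNeg (*-nonNeg (re-z^4m-nonNeg m) 0≤x)
      (<⇒≤ (1/!ᴿ-pos (3 ℕ.+ m ℕ.* 4))))) (blockIm-lowerBound m)

    -- No block is negative, so the first one bounds the whole sum: sin x ≥ x/3 on [0,2].
    sin-lowerBound : ∀ {w} → IsExpSum z w → fromℚ 2ℚ * (x * 1/!ᴿ 3) ≤ im w
    sin-lowerBound z⇒w = ⇒-im-lowerBound z⇒w λ N → suc N ℕ.* 4 ,
      ℕ.≤-trans (ℕ.n≤1+n N) (ℕ.m≤m*n (suc N) 4) ,
      ≤-respˡ (*-congˡ (*-congʳ (trans (*-congʳ re-1) (*-identityˡ x))))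
        (≤-trans (blockIm-lowerBound 0) (first-block≤Σ (expTerm z) blockIm-nonNeg N))

  sin-pos : ∀ {x w} → 0# < x → x ≤ fromℚ 2ℚ → IsExpSum (ⅈ x) w → 0# < im w
  sin-pos 0<x x≤2 z⇒w = <-≤-trans
    (*-pos (fromℚ-pos (ℚ.positive⁻¹ 2ℚ)) (*-pos 0<x (1/!ᴿ-pos 3)))
    (sin-lowerBound (<⇒≤ 0<x) x≤2 z⇒w)

  -- If x² < 0, then 0 ≤ x is impossible, and so is x < 0 because (-x)² = x²; the goal `⊥` lets both
  -- cases be refuted without deciding the sign.
  square-nonNeg : ∀ x → 0# ≤ x * x
  square-nonNeg x xx<0 = ¬0≤x λ x<0 → *-nonNeg (-x≥0 x<0) (-x≥0 x<0)
    (≤-<-trans (≤-reflexive (solve 1 (λ x → (:- x) :* (:- x) := x :* x) refl x)) xx<0)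
    where
    ¬0≤x : ¬ (0# ≤ x)
    ¬0≤x 0≤x = *-nonNeg 0≤x 0≤x xx<0
    -x≥0 : x < 0# → 0# ≤ - x
    -x≥0 x<0 = ≤-respˡ -0#≈0# (neg-antimono (<⇒≤ x<0))

  -- If e^{ih} = u = is, then e^{i(2h − x)} = u² conj(e^{ix}), so that
  -- sin (2h − x) = s² sin x: positivity on (0 , h] spreads to (0 , 2h).
  sin-pos-half-turn : ∀ {h u} → h ≤ fromℚ 2ℚ → IsExpSum (ⅈ h) u → re u ≈ 0# →
    ∀ {x w} → ¬ (x ≤ 0#) → ¬ (h + h ≤ x) → IsExpSum (ⅈ x) w → ¬ (im w ≤ 0#)
  sin-pos-half-turn {h} {u} h≤2 h⇒u u-im {x} {w} x>0 x<2h x⇒w w≤0 =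
    x>0 λ 0<x → small 0<x x≤h
    where
    small : 0# < x → ¬ (x ≤ h)
    small 0<x x≤h = w≤0 (sin-pos 0<x (≤-trans x≤h h≤2) x⇒w)
    y = h + h - x
    y⇒ : IsExpSum (ⅈ y) ((u *ᶜ u) *ᶜ conj w)
    y⇒ = exp-congˡ (≈ᶜ-intro
      (trans (trans (re-+ _ _) (+-cong (trans (re-+ _ _) (+-cong (re-+i _ _) (re-+i _ _)))
        (trans (re-conj _) (re-+i _ _)))) (trans (+-identityʳ _) (trans (+-identityʳ _) (sym (re-+i _ _)))))
      (trans (trans (im-+ _ _) (+-cong (trans (im-+ _ _) (+-cong (im-+i _ _) (im-+i _ _)))
        (trans (im-conj _) (-‿cong (im-+i _ _))))) (sym (im-+i _ _))))
      (exp-+ (exp-+ h⇒u h⇒u) (exp-conj x⇒w))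
    sin-y : im ((u *ᶜ u) *ᶜ conj w) ≈ im u * im u * im w
    sin-y = begin
      im ((u *ᶜ u) *ᶜ conj w)
        ≈⟨ trans (im-* _ _) (+-cong (*-cong (re-* u u) (im-conj w)) (*-congʳ (im-* u u))) ⟩
      (re u * re u - im u * im u) * (- im w) + (re u * im u + im u * re u) * re (conj w)
        ≈⟨ +-cong (*-congʳ (+-congʳ (trans (*-congʳ u-im) (zeroˡ _))))
             (trans (*-congʳ (trans (+-cong (trans (*-congʳ u-im) (zeroˡ _))
               (trans (*-congˡ u-im) (zeroʳ _))) (+-identityʳ 0#))) (zeroˡ _)) ⟩
      (0# - im u * im u) * (- im w) + 0#
        ≈⟨ trans (+-identityʳ _) (*-congʳ (+-identityˡ _)) ⟩
      (- (im u * im u)) * (- im w)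
        ≈⟨ solve 2 (λ s y → (:- s) :* (:- y) := s :* y) refl _ _ ⟩
      im u * im u * im w ∎
      where open SetoidReasoning setoid
    sin-y≤0 : im ((u *ᶜ u) *ᶜ conj w) ≤ 0#
    sin-y≤0 = ≤-respˡ (sym sin-y) (≤-respʳ (zeroʳ _) (*-monoˡ-≤ (square-nonNeg (im u)) w≤0))
    y≤0 : h ≤ x → y ≤ 0#
    y≤0 h≤x 0<y = sin-y≤0 (sin-pos 0<y (≤-trans y≤h h≤2) y⇒)
      where
      y≤h : y ≤ h
      y≤h = ≤-by-difference (solve 2 (λ h x → h := (h :+ h :- x) :+ (x :- h)) refl h x)
        (x≤y⇒0≤y-x h≤x)
    -- Were h < x, then y = 2h - x would be at most h, and y > 0 would make sin y positive, against
    -- `sin-y≤0`. So y ≤ 0, that is 2h ≤ x, which `x<2h` excludes.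
    x≤h : x ≤ h
    x≤h h<x = x<2h (≤-by-difference (solve 2 (λ h x → x := (h :+ h) :+ :- (h :+ h :- x)) refl h x)
      (≤-respˡ -0#≈0# (neg-antimono (y≤0 (<⇒≤ h<x)))))

  exp-^ : ∀ {x w} → IsExpSum (ⅈ x) w → ∀ k → IsExpSum (ⅈ (natᴿ (suc k) * x)) (w ^ᶜ suc k)
  exp-^ {x} {w} x⇒w zero = ⇒-congʳ (≈ᶜ-sym (*ᶜ-identityʳ w)) (exp-congˡ (≈ᶜ-intro
    (trans (re-+i _ _) (sym (re-+i _ _)))
    (trans (im-+i _ _) (trans (sym 1x≈x) (sym (im-+i _ _))))) x⇒w)
    where
    1x≈x : natᴿ 1 * x ≈ x
    1x≈x = trans (*-congʳ (trans (natᴿ-suc 0) (trans (+-congˡ natᴿ-zero) (+-identityʳ 1#)))) (*-identityˡ x)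
  exp-^ {x} {w} x⇒w (suc k) = exp-congˡ (≈ᶜ-intro
    (trans (re-+ _ _) (trans (+-cong (re-+i _ _) (re-+i _ _)) (trans (+-identityʳ 0#) (sym (re-+i _ _)))))
    (trans (im-+ _ _) (trans (+-cong (im-+i _ _) (im-+i _ _)) (trans step (sym (im-+i _ _))))))
    (exp-+ x⇒w (exp-^ x⇒w k))
    where
    step : x + natᴿ (suc k) * x ≈ natᴿ (2 ℕ.+ k) * x
    step = sym (trans (*-congʳ (natᴿ-suc (suc k))) (trans (distribʳ _ _ _) (+-congʳ (*-identityˡ x))))

-- Polynomials in y with nonnegative coefficients

module NonNegativePolynomials {A : ArchimedeanRing} (C : Complexification A) where
  open import Data.Fin.Base using (zero; suc)
  open ComplexProperties C
  open R-Solver using (solve; _:+_; _:*_; _:-_; :-_; _:=_)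
  open Sum semiring using (sum; sum-remove; sum-cong-≋; *-distribʳ-sum; ∑-distrib-+)
  private module C = C-Solver

  sum-mono-≤ : ∀ {m} {f g : Vector Carrier m} → (∀ k → f k ≤ g k) → sum f ≤ sum g
  sum-mono-≤ {zero}  h = ≤-refl
  sum-mono-≤ {suc m} h = +-mono-≤ (h zero) (sum-mono-≤ (h ∘ suc))

  sum-nonNeg : ∀ {m} {f : Vector Carrier m} → (∀ k → 0# ≤ f k) → 0# ≤ sum f
  sum-nonNeg {zero}  h = ≤-refl
  sum-nonNeg {suc m} h = +-nonNeg (h zero) (sum-nonNeg (h ∘ suc))

  -- Terms outside the range of `j` can only increase the sum. The induction deletes the index
  -- `j zero` from the vector, and injectivity lets `punchOut` renumber the other indices.
  sum-subfamily-≤ : ∀ {ℓ m} (g : Vector Carrier m) (j : Fin ℓ → Fin m) →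
    (∀ {p q} → j p ≡ j q → p ≡ q) → (∀ k → (∀ i → j i ≢ k) → 0# ≤ g k) → sum (g ∘ j) ≤ sum g
  sum-subfamily-≤ {zero} g j inj h = sum-nonNeg λ k → h k λ ()
  sum-subfamily-≤ {suc ℓ} {zero} g j inj h with () ← j zero
  sum-subfamily-≤ {suc ℓ} {suc m} g j inj h = begin
    g (j zero) + sum (g ∘ j ∘ suc)
      ≈⟨ +-congˡ (sum-cong-≋ {ℓ} λ i → reflexive (≡.cong g (≡.sym (Fin.punchIn-punchOut (j₀≢ i))))) ⟩
    g (j zero) + sum (removeAt g (j zero) ∘ j′)
      ≤⟨ +-mono-≤ ≤-refl (sum-subfamily-≤ (removeAt g (j zero)) j′ inj′ h′) ⟩
    g (j zero) + sum (removeAt g (j zero))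
      ≈⟨ sum-remove {i = j zero} g ⟨
    sum g ∎
    where
    open ≤-Reasoning
    j₀≢ : ∀ i → j zero ≢ j (suc i)
    j₀≢ i e with () ← inj e
    j′ : Fin ℓ → Fin m
    j′ i = punchOut (j₀≢ i)
    inj′ : ∀ {p q} → j′ p ≡ j′ q → p ≡ q
    inj′ {p} {q} e = Fin.suc-injective (inj (Fin.punchOut-injective (j₀≢ p) (j₀≢ q) e))
    h′ : ∀ k → (∀ i → j′ i ≢ k) → 0# ≤ removeAt g (j zero) k
    h′ k k∉ = h (punchIn (j zero) k) λ where
      zero    e → Fin.punchInᵢ≢i (j zero) k (≡.sym e)
      (suc i) e → k∉ i (Fin.punchIn-injective (j zero) _ _ (≡.trans (Fin.punchIn-punchOut (j₀≢ i)) e))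

  record Linear (L : ℂ → Carrier) : Set where
    field
      L-cong : ∀ {z w} → z ≈ᶜ w → L z ≈ L w
      L-+    : ∀ z w → L (z +ᶜ w) ≈ L z + L w
      L-ι*   : ∀ x z → L (ι x *ᶜ z) ≈ x * L z

    L-0 : L 0ᶜ ≈ 0#
    L-0 = trans (L-cong (≈ᶜ-sym (≈ᶜ-trans (*ᶜ-congʳ ι-0) (zeroᶜˡ 0ᶜ)))) (trans (L-ι* 0# 0ᶜ) (zeroˡ _))

    L-sum : ∀ {m} (f : Vector ℂ m) → L (sumᶜ f) ≈ sum (L ∘ f)
    L-sum {zero}  f = L-0
    L-sum {suc m} f = trans (L-+ _ _) (+-congˡ (L-sum (f ∘ suc)))

  eval : ∀ {m} → Vector Carrier m → ℂ → ℂ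
  eval a z = sumᶜ λ k → ι (a k) *ᶜ z ^ᶜ toℕ k

  -- NonNegUpTo m contains the polynomials in y of degree at most m with
  -- nonnegative coefficients, for every y whose powers up to n satisfy L ≥ 0.
  module _ {L} (linear : Linear L) (n : ℕ) (y : ℂ) (L-y^ : ∀ l → l ℕ.≤ n → 0# ≤ L (y ^ᶜ l)) where
    open Linear linear

    NonNegUpTo : ℕ → ℂ → Set
    NonNegUpTo m ζ = ∀ l → l ℕ.+ m ℕ.≤ n → 0# ≤ L (y ^ᶜ l *ᶜ ζ)

    nonNeg-cong : ∀ {m ζ ξ} → ζ ≈ᶜ ξ → NonNegUpTo m ζ → NonNegUpTo m ξ
    nonNeg-cong ζ≈ξ h l l+m≤n = ≤-respʳ (L-cong (*ᶜ-congˡ ζ≈ξ)) (h l l+m≤n)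

    nonNeg-weaken : ∀ {m m′ ζ} → m ℕ.≤ m′ → NonNegUpTo m ζ → NonNegUpTo m′ ζ
    nonNeg-weaken m≤m′ h l l+m′≤n = h l (ℕ.≤-trans (ℕ.+-monoʳ-≤ l m≤m′) l+m′≤n)

    nonNeg-y^ : ∀ k → NonNegUpTo k (y ^ᶜ k)
    nonNeg-y^ k l l+k≤n = ≤-respʳ (L-cong (^ᶜ-homo-* y l k)) (L-y^ (l ℕ.+ k) l+k≤n)

    nonNeg-+ : ∀ {m ζ ξ} → NonNegUpTo m ζ → NonNegUpTo m ξ → NonNegUpTo m (ζ +ᶜ ξ)
    nonNeg-+ h h′ l l+m≤n = ≤-respʳ (sym (trans
      (L-cong (C.solve 3 (λ y ζ ξ → y C.:* (ζ C.:+ ξ) C.:= y C.:* ζ C.:+ y C.:* ξ) ≈ᶜ-refl _ _ _))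
      (L-+ _ _))) (+-nonNeg (h l l+m≤n) (h′ l l+m≤n))

    nonNeg-ι* : ∀ {m x ζ} → 0# ≤ x → NonNegUpTo m ζ → NonNegUpTo m (ι x *ᶜ ζ)
    nonNeg-ι* 0≤x h l l+m≤n = ≤-respʳ (sym (trans
      (L-cong (C.solve 3 (λ y x ζ → y C.:* (x C.:* ζ) C.:= x C.:* (y C.:* ζ)) ≈ᶜ-refl _ _ _))
      (L-ι* _ _))) (*-nonNeg 0≤x (h l l+m≤n))

    -- This closure is why `NonNegUpTo` quantifies over l: the factor y is absorbed into `y ^ᶜ l` at
    -- the cost of one degree.
    nonNeg-y* : ∀ {m ζ} → NonNegUpTo m ζ → NonNegUpTo (suc m) (y *ᶜ ζ)
    nonNeg-y* {m} h l l+1+m≤n = ≤-respʳ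
      (L-cong (C.solve 3 (λ u y ζ → (y C.:* u) C.:* ζ C.:= u C.:* (y C.:* ζ)) ≈ᶜ-refl _ _ _))
      (h (suc l) (≡.subst (ℕ._≤ n) (ℕ.+-suc l m) l+1+m≤n))

    module _ {v z} (0≤v : 0# ≤ v) (z≈v+y : z ≈ᶜ ι v +ᶜ y) where

      nonNeg-z* : ∀ {m ζ} → NonNegUpTo m ζ → NonNegUpTo (suc m) (z *ᶜ ζ)
      nonNeg-z* {m} {ζ} h = nonNeg-cong
        (≈ᶜ-sym (≈ᶜ-trans (*ᶜ-congʳ z≈v+y)
          (C.solve 3 (λ v y ζ → (v C.:+ y) C.:* ζ C.:= v C.:* ζ C.:+ y C.:* ζ) ≈ᶜ-refl _ _ _)))
        (nonNeg-+ (nonNeg-ι* 0≤v (nonNeg-weaken (ℕ.n≤1+n m) h)) (nonNeg-y* h))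

      nonNeg-z^ : ∀ k → NonNegUpTo k (z ^ᶜ k)
      nonNeg-z^ zero    = nonNeg-y^ 0
      nonNeg-z^ (suc k) = nonNeg-z* (nonNeg-z^ k)

      module _ {r} (0≤r : 0# ≤ r) (r≤v : r ≤ v) where

        v-r : ℂ
        v-r = ι (v - r)

        v≈ : ι v ≈ᶜ v-r +ᶜ ι r
        v≈ = ≈ᶜ-trans (ι-cong (solve 2 (λ v r → v := (v :- r) :+ r) refl v r)) (ι-+ _ _)

        z≈ : z ≈ᶜ (v-r +ᶜ ι r) +ᶜ y
        z≈ = ≈ᶜ-trans z≈v+y (+ᶜ-congʳ v≈)

        -- Induct along z^{d+2} - r^{d+2} = z (z^{d+1} - r^{d+1}) + (z - r) r^{d+1}, where z - r =
        -- (v - r) + y. Since z y^{d+1} = v y^{d+1} + y^{d+2}, the top power cancels; besides z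
        -- times the previous case there remain v y^{d+1}, (v - r) r^{d+1} and r^{d+1} y, with
        -- nonnegative coefficients because 0 ≤ r ≤ v.
        nonNeg-z^-r^-y^ : ∀ d → NonNegUpTo (suc d) (z ^ᶜ suc d -ᶜ ι r ^ᶜ suc d -ᶜ y ^ᶜ suc d)
        nonNeg-z^-r^-y^ zero = nonNeg-cong
          (≈ᶜ-sym (≈ᶜ-trans (+ᶜ-congʳ (+ᶜ-congʳ (*ᶜ-congʳ z≈)))
            (C.solve 4 (λ u r y e → ((u C.:+ r) C.:+ y) C.:* e C.:- r C.:* e C.:- y C.:* e C.:= u C.:* e)
              ≈ᶜ-refl _ _ _ _)))
          (nonNeg-ι* (x≤y⇒0≤y-x r≤v) (nonNeg-weaken ℕ.z≤n (nonNeg-y^ 0)))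
        nonNeg-z^-r^-y^ (suc d) = nonNeg-cong
          (≈ᶜ-sym (≈ᶜ-trans
            (+ᶜ-cong (C.solve 4 (λ z zᵈ r rᵈ → z C.:* zᵈ C.:- r C.:* rᵈ C.:=
              z C.:* (zᵈ C.:- rᵈ) C.:+ (z C.:- r) C.:* rᵈ) ≈ᶜ-refl z (z ^ᶜ suc d) (ι r) (ι r ^ᶜ suc d)) ≈ᶜ-refl)
            (≈ᶜ-trans (+ᶜ-congʳ (+ᶜ-cong
                (≈ᶜ-trans (C.solve 4 (λ z zᵈ rᵈ yᵈ → z C.:* (zᵈ C.:- rᵈ) C.:=
                  z C.:* (zᵈ C.:- rᵈ C.:- yᵈ) C.:+ z C.:* yᵈ) ≈ᶜ-refl z (z ^ᶜ suc d) (ι r ^ᶜ suc d) (y ^ᶜ suc d))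
                  (+ᶜ-congˡ (*ᶜ-congʳ z≈v+y)))
                (*ᶜ-congʳ (+ᶜ-congʳ z≈))))
              (C.solve 7 (λ w v y yᵈ u r rᵈ →
                w C.:+ (v C.:+ y) C.:* yᵈ C.:+ (u C.:+ r C.:+ y C.:- r) C.:* rᵈ C.:- y C.:* yᵈ C.:=
                w C.:+ (v C.:* yᵈ C.:+ (u C.:* rᵈ C.:+ rᵈ C.:* y)))
                ≈ᶜ-refl _ (ι v) y (y ^ᶜ suc d) v-r (ι r) (ι r ^ᶜ suc d)))))
          (nonNeg-+ (nonNeg-z* (nonNeg-z^-r^-y^ d))
            (nonNeg-+ (nonNeg-ι* 0≤v (nonNeg-weaken (ℕ.n≤1+n (suc d)) (nonNeg-y^ (suc d))))
              (nonNeg-+ (nonNeg-ι* (x≤y⇒0≤y-x r≤v) (nonNeg-weaken ℕ.z≤n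
                  (nonNeg-cong (≈ᶜ-trans (*ᶜ-identityʳ _) (ι-^ r (suc d)))
                    (nonNeg-ι* (^-nonNeg 0≤r (suc d)) (nonNeg-y^ 0)))))
                (nonNeg-weaken {1} (ℕ.s≤s ℕ.z≤n) (nonNeg-cong
                  (*ᶜ-cong (ι-^ r (suc d)) (*ᶜ-identityʳ y))
                  (nonNeg-ι* (^-nonNeg 0≤r (suc d)) (nonNeg-y^ 1)))))))

        -- Multiplication by z = v + y turns the top power y^m into v y^m + y^{m+1}; subtracting the
        -- new top power leaves the nonnegative v y^m.
        nonNeg-z^[z^-r^]-y^ : ∀ k d →
          NonNegUpTo (k ℕ.+ suc d) (z ^ᶜ k *ᶜ (z ^ᶜ suc d -ᶜ ι r ^ᶜ suc d) -ᶜ y ^ᶜ (k ℕ.+ suc d))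
        nonNeg-z^[z^-r^]-y^ zero d = nonNeg-cong (+ᶜ-congʳ (≈ᶜ-sym (*ᶜ-identityˡ _))) (nonNeg-z^-r^-y^ d)
        nonNeg-z^[z^-r^]-y^ (suc k) d = nonNeg-cong
          (≈ᶜ-trans (+ᶜ-congʳ (*ᶜ-congʳ z≈v+y)) (≈ᶜ-trans
            (C.solve 5 (λ v y zᵏ w yᵏ → (v C.:+ y) C.:* (zᵏ C.:* w C.:- yᵏ) C.:+ v C.:* yᵏ C.:=
              ((v C.:+ y) C.:* zᵏ) C.:* w C.:- y C.:* yᵏ) ≈ᶜ-refl _ _ _ _ _)
            (+ᶜ-congʳ (*ᶜ-congʳ (*ᶜ-congʳ (≈ᶜ-sym z≈v+y))))))
          (nonNeg-+ (nonNeg-z* (nonNeg-z^[z^-r^]-y^ k d))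
            (nonNeg-ι* 0≤v (nonNeg-weaken (ℕ.n≤1+n (k ℕ.+ suc d)) (nonNeg-y^ (k ℕ.+ suc d)))))

        L-z^n-lowerBound : ∀ k → k ℕ.< n → L (y ^ᶜ n) + r ^ (n ∸ k) * L (z ^ᶜ k) ≤ L (z ^ᶜ n)
        -- The exponent n - k is positive, hence a successor; generalising its predecessor to `d`
        -- lets n be replaced by k + (d + 1).
        L-z^n-lowerBound k k<n = bound (n ∸ suc k) (≡.trans (≡.cong (k ℕ.+_) (≡.sym (n∸k≡ k k<n))) (ℕ.m+[n∸m]≡n (ℕ.<⇒≤ k<n)))
          where
          n∸k≡ : ∀ k → k ℕ.< n → n ∸ k ≡ suc (n ∸ suc k)
          n∸k≡ k k<n = ℕ.+-∸-assoc 1 k<n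
          bound : ∀ d → k ℕ.+ suc d ≡ n → L (y ^ᶜ n) + r ^ (n ∸ k) * L (z ^ᶜ k) ≤ L (z ^ᶜ n)
          bound d ≡.refl = ≤-by-difference
            (trans (L-cong (≈ᶜ-trans (^ᶜ-homo-* z k (suc d))
                (C.solve 4 (λ zᵏ zᵈ rᵈ yⁿ → zᵏ C.:* zᵈ C.:=
                  (yⁿ C.:+ rᵈ C.:* zᵏ) C.:+ (zᵏ C.:* (zᵈ C.:- rᵈ) C.:- yⁿ)) ≈ᶜ-refl
                  _ _ (ι r ^ᶜ suc d) (y ^ᶜ (k ℕ.+ suc d)))))
              (trans (L-+ _ _) (+-congʳ (trans (L-+ _ _) (+-congˡ (trans
                (L-cong (*ᶜ-congʳ (≈ᶜ-sym (ι-^ r (suc d))))) (trans (L-ι* _ _)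
                (*-congʳ (reflexive (≡.cong (r ^_) (≡.sym (ℕ.m+n∸m≡n k (suc d)))))))))))))
            (≤-respʳ (L-cong (*ᶜ-identityˡ _)) (nonNeg-z^[z^-r^]-y^ k d 0 ℕ.≤-refl))

      eval-lowerBound : (a : Vector Carrier (suc n)) → 0# ≤ a (fromℕ n) →
        ∀ {ℓ} (j : Fin ℓ → Fin (suc n)) → (∀ {p q} → j p ≡ j q → p ≡ q) → (∀ i → toℕ (j i) ℕ.< n) →
        (∀ k → (∀ i → j i ≢ k) → 0# ≤ a k) →
        (lam r : Fin ℓ → Carrier) → (∀ i → 0# ≤ lam i) → sum lam ≈ 1# →
        (∀ i → 0# ≤ r i) → (∀ i → r i ≤ v) →
        (∀ i → a (j i) ≈ - (lam i * a (fromℕ n) * r i ^ (n ∸ toℕ (j i)))) →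
        a (fromℕ n) * L (y ^ᶜ n) ≤ L (eval a z)
      eval-lowerBound a 0≤aₙ {ℓ} j inj j<n a≥0 lam r 0≤lam Σlam≈1 0≤r r≤v a-j = begin
        aₙ * L (y ^ᶜ n)
          ≈⟨ weighted (L (y ^ᶜ n)) ⟩
        sum (λ i → lam i * (aₙ * L (y ^ᶜ n)))
          ≤⟨ sum-mono-≤ term ⟩
        sum (λ i → lam i * (aₙ * L (z ^ᶜ n)) + g (j i))
          ≈⟨ ∑-distrib-+ {ℓ} _ _ ⟩
        sum (λ i → lam i * (aₙ * L (z ^ᶜ n))) + sum (g ∘ j)
          ≈⟨ +-congʳ (trans (sym (weighted (L (z ^ᶜ n))))
               (*-congˡ (reflexive (≡.cong (λ m → L (z ^ᶜ m)) (≡.sym (Fin.toℕ-fromℕ n)))))) ⟩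
        g (fromℕ n) + sum (g ∘ j)
          ≤⟨ sum-subfamily-≤ g j⁺ inj⁺ g≥0 ⟩
        sum g
          ≈⟨ trans (L-sum (λ k → ι (a k) *ᶜ z ^ᶜ toℕ k)) (sum-cong-≋ {suc n} λ k → L-ι* (a k) (z ^ᶜ toℕ k)) ⟨
        L (eval a z) ∎
        where
        open ≤-Reasoning
        aₙ = a (fromℕ n)
        g : Vector Carrier (suc n)
        g k = a k * L (z ^ᶜ toℕ k)
        weighted : ∀ x → aₙ * x ≈ sum (λ i → lam i * (aₙ * x))
        weighted x = trans (sym (trans (*-congʳ Σlam≈1) (*-identityˡ _))) (*-distribʳ-sum {ℓ} (aₙ * x) lam)
        -- Since a_j is -λᵢ aₙ rᵢ^{n-j}, this is λᵢ aₙ times the inequality `L-z^n-lowerBound`.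
        term : ∀ i → lam i * (aₙ * L (y ^ᶜ n)) ≤ lam i * (aₙ * L (z ^ᶜ n)) + g (j i)
        term i = ≤-by-difference
          (trans (+-congˡ (*-congʳ (a-j i))) (solve 6 (λ l a u w r x →
            l :* (a :* u) :+ (:- (l :* a :* r)) :* x :=
            l :* (a :* w) :+ l :* (a :* (u :- (w :+ r :* x))))
            refl (lam i) aₙ (L (z ^ᶜ n)) (L (y ^ᶜ n)) _ _))
          (*-nonNeg (0≤lam i) (*-nonNeg 0≤aₙ
            (x≤y⇒0≤y-x (L-z^n-lowerBound (0≤r i) (r≤v i) (toℕ (j i)) (j<n i)))))
        -- The index n joins the negative indices, so that its term is kept in full; all remaining
        -- coefficients are nonnegative and their terms may be dropped.
        j⁺ : Fin (suc ℓ) → Fin (suc n)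
        j⁺ zero    = fromℕ n
        j⁺ (suc i) = j i
        n≢j : ∀ i → fromℕ n ≢ j i
        n≢j i e = ℕ.<-irrefl (≡.trans (≡.cong toℕ (≡.sym e)) (Fin.toℕ-fromℕ n)) (j<n i)
        inj⁺ : ∀ {p q} → j⁺ p ≡ j⁺ q → p ≡ q
        inj⁺ {zero}  {zero}  e = ≡.refl
        inj⁺ {zero}  {suc q} e = contradiction e (n≢j q)
        inj⁺ {suc p} {zero}  e = contradiction (≡.sym e) (n≢j p)
        inj⁺ {suc p} {suc q} e = ≡.cong suc (inj e)
        g≥0 : ∀ k → (∀ i → j⁺ i ≢ k) → 0# ≤ g k
        g≥0 k k∉ = *-nonNeg (a≥0 k (k∉ ∘ suc)) (≤-respʳ (L-cong (*ᶜ-identityˡ _))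
          (nonNeg-z^ (toℕ k) 0 (ℕ.≤-pred (Fin.toℕ<n k))))

-- Supporting functionals and the sector

module SectorTheorem {A : ArchimedeanRing} (C : Complexification A) where
  open ComplexProperties C
  open Series C
  open Exponential C
  open SinePositivity C
  open NonNegativePolynomials C
  open R-Solver using (solve; _:*_; _:=_)
  open Sum semiring using (sum)

  infix 4 _⟶_
  _⟶_ : (ℕ → ℂ) → ℂ → Set
  s ⟶ w = ∀ ε → 0ℚ ℚ.< ε → ∃ λ N → ∀ n → N ℕ.≤ n →
          ∣ re (s n) - re w ∣ < fromℚ ε × ∣ im (s n) - im w ∣ < fromℚ ε

  ⟶⇒⇒ : ∀ {s w} → s ⟶ w → s ⇒ w
  ⟶⇒⇒ {s} {w} s⟶w ε 0<ε = mapᵉ (λ n (re< , im<) → ≤-respˡ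
      (sym (+-cong (∣-∣-cong (trans (re-+ _ _) (+-congˡ (re-neg w))))
        (∣-∣-cong (trans (im-+ _ _) (+-congˡ (im-neg w))))))
      (≤-respʳ (half+half ε) (+-mono-≤ (<⇒≤ re<) (<⇒≤ im<))))
    (s⟶w (½ ℚ.* ε) (½-pos 0<ε))

  re-linear : Linear re
  re-linear = record { L-cong = re-cong ; L-+ = re-+ ; L-ι* = re-ι* }

  im-linear : Linear im
  im-linear = record { L-cong = im-cong ; L-+ = im-+ ; L-ι* = im-ι* }

  im-conj-linear : Linear (im ∘ conj)
  im-conj-linear = record
    { L-cong = im-cong ∘ conj-cong
    ; L-+    = λ z w → trans (im-cong (conj-+ z w)) (im-+ _ _)
    ; L-ι*   = λ x z → trans (im-cong (≈ᶜ-trans (conj-* _ z) (*ᶜ-congʳ (conj-ι x)))) (im-ι* x _)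
    }

  -- Positivity at the top power is doubly negated, which is the form that `sin-pos-half-turn`
  -- delivers and enough for a final goal `⊥`.
  Supports : ℕ → ℂ → (ℂ → Carrier) → Set
  Supports n w L = (∀ l → l ℕ.≤ n → 0# ≤ L (w ^ᶜ l)) × ¬ (L (w ^ᶜ n) ≤ 0#)

  ≰⇒≥ : ∀ {x y} → ¬ (x ≤ y) → y ≤ x
  ≰⇒≥ x≰y x<y = x≰y (<⇒≤ x<y)

  supports-scale : ∀ {L ρ n w} → Linear L → 0# < ρ → Supports n w L → Supports n (ι ρ *ᶜ w) L
  supports-scale {L} {ρ} {n} {w} linear 0<ρ (L≥0 , L>0) =
    (λ l l≤n → ≤-respʳ (sym (power l)) (*-nonNeg (^-nonNeg (<⇒≤ 0<ρ) l) (L≥0 l l≤n))) ,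
    λ h → L>0 λ 0<L → ≤-respˡ (power n) h (*-pos (^-pos 0<ρ n) 0<L)
    where
    open Linear linear
    power : ∀ l → L ((ι ρ *ᶜ w) ^ᶜ l) ≈ ρ ^ l * L (w ^ᶜ l)
    power l = trans (L-cong (≈ᶜ-trans (^ᶜ-distrib-* (ι ρ) w l) (*ᶜ-congʳ (≈ᶜ-sym (ι-^ ρ l))))) (L-ι* _ _)

  -- The multiples l φ stay in [0 , 2h), where sine is nonnegative.
  supports-im : ∀ {h u} → h ≤ fromℚ 2ℚ → IsExpSum (ⅈ h) u → re u ≈ 0# →
    ∀ {φ w} n → ¬ (φ ≤ 0#) → ¬ (h + h ≤ natᴿ (suc n) * φ) → IsExpSum (ⅈ φ) w → Supports (suc n) w im
  supports-im {h} h≤2 h⇒u u-re {φ} {w} n φ>0 nφ<2h φ⇒w = nonNeg , pos n ℕ.≤-refl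
    where
    0≤φ : 0# ≤ φ
    0≤φ = ≰⇒≥ φ>0
    pos : ∀ k → k ℕ.≤ n → ¬ (im (w ^ᶜ suc k) ≤ 0#)
    pos k k≤n = sin-pos-half-turn h≤2 h⇒u u-re
      (λ kφ≤0 → φ>0 (≤-trans (≤-by-difference
        (trans (*-congʳ (natᴿ-suc k)) (trans (distribʳ _ _ _) (+-congʳ (*-identityˡ φ))))
        (*-nonNeg (natᴿ-nonNeg k) 0≤φ)) kφ≤0))
      (λ 2h≤kφ → nφ<2h (≤-trans 2h≤kφ (*-monoʳ-≤ 0≤φ (natᴿ-mono (ℕ.s≤s k≤n)))))
      (exp-^ φ⇒w k)
    nonNeg : ∀ l → l ℕ.≤ suc n → 0# ≤ im (w ^ᶜ l)
    nonNeg zero    _          = ≤-reflexive (sym im-1)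
    nonNeg (suc k) (ℕ.s≤s k≤n) = ≰⇒≥ (pos k k≤n)

  supports-re : ∀ {z w} n → z ≈ᶜ 0ᶜ → IsExpSum z w → Supports n w re
  supports-re n z≈0 z⇒w = (λ l _ → ≤-trans (<⇒≤ 0<1) (≤-reflexive (sym (power l)))) ,
    λ h → ≤-respˡ (power n) h 0<1
    where
    1^ : ∀ l → 1ᶜ ^ᶜ l ≈ᶜ 1ᶜ
    1^ zero    = ≈ᶜ-refl
    1^ (suc l) = ≈ᶜ-trans (*ᶜ-identityˡ _) (1^ l)
    power : ∀ l → re (_ ^ᶜ l) ≈ 1#
    power l = trans (re-cong (≈ᶜ-trans (^ᶜ-congˡ l (≈ᶜ-sym (exp-0 z≈0 z⇒w))) (1^ l))) re-1

  -- Trichotomy of φ is simulated: if no functional exists, `im` refutes 0 < φ and `im ∘ conj`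
  -- refutes φ < 0, so φ ≈ 0 by antisymmetry, and then `re` is one after all.
  supporting-functional : ∀ {h u} → h ≤ fromℚ 2ℚ → IsExpSum (ⅈ h) u → re u ≈ 0# →
    ∀ {φ w} n → ¬ (h + h ≤ natᴿ (suc n) * ∣ φ ∣) → IsExpSum (ⅈ φ) w →
    ¬ ¬ ∃ λ L → Linear L × Supports (suc n) w L
  supporting-functional {h} h≤2 h⇒u u-re {φ} {w} n n∣φ∣<2h φ⇒w none = none
    (re , re-linear , supports-re (suc n)
      (≈ᶜ-intro (trans (re-+i _ _) (sym re-0)) (trans (im-+i _ _) (trans (≤-antisym φ≤0 0≤φ) (sym im-0)))) φ⇒w)
    where
    bound : ∀ {x} → x ≤ ∣ φ ∣ → ¬ (h + h ≤ natᴿ (suc n) * x)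
    bound x≤∣φ∣ 2h≤nx = n∣φ∣<2h (≤-trans 2h≤nx (*-monoˡ-≤ (natᴿ-nonNeg (suc n)) x≤∣φ∣))
    φ≤0 : φ ≤ 0#
    φ≤0 0<φ = none (im , im-linear , supports-im h≤2 h⇒u u-re n (λ φ≤0 → φ≤0 0<φ) (bound (x≤∣x∣ φ)) φ⇒w)
    0≤φ : 0# ≤ φ
    0≤φ φ<0 = none (im ∘ conj , im-conj-linear ,
      (λ l l≤n → ≤-respʳ (im-cong (≈ᶜ-sym (conj-^ w l))) (proj₁ reflected l l≤n)) ,
      λ le → proj₂ reflected (≤-respˡ (im-cong (conj-^ w (suc n))) le))
      where
      -φ⇒ : IsExpSum (ⅈ (- φ)) (conj w)
      -φ⇒ = exp-congˡ (≈ᶜ-intro (trans (re-conj _) (trans (re-+i _ _) (sym (re-+i _ _))))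
        (trans (im-conj _) (trans (-‿cong (im-+i _ _)) (sym (im-+i _ _))))) (exp-conj φ⇒w)
      reflected : Supports (suc n) (conj w) im
      reflected = supports-im h≤2 h⇒u u-re n
        (λ -φ≤0 → ≤-respˡ -0#≈0# (≤-respʳ (-‿involutive φ) (neg-antimono -φ≤0)) φ<0)
        (bound (-x≤∣x∣ φ)) -φ⇒

  -- Sums, exponential terms and monomials are only required up to ≈ᶜ, so that instances may
  -- supply their own expressions: comparing two of them definitionally unfolds every Cauchy proof.
  module _ (Σ′ : ∀ {m} → Vector ℂ m → ℂ) (Σ′≈sumᶜ : ∀ {m} (f : Vector ℂ m) → Σ′ f ≈ᶜ sumᶜ f)
    (term : ℂ → ℕ → ℂ) (term≈ : ∀ z k → term z k ≈ᶜ ι (fromℚ (1/! k)) *ᶜ z ^ᶜ k) where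

    IsExp : ℂ → ℂ → Set
    IsExp z w = (λ N → Σ′ {N} (term z ∘ toℕ)) ⟶ w

    IsExp⇒IsExpSum : ∀ {z z′ w} → z ≈ᶜ z′ → IsExp z w → IsExpSum z′ w
    IsExp⇒IsExpSum {z} z≈z′ h = exp-congˡ z≈z′ (⇒-congˡ
      (λ N → ≈ᶜ-trans (Σ′≈sumᶜ {N} (term z ∘ toℕ)) (Σ<-cong {term z} {expTerm z} term≈expTerm N)) (⟶⇒⇒ h))
      where
      term≈expTerm : ∀ k → term z k ≈ᶜ expTerm z k
      term≈expTerm k = ≈ᶜ-trans (term≈ z k) (*ᶜ-congʳ {z ^ᶜ k} (ι-cong (reflexive (≡.sym (1/!ᴿ≡ k)))))

    no-zero-in-sector : ∀ {π h z₁ u} → π ≈ h + h → h ≤ fromℚ 2ℚ → z₁ ≈ᶜ ⅈ h → IsExp z₁ u → re u ≈ 0# →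
      ∀ n .{{_ : ℕ.NonZero n}} (a : Vector Carrier (suc n)) → 0# < a (fromℕ n) →
      ∀ {ℓ} (j : Fin ℓ → Fin (suc n)) → (∀ {p q} → j p ≡ j q → p ≡ q) → (∀ i → toℕ (j i) ℕ.< n) →
      (∀ k → (∀ i → j i ≢ k) → 0# ≤ a k) →
      (lam r : Fin ℓ → Carrier) → (∀ i → 0# ≤ lam i) → sum lam ≈ 1# →
      (∀ i → 0# ≤ r i) →
      (∀ i → a (j i) ≈ - (lam i * a (fromℕ n) * r i ^ (n ∸ toℕ (j i)))) →
      ∀ {v ρ φ z₂ w z} → 0# ≤ v → (∀ i → r i ≤ v) →
      0# < ρ → ∣ φ ∣ < π * fromℚ (+ 1 ℚ./ n) → z₂ ≈ᶜ ⅈ φ → IsExp z₂ w → z ≈ᶜ ι v +ᶜ ι ρ *ᶜ w →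
      (f : Vector ℂ (suc n)) → (∀ k → f k ≈ᶜ ι (a k) *ᶜ z ^ᶜ toℕ k) → ¬ (Σ′ f ≈ᶜ 0ᶜ)
    no-zero-in-sector {π} {h} π≈2h h≤2 z₁≈ⅈh h⇒u u-re n@(suc m) a 0<aₙ j inj j<n a≥0 lam r 0≤lam Σlam≈1 0≤r a-j
      {v} {ρ} {φ} {z₂} {w} {z} 0≤v r≤v 0<ρ ∣φ∣<π/n z₂≈ⅈφ φ⇒w z≈ f f≈ Σ′f≈0 =
      supporting-functional h≤2 (IsExp⇒IsExpSum z₁≈ⅈh h⇒u) u-re m n∣φ∣<2h (IsExp⇒IsExpSum z₂≈ⅈφ φ⇒w)
        λ (L , linear , w-supports) → contradict L linear (supports-scale linear 0<ρ w-supports)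
      where
      n∣φ∣<2h : ¬ (h + h ≤ natᴿ n * ∣ φ ∣)
      n∣φ∣<2h 2h≤n∣φ∣ = ≤-respʳ cancel (*-monoʳ-≤ (1/suc-nonNeg m) 2h≤n∣φ∣)
        (<-≤-trans ∣φ∣<π/n (≤-reflexive (*-cong π≈2h (reflexive (≡.sym (1/suc≡ m))))))
        where
        cancel : natᴿ n * ∣ φ ∣ * 1/suc m ≈ ∣ φ ∣
        cancel = trans (solve 3 (λ x y z → x :* y :* z := (x :* z) :* y) refl _ _ _)
          (trans (*-congʳ (natᴿ*1/suc m)) (*-identityˡ _))
      eval≈0 : eval a z ≈ᶜ 0ᶜ
      eval≈0 = ≈ᶜ-trans (sumᶜ-cong-≋ {n = suc n} (λ k → ≈ᶜ-sym (f≈ k))) (≈ᶜ-trans (≈ᶜ-sym (Σ′≈sumᶜ f)) Σ′f≈0)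
      contradict : ∀ L → Linear L → ¬ Supports n (ι ρ *ᶜ w) L
      contradict L linear (L≥0 , L>0) = L>0 λ 0<L → ≤-trans
        (eval-lowerBound linear n (ι ρ *ᶜ w) L≥0 0≤v z≈ a (<⇒≤ 0<aₙ) j inj j<n a≥0 lam r 0≤lam Σlam≈1 0≤r r≤v a-j)
        (≤-reflexive (trans (L-cong eval≈0) L-0)) (*-pos 0<aₙ 0<L)
        where open Linear linear

  -- Clears the denominator of the radicand: with c = λᵢ aₙ, d its inverse and s = rᵢ^{n-j}, the
  -- root condition becomes a_j = -λᵢ aₙ rᵢ^{n-j}.
  negative-coefficient : ∀ {b c s d} → b < 0# → c * d ≈ 1# → s ≈ ∣ b ∣ * d → b ≈ - (c * s)
  negative-coefficient {b} {c} {s} {d} b<0 cd≈1 s≈ = sym (trans (-‿cong (begin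
    c * s             ≈⟨ *-congˡ s≈ ⟩
    c * (∣ b ∣ * d)   ≈⟨ solve 3 (λ c b d → c :* (b :* d) := (c :* d) :* b) refl _ _ _ ⟩
    (c * d) * ∣ b ∣   ≈⟨ trans (*-congʳ cd≈1) (*-identityˡ _) ⟩
    ∣ b ∣             ≈⟨ ≤-antisym (∣x∣≤ (≤-trans (<⇒≤ b<0) 0≤-b) ≤-refl) (-x≤∣x∣ b) ⟩
    - b               ∎)) (-‿involutive b))
    where
    open SetoidReasoning setoid
    0≤-b : 0# ≤ - b
    0≤-b = ≤-respˡ -0#≈0# (neg-antimono (<⇒≤ b<0))

open import Defs

-- The Cauchy reals as an Archimedean ordered ring

module RealProperties where
  open ≡
  open RationalLemmas hiding (½-pos; *-pos)
  open CauchyLemmas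
  open +-*-Solver

  ≤-respˡ : ∀ {p q r} → p ≡ q → p ℚ.≤ r → q ℚ.≤ r
  ≤-respˡ refl x = x

  ≤-respʳ : ∀ {p q r} → p ≡ q → r ℚ.≤ p → r ℚ.≤ q
  ≤-respʳ refl x = x

  half-sum : ∀ p ε → (p ℚ.+ ½ ℚ.* ε) ℚ.+ ½ ℚ.* ε ≡ p ℚ.+ ε
  half-sum = solve 2 (λ p ε → (p :+ con ½ :* ε) :+ con ½ :* ε := p :+ ε) refl

  ½< : ∀ {ε} → 0ℚ ℚ.< ε → ½ ℚ.* ε ℚ.< ε
  ½< {ε} 0<ε = subst₂ ℚ._<_ (ℚ.+-identityʳ (½ ℚ.* ε)) (ε/2+ε/2 ε)
    (ℚ.+-monoʳ-< (½ ℚ.* ε) (½-pos 0<ε))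

  dist⇒≤ : ∀ {p q ε} → dist p q ℚ.≤ ε → p ℚ.≤ q ℚ.+ ε
  dist⇒≤ {p} {q} d = ℚ.≤-trans (≤-+dist p q) (ℚ.+-monoʳ-≤ q d)

  -- The criteria below replace the negative definition of ≤ and the strict
  -- ε-bounds of ≈ by eventual non-strict inequalities.

  ≈-intro : ∀ {x y} → (∀ ε → 0ℚ ℚ.< ε → Eventually λ n → dist (seq x n) (seq y n) ℚ.≤ ε) → x ≈ y
  ≈-intro h ε 0<ε = mapᵉ (λ n d → ℚ.≤-<-trans d (½< 0<ε)) (h (½ ℚ.* ε) (½-pos 0<ε))

  ≤-intro : ∀ {x y} → (∀ ε → 0ℚ ℚ.< ε → Eventually λ n → seq x n ℚ.≤ seq y n ℚ.+ ε) → x ≤ y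
  ≤-intro {x} {y} h (ε , 0<ε , y<x) = witnessᵉ (zipᵉ clash (h (½ ℚ.* ε) (½-pos 0<ε)) y<x)
    where
    clash : ∀ n → seq x n ℚ.≤ seq y n ℚ.+ ½ ℚ.* ε → seq y n ℚ.+ ε ℚ.≤ seq x n → _
    clash n a b = ℚ.<-irrefl refl (ℚ.<-≤-trans (½< 0<ε) (ℚ.≤-trans (≤-respˡ (e (seq y n) ε) (ℚ.+-monoʳ-≤ (ℚ.- seq y n) b))
      (≤-respʳ (e (seq y n) (½ ℚ.* ε)) (ℚ.+-monoʳ-≤ (ℚ.- seq y n) a))))
      where
      e : ∀ p q → ℚ.- p ℚ.+ (p ℚ.+ q) ≡ q
      e = solve 2 (λ p q → :- p :+ (p :+ q) := q) refl

  -- Take a Cauchy index N of x - y for ε/4 and compare the rational at N with ε/2. If it is at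
  -- least ε/2, all later differences are at least ε/4 and y < x follows, which is excluded;
  -- otherwise they stay at most 3ε/4.
  ≤-elim : ∀ {x y} → x ≤ y → ∀ ε → 0ℚ ℚ.< ε → Eventually λ n → seq x n ℚ.≤ seq y n ℚ.+ ε
  ≤-elim {x} {y} x≤y ε 0<ε = N , case (ℚ.≤-total (d N) δ)
    where
    d : ℕ → ℚ
    d = seq (x - y)
    δ η : ℚ
    δ = ½ ℚ.* ε
    η = ½ ℚ.* δ
    0<δ : 0ℚ ℚ.< δ
    0<δ = ½-pos 0<ε
    close : ∃ λ N → ∀ m n → N ℕ.≤ m → N ℕ.≤ n → dist (d m) (d n) ℚ.< η
    close = cauchy (x - y) η (½-pos 0<δ)
    N = proj₁ close
    bound : ∀ m n → N ℕ.≤ m → N ℕ.≤ n → d m ℚ.≤ d n ℚ.+ η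
    bound m n ≤m ≤n = dist⇒≤ (ℚ.<⇒≤ (proj₂ close m n ≤m ≤n))
    restore : ∀ p q r → (p ℚ.- q) ℚ.≤ r → p ℚ.≤ q ℚ.+ r
    restore p q r h = ≤-respˡ (e p q) (ℚ.+-monoʳ-≤ q h)
      where
      e : ∀ p q → q ℚ.+ (p ℚ.- q) ≡ p
      e = solve 2 (λ p q → q :+ (p :- q) := p) refl
    case : d N ℚ.≤ δ ⊎ δ ℚ.≤ d N → ∀ n → N ℕ.≤ n → seq x n ℚ.≤ seq y n ℚ.+ ε
    case (inj₁ dN≤δ) n ≤n = restore (seq x n) (seq y n) ε (ℚ.≤-trans (bound n N ≤n ℕ.≤-refl)
      (ℚ.≤-trans (ℚ.+-mono-≤ dN≤δ (ℚ.<⇒≤ (½< 0<δ))) (ℚ.≤-reflexive (ε/2+ε/2 ε))))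
    case (inj₂ δ≤dN) = contradiction (η , ½-pos 0<δ , N , gap) x≤y
      where
      gap : ∀ m → N ℕ.≤ m → seq y m ℚ.+ η ℚ.≤ seq x m
      gap m ≤m = ≤-respʳ (e₂ (seq x m) (seq y m)) (ℚ.+-monoʳ-≤ (seq y m) (≤-respʳ (e₁ (d m) η)
        (≤-respˡ (trans (cong (ℚ._- η) (sym (ε/2+ε/2 δ))) (e₁ η η))
          (ℚ.+-monoˡ-≤ (ℚ.- η) (ℚ.≤-trans δ≤dN (bound N m ℕ.≤-refl ≤m))))))
        where
        e₁ : ∀ p q → (p ℚ.+ q) ℚ.- q ≡ p
        e₁ = solve 2 (λ p q → (p :+ q) :- q := p) refl
        e₂ : ∀ p q → q ℚ.+ (p ℚ.- q) ≡ p
        e₂ = solve 2 (λ p q → q :+ (p :- q) := p) refl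

  pointwise-≤ : ∀ {x y} → Eventually (λ n → seq x n ℚ.≤ seq y n) → x ≤ y
  pointwise-≤ {x} {y} h = ≤-intro {x} {y} λ ε 0<ε → mapᵉ (λ n p → ℚ.≤-trans p
    (≤-respˡ (ℚ.+-identityʳ (seq y n)) (ℚ.+-monoʳ-≤ (seq y n) (ℚ.<⇒≤ 0<ε)))) h

  pointwise-≈ : ∀ {x y} → Eventually (λ n → seq x n ≡ seq y n) → x ≈ y
  pointwise-≈ {x} {y} h ε 0<ε = mapᵉ (λ n p → subst (ℚ._< ε)
    (sym (trans (cong (λ t → dist t (seq y n)) p) (cong ℚ.∣_∣ (ℚ.+-inverseʳ (seq y n))))) 0<ε) h

  ≈⇒≤ : ∀ {x y} → x ≈ y → x ≤ y
  ≈⇒≤ {x} {y} x≈y = ≤-intro {x} {y} λ ε 0<ε → mapᵉ (λ n d → dist⇒≤ (ℚ.<⇒≤ d)) (x≈y ε 0<ε)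

  ≤-antisym : ∀ {x y} → x ≤ y → y ≤ x → x ≈ y
  ≤-antisym {x} {y} x≤y y≤x = ≈-intro {x} {y} λ ε 0<ε →
    zipᵉ (λ n → dist-≤) (≤-elim {x} {y} x≤y ε 0<ε) (≤-elim {y} {x} y≤x ε 0<ε)

  ≤-trans : ∀ {x y z} → x ≤ y → y ≤ z → x ≤ z
  ≤-trans {x} {y} {z} x≤y y≤z = ≤-intro {x} {z} λ ε 0<ε →
    zipᵉ (λ n a b → ≤-respʳ (half-sum (seq z n) ε) (ℚ.≤-trans a (ℚ.+-monoˡ-≤ (½ ℚ.* ε) b)))
      (≤-elim {x} {y} x≤y (½ ℚ.* ε) (½-pos 0<ε)) (≤-elim {y} {z} y≤z (½ ℚ.* ε) (½-pos 0<ε))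

  ≤-<-trans : ∀ {x y z} → x ≤ y → y < z → x < z
  ≤-<-trans {x} {y} {z} x≤y (ε , 0<ε , y<z) = ½ ℚ.* ε , ½-pos 0<ε ,
    zipᵉ (λ n a b → ℚ.≤-trans (ℚ.+-monoˡ-≤ (½ ℚ.* ε) a) (≤-respˡ (sym (half-sum (seq y n) ε)) b))
      (≤-elim {x} {y} x≤y (½ ℚ.* ε) (½-pos 0<ε)) y<z

  <-≤-trans : ∀ {x y z} → x < y → y ≤ z → x < z
  <-≤-trans {x} {y} {z} (ε , 0<ε , x<y) y≤z = ½ ℚ.* ε , ½-pos 0<ε ,
    zipᵉ (λ n a b → +-cancelʳ-≤ (½ ℚ.* ε) (≤-respˡ (sym (half-sum (seq x n) ε)) (ℚ.≤-trans a b)))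
      x<y (≤-elim {y} {z} y≤z (½ ℚ.* ε) (½-pos 0<ε))
    where
    +-cancelʳ-≤ : ∀ {p q} r → p ℚ.+ r ℚ.≤ q ℚ.+ r → p ℚ.≤ q
    +-cancelʳ-≤ {p} {q} r h = ≤-respˡ (e p r) (≤-respʳ (e q r) (ℚ.+-monoˡ-≤ (ℚ.- r) h))
      where
      e : ∀ p r → (p ℚ.+ r) ℚ.- r ≡ p
      e = solve 2 (λ p r → (p :+ r) :- r := p) refl

  <⇒≤ : ∀ {x y} → x < y → x ≤ y
  <⇒≤ {x} {y} (ε , 0<ε , x<y) = pointwise-≤ {x} {y} (mapᵉ (λ n p → ℚ.≤-trans
    (≤-respˡ (ℚ.+-identityʳ (seq x n)) (ℚ.+-monoʳ-≤ (seq x n) (ℚ.<⇒≤ 0<ε))) p) x<y)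

  +-mono-≤ : ∀ {x y u v} → x ≤ y → u ≤ v → x + u ≤ y + v
  +-mono-≤ {x} {y} {u} {v} x≤y u≤v = ≤-intro {x + u} {y + v} λ ε 0<ε →
    zipᵉ (λ n a b → ≤-respʳ (e (seq y n) (seq v n) ε) (ℚ.+-mono-≤ a b))
      (≤-elim {x} {y} x≤y (½ ℚ.* ε) (½-pos 0<ε)) (≤-elim {u} {v} u≤v (½ ℚ.* ε) (½-pos 0<ε))
    where
    e : ∀ p q ε → (p ℚ.+ ½ ℚ.* ε) ℚ.+ (q ℚ.+ ½ ℚ.* ε) ≡ (p ℚ.+ q) ℚ.+ ε
    e = solve 3 (λ p q ε → (p :+ con ½ :* ε) :+ (q :+ con ½ :* ε) := (p :+ q) :+ ε) refl

  ≈-refl : ∀ {x} → x ≈ x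
  ≈-refl {x} = pointwise-≈ {x} {x} (alwaysᵉ λ _ → refl)

  ≈-sym : ∀ {x y} → x ≈ y → y ≈ x
  ≈-sym {x} {y} x≈y ε 0<ε = mapᵉ (λ n → subst (ℚ._< ε) (dist-sym (seq x n) (seq y n))) (x≈y ε 0<ε)

  ≈-trans : ∀ {x y z} → x ≈ y → y ≈ z → x ≈ z
  ≈-trans {x} {y} {z} x≈y y≈z = ≤-antisym {x} {z}
    (≤-trans {x} {y} {z} (≈⇒≤ {x} {y} x≈y) (≈⇒≤ {y} {z} y≈z))
    (≤-trans {z} {y} {x} (≈⇒≤ {z} {y} (≈-sym {y} {z} y≈z)) (≈⇒≤ {y} {x} (≈-sym {x} {y} x≈y)))

  +-cong : ∀ {x y u v} → x ≈ y → u ≈ v → x + u ≈ y + v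
  +-cong {x} {y} {u} {v} x≈y u≈v = ≤-antisym {x + u} {y + v}
    (+-mono-≤ {x} {y} {u} {v} (≈⇒≤ {x} {y} x≈y) (≈⇒≤ {u} {v} u≈v))
    (+-mono-≤ {y} {x} {v} {u} (≈⇒≤ {y} {x} (≈-sym {x} {y} x≈y)) (≈⇒≤ {v} {u} (≈-sym {u} {v} u≈v)))

  neg-cong : ∀ {x y} → x ≈ y → - x ≈ - y
  neg-cong {x} {y} x≈y ε 0<ε = mapᵉ (λ n → ℚ.≤-<-trans (neg-nonexp (seq x n) (seq y n))) (x≈y ε 0<ε)

  ∣-∣-cong : ∀ {x y} → x ≈ y → ∣ x ∣ ≈ ∣ y ∣
  ∣-∣-cong {x} {y} x≈y ε 0<ε = mapᵉ (λ n → ℚ.≤-<-trans (abs-nonexp (seq x n) (seq y n))) (x≈y ε 0<ε)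

  *-cong : ∀ {x y u v} → x ≈ y → u ≈ v → x * u ≈ y * v
  *-cong {x} {y} {u} {v} x≈y u≈v ε 0<ε =
    let (A , 0≤A , u≤A) = bounded u
        (B , 0≤B , y≤B) = bounded y
        (K , 0<K , A≤K , B≤K) = upper A B 0≤A 0≤B
        (δ , 0<δ , δ-small) = shrink K ε 0<K 0<ε
    in zipᵉ (λ n (b , b′) (d , d′) → ℚ.≤-<-trans
          (*-dist (seq x n) (seq u n) (seq y n) (seq v n) (ℚ.≤-trans b A≤K) (ℚ.≤-trans b′ B≤K))
          (δ-small d d′))
        (zipᵉ (λ _ → _,_) u≤A y≤B) (zipᵉ (λ _ → _,_) (x≈y δ 0<δ) (u≈v δ 0<δ))

  ℝ-isCommutativeRing : IsCommutativeRing _≈_ _+_ _*_ -_ 0ℝ 1ℝ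
  ℝ-isCommutativeRing = record
    { isRing = record
      { +-isAbelianGroup = record
        { isGroup = record
          { isMonoid = record
            { isSemigroup = record
              { isMagma = record
                { isEquivalence = record
                  { refl  = λ {x} → ≈-refl {x}
                  ; sym   = λ {x} {y} → ≈-sym {x} {y}
                  ; trans = λ {x} {y} {z} → ≈-trans {x} {y} {z}
                  }
                ; ∙-cong = λ {x} {y} {u} {v} → +-cong {x} {y} {u} {v}
                }
              ; assoc = λ x y z → pointwise-≈ {x + y + z} {x + (y + z)}
                  (alwaysᵉ λ n → ℚ.+-assoc (seq x n) (seq y n) (seq z n))
              }
            ; identity = (λ x → pointwise-≈ {0ℝ + x} {x} (alwaysᵉ λ n → ℚ.+-identityˡ (seq x n)))
                       , (λ x → pointwise-≈ {x + 0ℝ} {x} (alwaysᵉ λ n → ℚ.+-identityʳ (seq x n)))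
            }
          ; inverse = (λ x → pointwise-≈ {(- x) + x} {0ℝ} (alwaysᵉ λ n → ℚ.+-inverseˡ (seq x n)))
                    , (λ x → pointwise-≈ {x - x} {0ℝ} (alwaysᵉ λ n → ℚ.+-inverseʳ (seq x n)))
          ; ⁻¹-cong = λ {x} {y} → neg-cong {x} {y}
          }
        ; comm = λ x y → pointwise-≈ {x + y} {y + x} (alwaysᵉ λ n → ℚ.+-comm (seq x n) (seq y n))
        }
      ; *-cong = λ {x} {y} {u} {v} → *-cong {x} {y} {u} {v}
      ; *-assoc = λ x y z → pointwise-≈ {x * y * z} {x * (y * z)}
          (alwaysᵉ λ n → ℚ.*-assoc (seq x n) (seq y n) (seq z n))
      ; *-identity = (λ x → pointwise-≈ {1ℝ * x} {x} (alwaysᵉ λ n → ℚ.*-identityˡ (seq x n)))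
                   , (λ x → pointwise-≈ {x * 1ℝ} {x} (alwaysᵉ λ n → ℚ.*-identityʳ (seq x n)))
      ; distrib = (λ x y z → pointwise-≈ {x * (y + z)} {x * y + x * z}
                    (alwaysᵉ λ n → ℚ.*-distribˡ-+ (seq x n) (seq y n) (seq z n)))
                , (λ x y z → pointwise-≈ {(y + z) * x} {y * x + z * x}
                    (alwaysᵉ λ n → ℚ.*-distribʳ-+ (seq x n) (seq y n) (seq z n)))
      }
    ; *-comm = λ x y → pointwise-≈ {x * y} {y * x} (alwaysᵉ λ n → ℚ.*-comm (seq x n) (seq y n))
    }

  ∣p∣≤ : ∀ {p q} → p ℚ.≤ q → ℚ.- p ℚ.≤ q → ℚ.∣ p ∣ ℚ.≤ q
  ∣p∣≤ {p} h₁ h₂ with ℚ.∣p∣≡p∨∣p∣≡-p p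
  ... | inj₁ e = ≤-respˡ (sym e) h₁
  ... | inj₂ e = ≤-respˡ (sym e) h₂

  -p≤∣p∣ : ∀ p → ℚ.- p ℚ.≤ ℚ.∣ p ∣
  -p≤∣p∣ p = ≤-respʳ (ℚ.∣-p∣≡∣p∣ p) (p≤∣p∣ (ℚ.- p))

  ∣x∣≤ : ∀ {x y} → x ≤ y → - x ≤ y → ∣ x ∣ ≤ y
  ∣x∣≤ {x} {y} h₁ h₂ = ≤-intro {∣ x ∣} {y} λ ε 0<ε →
    zipᵉ (λ n → ∣p∣≤) (≤-elim {x} {y} h₁ ε 0<ε) (≤-elim { - x} {y} h₂ ε 0<ε)

  -- A nonnegative fraction is at most its numerator, as denominators are at least 1; a negative one
  -- is below 0.
  p≤natℚ : ∀ p → ∃ λ K → p ℚ.≤ natℚ K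
  p≤natℚ p@(ℚ.mkℚ (+ n) d-1 c) = n , ≤-respˡ (ℚ.↥p/↧p≡p p)
    (ℚ.toℚᵘ-cancel-≤ (ℚᵘ-le p))
    where
    ℚᵘ-le : ∀ p → ℚ.toℚᵘ (+ n ℚ./ suc d-1) ℚᵘ.≤ ℚ.toℚᵘ (natℚ n)
    ℚᵘ-le _ = ℚᵘ.≤-respˡ-≃ (ℚᵘ.≃-sym (ℚ.toℚᵘ-fromℚᵘ (mkℚᵘ (+ n) d-1)))
      (ℚᵘ.≤-respʳ-≃ (ℚᵘ.≃-sym (ℚ.toℚᵘ-fromℚᵘ (mkℚᵘ (+ n) 0)))
        (*≤* (ℤ.*-monoˡ-≤-nonNeg (+ n) (ℤ.+≤+ (ℕ.s≤s ℕ.z≤n)))))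
  p≤natℚ p@(ℚ.mkℚ (ℤ.-[1+ _ ]) d-1 c) = 0 , ℚ.<⇒≤ (ℚ.negative⁻¹ p)

  ℝ-archimedeanRing : ArchimedeanRing
  ℝ-archimedeanRing = record
    { commutativeRing = record { isCommutativeRing = ℝ-isCommutativeRing }
    ; fromℚ        = fromℚ
    ; fromℚ-+      = λ p q → ≈-refl {fromℚ (p ℚ.+ q)}
    ; fromℚ-*      = λ p q → pointwise-≈ {fromℚ (p ℚ.* q)} {fromℚ p * fromℚ q} (alwaysᵉ λ _ → refl)
    ; fromℚ-neg    = λ p → ≈-refl {fromℚ (ℚ.- p)}
    ; fromℚ-0      = ≈-refl {0ℝ}
    ; fromℚ-1      = ≈-refl {1ℝ}
    ; _<_          = _<_
    ; ≤-reflexive  = λ {x} {y} → ≈⇒≤ {x} {y}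
    ; <⇒≤          = λ {x} {y} → <⇒≤ {x} {y}
    ; ≤-trans      = λ {x} {y} {z} → ≤-trans {x} {y} {z}
    ; ≤-<-trans    = λ {x} {y} {z} → ≤-<-trans {x} {y} {z}
    ; <-≤-trans    = λ {x} {y} {z} → <-≤-trans {x} {y} {z}
    ; ≤-antisym    = λ {x} {y} → ≤-antisym {x} {y}
    ; +-mono-≤     = λ {x} {y} {u} {v} → +-mono-≤ {x} {y} {u} {v}
    ; *-pos        = λ {x} {y} → 0<-* x y
    ; fromℚ-mono-< = λ {p} {q} p<q → q ℚ.- p ,
        subst (ℚ._< q ℚ.- p) (ℚ.+-inverseʳ p) (ℚ.+-monoˡ-< (ℚ.- p) p<q) ,
        alwaysᵉ λ _ → ℚ.≤-reflexive (e p q)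
    ; ∣_∣          = ∣_∣
    ; ∣-∣-cong     = λ {x} {y} → ∣-∣-cong {x} {y}
    ; x≤∣x∣        = λ x → pointwise-≤ {x} {∣ x ∣} (alwaysᵉ λ n → p≤∣p∣ (seq x n))
    ; -x≤∣x∣       = λ x → pointwise-≤ { - x} {∣ x ∣} (alwaysᵉ λ n → -p≤∣p∣ (seq x n))
    ; ∣x∣≤         = λ {x} {y} → ∣x∣≤ {x} {y}
    ; ∣x*y∣≤       = λ x y → pointwise-≤ {∣ x * y ∣} {∣ x ∣ * ∣ y ∣}
        (alwaysᵉ λ n → ℚ.≤-reflexive (ℚ.∣p*q∣≡∣p∣*∣q∣ (seq x n) (seq y n)))
    ; archimedean  = λ x → let (B , _ , x≤B) = bounded x ; (K , B≤K) = p≤natℚ B in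
        K , pointwise-≤ {x} {fromℚ (natℚ K)}
          (mapᵉ (λ n b → ℚ.≤-trans (p≤∣p∣ (seq x n)) (ℚ.≤-trans b B≤K)) x≤B)
    ; ≤-closed     = λ {x} h → ≤-intro {x} {0ℝ} λ ε 0<ε →
        mapᵉ (λ n → ≤-respʳ (e′ ε))
          (≤-elim {x} {fromℚ (½ ℚ.* ε)} (h (½ ℚ.* ε) (½-pos 0<ε)) (½ ℚ.* ε) (½-pos 0<ε))
    }
    where
    e : ∀ p q → p ℚ.+ (q ℚ.- p) ≡ q
    e = solve 2 (λ p q → p :+ (q :- p) := q) refl
    e′ : ∀ ε → ½ ℚ.* ε ℚ.+ ½ ℚ.* ε ≡ 0ℚ ℚ.+ ε
    e′ = solve 1 (λ ε → con ½ :* ε :+ con ½ :* ε := con 0ℚ :+ ε) refl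

open RealProperties using (pointwise-≈; pointwise-≤; ℝ-archimedeanRing)

-- The complex numbers as a commutative ring

private
  module R = OrderProperties ℝ-archimedeanRing
  module M = ComplexMultiplication ℝ-archimedeanRing

ℂ-isCommutativeRing : IsCommutativeRing _≈ᶜ_ _+ᶜ_ _*ᶜ_ -ᶜ_ 0ℂ 1ℂ
ℂ-isCommutativeRing = record
  { isRing = record
    { +-isAbelianGroup = record
      { isGroup = record
        { isMonoid = record
          { isSemigroup = record
            { isMagma = record
              { isEquivalence = record
                { refl  = λ {z} → R.refl {re z} , R.refl {im z}
                ; sym   = λ {z} {w} (p , q) → R.sym {re z} {re w} p , R.sym {im z} {im w} q
                ; trans = λ {z} {w} {u} (p , q) (p′ , q′) →
                    R.trans {re z} {re w} {re u} p p′ , R.trans {im z} {im w} {im u} q q′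
                }
              ; ∙-cong = λ {z} {w} {u} {v} (p , q) (p′ , q′) →
                  R.+-cong {re z} {re w} {re u} {re v} p p′ , R.+-cong {im z} {im w} {im u} {im v} q q′
              }
            ; assoc = λ z w u → R.+-assoc (re z) (re w) (re u) , R.+-assoc (im z) (im w) (im u)
            }
          ; identity = (λ z → R.+-identityˡ (re z) , R.+-identityˡ (im z))
                     , (λ z → R.+-identityʳ (re z) , R.+-identityʳ (im z))
          }
        ; inverse = (λ z → R.-‿inverseˡ (re z) , R.-‿inverseˡ (im z))
                  , (λ z → R.-‿inverseʳ (re z) , R.-‿inverseʳ (im z))
        ; ⁻¹-cong = λ {z} {w} (p , q) → R.-‿cong {re z} {re w} p , R.-‿cong {im z} {im w} q
        }
      ; comm = λ z w → R.+-comm (re z) (re w) , R.+-comm (im z) (im w)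
      }
    ; *-cong = λ {z} {w} {u} {v} (p , q) (p′ , q′) →
        R.+-cong {re z * re u} {re w * re v} { - (im z * im u)} { - (im w * im v)}
          (R.*-cong {re z} {re w} {re u} {re v} p p′)
          (R.-‿cong {im z * im u} {im w * im v} (R.*-cong {im z} {im w} {im u} {im v} q q′)) ,
        R.+-cong {re z * im u} {re w * im v} {im z * re u} {im w * re v}
          (R.*-cong {re z} {re w} {im u} {im v} p q′) (R.*-cong {im z} {im w} {re u} {re v} q p′)
    ; *-assoc = λ z w u →
        M.re-assoc (re z) (im z) (re w) (im w) (re u) (im u) ,
        M.im-assoc (re z) (im z) (re w) (im w) (re u) (im u)
    ; *-identity = (λ z → M.re-identityˡ (re z) (im z) , M.im-identityˡ (re z) (im z))
                 , (λ z → M.re-identityʳ (re z) (im z) , M.im-identityʳ (re z) (im z))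
    ; distrib = (λ z w u →
          M.re-distribˡ (re z) (im z) (re w) (im w) (re u) (im u) ,
          M.im-distribˡ (re z) (im z) (re w) (im w) (re u) (im u))
      , (λ z w u →
          M.re-distribʳ (re z) (im z) (re w) (im w) (re u) (im u) ,
          M.im-distribʳ (re z) (im z) (re w) (im w) (re u) (im u))
    }
  ; *-comm = λ z w → M.re-comm (re z) (im z) (re w) (im w) , M.im-comm (re z) (im z) (re w) (im w)
  }

ℂ-complexification : Complexification ℝ-archimedeanRing
ℂ-complexification = record
  { ℂ-commutativeRing = record { isCommutativeRing = ℂ-isCommutativeRing }
  ; re = re
  ; im = im
  ; _+i_ = _+i_
  ; re-+i = λ x y → R.refl {x}
  ; im-+i = λ x y → R.refl {y}
  ; ≈ᶜ-intro = _,_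
  ; re-cong = proj₁
  ; im-cong = proj₂
  ; re-+ = λ z w → R.refl {re z + re w}
  ; im-+ = λ z w → R.refl {im z + im w}
  ; re-* = λ z w → R.refl {re (z *ᶜ w)}
  ; im-* = λ z w → R.refl {im (z *ᶜ w)}
  ; re-neg = λ z → R.refl { - re z}
  ; im-neg = λ z → R.refl { - im z}
  ; re-0 = R.refl {0ℝ}
  ; im-0 = R.refl {0ℝ}
  ; re-1 = R.refl {1ℝ}
  ; im-1 = R.refl {0ℝ}
  }

-- From the data of the theorem to the sector argument

-- The terms of `inv` are true reciprocals once those of x are at least η, that is from the index
-- contained in `0<x` on.
x*inv≈1 : ∀ x (0<x : 0ℝ < x) → x * inv x 0<x ≈ 1ℝ
x*inv≈1 x 0<x@(η , 0<η , N , x≥η) = pointwise-≈ {x * inv x 0<x} {1ℝ} (N , λ n N≤n →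
  ≡.trans (ℚ.*-comm (seq x n) _) (RecipLemmas.recip-inverse (seq x n)
    (ℚ.<-≤-trans 0<η (≡.subst (ℚ._≤ seq x n) (ℚ.+-identityˡ η) (x≥η n N≤n)))))

≤-max : ∀ {ℓ} .{{_ : NonZero ℓ}} (r : Vector ℝ ℓ) i → r i ≤ max r
≤-max {suc zero}    r Fin.zero    = R.≤-refl {r Fin.zero}
≤-max {suc (suc ℓ)} r Fin.zero    = pointwise-≤ {r Fin.zero} {max r}
  (0 , λ n _ → ℚ.p≤p⊔q (seq (r Fin.zero) n) (seq (max (tail r)) n))
≤-max {suc (suc ℓ)} r (Fin.suc i) = R.≤-trans {r (Fin.suc i)} {max (tail r)} {max r} (≤-max (tail r) i)
  (pointwise-≤ {max (tail r)} {max r} (0 , λ n _ → ℚ.p≤q⊔p (seq (r Fin.zero) n) (seq (max (tail r)) n)))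

strictMono⇒injective : ∀ {ℓ m} (j : Fin ℓ → Fin m) → (∀ {p q} → p Fin.< q → j p Fin.< j q) →
  ∀ {p q} → j p ≡ j q → p ≡ q
strictMono⇒injective j mono {p} {q} e with Fin.<-cmp p q
... | tri< p<q _ _ = contradiction (mono p<q) (Fin.<-irrefl e)
... | tri≈ _ p≡q _ = p≡q
... | tri> _ _ q<p = contradiction (mono q<p) (Fin.<-irrefl (≡.sym e))

private
  module C = ComplexProperties ℂ-complexification
open SectorTheorem ℂ-complexification using (no-zero-in-sector; negative-coefficient)

sumᶜ≈ : ∀ {m} (f : Vector ℂ m) → sumᶜ f ≈ᶜ C.sumᶜ f
sumᶜ≈ f = C.≈ᶜ-refl {sumᶜ f}

expTerm≈ : ∀ z k → expTerm z k ≈ᶜ C.ι (fromℚ (1/! k)) C.*ᶜ z C.^ᶜ k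
expTerm≈ z k = C.≈ᶜ-refl {expTerm z k}

monomial≈ : ∀ x z k → fromℝ x *ᶜ z ^ᶜ k ≈ᶜ C.ι x C.*ᶜ z C.^ᶜ k
monomial≈ x z k = C.≈ᶜ-refl {fromℝ x *ᶜ z ^ᶜ k}

theorem2p7 : ∀ (π : ℝ) → IsPi π →
    ∀ (n : ℕ) .{{_ : NonZero n}} (a : Vector ℝ (suc n)) (0<aₙ : 0ℝ < a (fromℕ n)) →
    ∀ (ℓ : ℕ) .{{_ : NonZero ℓ}} (j : Vector (Fin (suc n)) ℓ) →
    (∀ {p q} → p Fin.< q → j p Fin.< j q) →
    (∀ k → a k < 0ℝ ⇔ (∃ λ i → j i ≡ k)) →
    ∀ (lam : Vector ℝ ℓ) (0<lam : ∀ i → 0ℝ < lam i) → sum lam ≈ 1ℝ →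
    ∀ (r : Vector ℝ ℓ) →
    (∀ i → IsRoot (n ∸ toℕ (j i)) (∣ a (j i) ∣ / (lam i * a (fromℕ n)) [ 0<-* (lam i) (a (fromℕ n)) (0<lam i) 0<aₙ ]) (r i)) →
    ∀ (z : ℂ) → Sector (max r) (π /ₙ n) z → ¬ (eval a z ≈ᶜ 0ℂ)
theorem2p7 π (h , u , π≈2h , _ , h≤2 , h⇒u , re-u) n a 0<aₙ (suc ℓ) j mono neg lam 0<lam Σlam≈1 r roots
  z (ρ , φ , w , 0<ρ , ∣φ∣<π/n , φ⇒w , z≈) =
  no-zero-in-sector sumᶜ sumᶜ≈ expTerm expTerm≈ {π} {h} {0ℝ +i h} {u} π≈2h h≤2
  (C.≈ᶜ-refl {0ℝ +i h}) h⇒u re-u n a 0<aₙ j (strictMono⇒injective j mono) j<n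
    -- `0ℝ ≤ a k` unfolds to `¬ (a k < 0ℝ)`, so this is a contraposition and no sign is decided.
    (λ k k∉j aₖ<0 → let (i , e) = Equivalence.to (neg k) aₖ<0 in k∉j i e)
    lam r (λ i → R.<⇒≤ {0ℝ} {lam i} (0<lam i)) Σlam≈1 0≤r aⱼ≈
    {max r} {ρ} {φ} {0ℝ +i φ} {w} {z}
    -- v ≥ 0 because v dominates the root at index 0, which exists as ℓ ≥ 1.
    (R.≤-trans {0ℝ} {r Fin.zero} {max r} (0≤r Fin.zero) (≤-max r Fin.zero)) (≤-max r)
    0<ρ ∣φ∣<π/n (C.≈ᶜ-refl {0ℝ +i φ}) φ⇒w z≈
    (λ k → fromℝ (a k) *ᶜ z ^ᶜ toℕ k) (λ k → monomial≈ (a k) z (toℕ k))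
  where
  aₙ : ℝ
  aₙ = a (fromℕ n)
  aⱼ<0 : ∀ i → a (j i) < 0ℝ
  aⱼ<0 i = Equivalence.from (neg (j i)) (i , ≡.refl)
  0≤r : ∀ i → 0ℝ ≤ r i
  0≤r i = proj₁ (roots i)
  j≢n : ∀ i → j i ≢ fromℕ n
  j≢n i e = R.<⇒≤ {0ℝ} {aₙ} 0<aₙ (≡.subst (λ k → a k < 0ℝ) e (aⱼ<0 i))
  j<n : ∀ i → toℕ (j i) ℕ.< n
  j<n i = ℕ.≤∧≢⇒< (ℕ.≤-pred (Fin.toℕ<n (j i)))
    λ e → j≢n i (Fin.toℕ-injective (≡.trans e (≡.sym (Fin.toℕ-fromℕ n))))
  aⱼ≈ : ∀ i → a (j i) ≈ - (lam i * aₙ * r i ^ (n ∸ toℕ (j i)))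
  aⱼ≈ i = negative-coefficient {a (j i)} {lam i * aₙ} {r i ^ (n ∸ toℕ (j i))}
    {inv (lam i * aₙ) (0<-* (lam i) aₙ (0<lam i) 0<aₙ)} (aⱼ<0 i)
    (x*inv≈1 (lam i * aₙ) (0<-* (lam i) aₙ (0<lam i) 0<aₙ)) (proj₂ (roots i))
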